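{- Let $\mathbf M$ be an ascending Motzkin path with $m_1=0$ and let $T_{\mathbf M}$, its edge weights and its lattice paths be as defined in the context. Let $1\le k\le r$ and $n\ge k-1$, and put $A_i=(2i-2,0)$, $E_i=(2n+2k-2i,0)$ for $i=1,\dots,k$. Then $$R_{k,n}=(R_{1,0})^k\sum_{(P_1,\dots,P_k)}\prod_{i=1}^k w(P_i),$$ the sum running over all $k$-tuples of $T_{\mathbf M}$-lattice paths such that $P_i$ goes from $A_i$ to $E_i$ and no two of the paths share a vertex, where $w(P)$ is the product of the weights of the steps of $P$. (For $k=1$ this says $R_{1,n}/R_{1,0}$ is the weighted count of $T_{\mathbf M}$-lattice paths from $(0,0)$ to $(2n,0)$.)
   Context: Fix $r\ge1$, $I_r=\{1,\dots,r\}$, and let $(R_{\alpha,n})$ be the $A_r$ $Q$-system: $R_{0,n}=R_{r+1,n}=1$, $R_{\alpha,n+1}R_{\alpha,n-1}=R_{\alpha,n}^2+R_{\alpha+1,n}R_{\alpha-1,n}$ ($\alpha\in I_r$, $n\in\mathbb Z$), viewed as rational functions of $2r$ algebraically independent initial values. An ascending Motzkin path is $\mathbf M=(m_1,\dots,m_r)\in\mathbb Z^r$ with $m_{\alpha+1}-m_\alpha\in\{0,1\}$; here $m_1=0$. Its initial data are $R_{\alpha,m_\alpha},R_{\alpha,m_\alpha+1}$ ($\alpha\in I_r$). Weights: with $\lambda_{\alpha,n}=R_{\alpha,n+1}/R_{\alpha,n}$ and $\mu_{\alpha,n}=R_{\alpha,n}/R_{\alpha-1,n}$ (so $\lambda_{0,n}=\lambda_{r+1,n}=1$),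 and any value for $m_0,m_{r+1}$, set $y_{2\alpha-1}=\lambda_{\alpha,m_\alpha}/\lambda_{\alpha-1,m_{\alpha-1}}$ for $1\le\alpha\le r+1$ and $y_{2\alpha}=\mu_{\alpha+1,m_\alpha+1}/\mu_{\alpha,m_\alpha}$ for $1\le\alpha\le r$. The tree $T_{\mathbf M}$: let $H=\{\alpha\in\{2,\dots,r\}: m_\alpha=m_{\alpha-1}\}$, $s=|H|$, $N=2r+1-s$. It has $2r+1$ edges labelled $1,\dots,2r+1$; edge $2\alpha-1$ with $\alpha\in H$ is called horizontal, all others vertical. The $N$ vertical edges, in increasing order of label, form a path with vertices $v_0,v_1,\dots,v_N$ (the $k$-th vertical edge joins $v_{k-1}$ and $v_k$; $v_k$ has height $k$). For each $\alpha\in H$ the horizontal edge $2\alpha-1$ joins a new leaf vertex to the upper endpoint of edge $2\alpha-2$. Traversing edge $e$ toward $v_0$ (from $v_k$ to $v_{k-1}$, or from a leaf to the chain) has weight $y_e$; traversing it away from $v_0$ has weight $1$. $T_{\mathbf M}$-lattice paths: sequences of lattice points of $\mathbb Z^2$ with heights in $[0,N]$, using steps $(x,h)\to(x+1,h+1)$ (weight $1$, allowed if $h<N$), $(x,h)\to(x+1,h-1)$ (weight $y_e$ for the vertical edge $e$ joining $v_{h-1},v_h$), and $(x,h)\to(x+2,h)$ (allowed only if a horizontal edge $e$ is attached at $v_h$, weight $y_e$). The vertices of a path are the endpoints of its steps. -}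

module Defs where

open import Algebra.Bundles using (CommutativeRing)
import Algebra.Properties.Semiring.Exp as Exp
import Algebra.Properties.Semiring.Mult as Mult
open import Data.Fin.Base using (Fin; toℕ)
open import Data.Integer.Base as ℤ using (ℤ; +_; -[1+_])
import Data.Integer.Properties as ℤₚ
open import Data.List.Base as List using (List; []; _∷_; length; filter; applyUpTo; lookup)
open import Data.List.Membership.Propositional using (_∈_)
open import Data.List.Relation.Binary.Disjoint.Propositional using (Disjoint)
open import Data.List.Relation.Unary.All using (All)
open import Data.List.Relation.Unary.Unique.Propositional using (Unique)
open import Data.Nat.Base as ℕ using (ℕ; zero; suc; _≤_; _<_; _∸_; ⌊_/2⌋; ⌈_/2⌉; parity)
import Data.Nat.Properties as ℕₚ
open import Data.List.Membership.DecPropositional ℕₚ._≟_ using (_∈?_)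
open import Data.Parity.Base using (0ℙ; 1ℙ)
open import Data.Product.Base using (_×_; _,_)
open import Data.Sum.Base using (_⊎_)
open import Data.Vec.Base as Vec using (Vec; []; _∷_)
open import Function.Bundles using (_⇔_)
open import Level using (_⊔_) renaming (suc to lsuc)
open import Relation.Binary.PropositionalEquality.Core using (_≡_; _≢_)
open import Relation.Nullary.Decidable.Core using (¬?)
open import Relation.Nullary.Negation.Core using (¬_)

-- The inverse is a total function whose value at 0# is unspecified.
record Field c ℓ : Set (lsuc (c ⊔ ℓ)) where
  infix 8 _⁻¹
  infixl 7 _÷_
  field
    commutativeRing : CommutativeRing c ℓ
  open CommutativeRing commutativeRing public
  field
    _⁻¹      : Carrier → Carrier
    ⁻¹-cong  : ∀ {x y} → x ≈ y → x ⁻¹ ≈ y ⁻¹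
    inverseʳ : ∀ x → ¬ x ≈ 0# → x * x ⁻¹ ≈ 1#
    1≉0      : ¬ 1# ≈ 0#

  _÷_ : Carrier → Carrier → Carrier
  x ÷ y = x * y ⁻¹

  open Exp semiring public using (_^_)

-- ℤ[x₁,…,xₙ] as iterated univariate polynomials: an element of Poly (suc n)
-- is its list of coefficients in the first variable, constant term first.
-- Trailing zero coefficients are allowed, so being the zero polynomial is
-- the predicate IsZero.
Poly : ℕ → Set
Poly zero    = ℤ
Poly (suc n) = List (Poly n)

IsZero : ∀ {n} → Poly n → Set
IsZero {zero}  c  = c ≡ + 0
IsZero {suc n} cs = All (IsZero {n}) cs

module _ {c ℓ} (K : Field c ℓ) where
  open Field K
  open Mult semiring using () renaming (_×_ to _·_)

  fromℤ : ℤ → Carrier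
  fromℤ (+ n)    = n · 1#
  fromℤ -[1+ n ] = - (suc n · 1#)

  eval : ∀ {n} → Vec Carrier n → Poly n → Carrier
  eval []       p = fromℤ p
  eval (x ∷ xs) p = List.foldr (λ q acc → eval xs q + x * acc) 0# p

  -- Independence over ℤ, equivalently over ℚ (in particular K has
  -- characteristic zero).
  AlgebraicallyIndependent : ∀ {n} → Vec Carrier n → Set ℓ
  AlgebraicallyIndependent {n} xs = ∀ (p : Poly n) → eval xs p ≈ 0# → IsZero p

  -- Only the values R α n with α ≤ r + 1 are meaningful.
  record IsQSystem (r : ℕ) (R : ℕ → ℤ → Carrier) : Set ℓ where
    field
      left-boundary  : ∀ n → R 0 n ≈ 1#
      right-boundary : ∀ n → R (suc r) n ≈ 1#
      recursion      : ∀ α n → 1 ≤ α → α ≤ r →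
        R α (n ℤ.+ + 1) * R α (n ℤ.- + 1) ≈ R α n * R α n + R (suc α) n * R (α ∸ 1) n

-- A path (m₁,…,m_r) is a function on ℕ of which only the values at 1,…,r
-- are constrained; m 0 and m (r + 1) are thus arbitrary.
AscendingMotzkin : ℕ → (ℕ → ℤ) → Set
AscendingMotzkin r m = ∀ α → 1 ≤ α → α < r →
  m (suc α) ≡ m α ⊎ m (suc α) ≡ m α ℤ.+ + 1

module _ {c ℓ} (K : Field c ℓ) (r : ℕ) (R : ℕ → ℤ → Field.Carrier K) (m : ℕ → ℤ) where
  open Field K

  initialData : Vec Carrier (r ℕ.+ r)
  initialData = Vec.tabulate (λ i → let α = suc (toℕ {r} i) in R α (m α))
         Vec.++ Vec.tabulate (λ i → let α = suc (toℕ {r} i) in R α (m α ℤ.+ + 1))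

module Weights {c ℓ} (K : Field c ℓ) (R : ℕ → ℤ → Field.Carrier K) (m : ℕ → ℤ) where
  open Field K

  lam : ℕ → ℤ → Carrier
  lam α n = R α (n ℤ.+ + 1) ÷ R α n

  mu : ℕ → ℤ → Carrier
  mu α n = R α n ÷ R (α ∸ 1) n

  y-odd : ℕ → Carrier
  y-odd α = lam α (m α) ÷ lam (α ∸ 1) (m (α ∸ 1))

  y-even : ℕ → Carrier
  y-even α = mu (suc α) (m α ℤ.+ + 1) ÷ mu α (m α)

  -- The label is e = 2α - 1 with α = ⌈ e /2⌉, or e = 2α with α = ⌊ e /2⌋.
  y : ℕ → Carrier
  y e with parity e
  ... | 1ℙ = y-odd ⌈ e /2⌉
  ... | 0ℙ = y-even ⌊ e /2⌋

module Tree (r : ℕ) (m : ℕ → ℤ) where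

  H : List ℕ
  H = filter (λ α → m α ℤₚ.≟ m (α ∸ 1)) (applyUpTo (2 ℕ.+_) (r ∸ 1))

  s : ℕ
  s = length H

  N : ℕ
  N = 2 ℕ.* r ℕ.+ 1 ∸ s

  edges : List ℕ
  edges = applyUpTo suc (2 ℕ.* r ℕ.+ 1)

  horizontalEdges : List ℕ
  horizontalEdges = List.map (λ α → 2 ℕ.* α ∸ 1) H

  verticalEdges : List ℕ
  verticalEdges = filter (λ e → ¬? (e ∈? horizontalEdges)) edges

  -- v k is the chain vertex of height k; leaf α is the free end of the
  -- horizontal edge 2α - 1.
  data Vertex : Set where
    v    : ℕ → Vertex
    leaf : ℕ → Vertex

  -- Edge e u w: the edge labelled e joins u and w, with u on the v 0 side.
  data Edge (e : ℕ) : Vertex → Vertex → Set where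
    vertical   : ∀ {k} (i : Fin (length verticalEdges)) →
                 toℕ i ≡ k → lookup verticalEdges i ≡ e →
                 Edge e (v k) (v (suc k))
    horizontal : ∀ {α k} → α ∈ H → e ≡ 2 ℕ.* α ∸ 1 →
                 Edge (2 ℕ.* α ∸ 2) (v k) (v (suc k)) →
                 Edge e (v (suc k)) (leaf α)

-- All paths considered start at a non-negative abscissa and abscissas
-- increase along a path, so ℕ × ℕ suffices for the lattice points (x , h).
Point : Set
Point = ℕ × ℕ

-- Steps carry the label of the tree edge they use; IsPath below forces it to
-- be the edge at the height in question, so a path is determined by its points.
data Step : Set where
  up   : Step
  down : (e : ℕ) → Step
  flat : (e : ℕ) → Step

module LatticePaths (r : ℕ) (m : ℕ → ℤ) where
  open Tree r m

  data IsPath : Point → List Step → Point → Set where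
    stop  : ∀ {x h} → h ≤ N → IsPath (x , h) [] (x , h)
    up∷   : ∀ {x h ss q} → h < N →
            IsPath (suc x , suc h) ss q → IsPath (x , h) (up ∷ ss) q
    down∷ : ∀ {x h e ss q} → Edge e (v h) (v (suc h)) →
            IsPath (suc x , h) ss q → IsPath (x , suc h) (down e ∷ ss) q
    flat∷ : ∀ {x h e α ss q} → Edge e (v h) (leaf α) →
            IsPath (suc (suc x) , h) ss q → IsPath (x , h) (flat e ∷ ss) q

vertices : Point → List Step → List Point
vertices p       []            = p ∷ []
vertices (x , h) (up ∷ ss)     = (x , h) ∷ vertices (suc x , suc h) ss
vertices (x , h) (down e ∷ ss) = (x , h) ∷ vertices (suc x , h ∸ 1) ss
vertices (x , h) (flat e ∷ ss) = (x , h) ∷ vertices (suc (suc x) , h) ss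

A : ℕ → Point
A i = 2 ℕ.* i ∸ 2 , 0

E : (k n i : ℕ) → Point
E k n i = 2 ℕ.* n ℕ.+ 2 ℕ.* k ∸ 2 ℕ.* i , 0

-- Entry i : Fin k of the tuple is the path number toℕ i + 1.
record NonIntersecting (r : ℕ) (m : ℕ → ℤ) (k n : ℕ) (P : Vec (List Step) k) : Set where
  open LatticePaths r m
  field
    isPath   : ∀ i → IsPath (A (suc (toℕ i))) (Vec.lookup P i) (E k n (suc (toℕ i)))
    disjoint : ∀ i j → i ≢ j →
      Disjoint (vertices (A (suc (toℕ i))) (Vec.lookup P i))
               (vertices (A (suc (toℕ j))) (Vec.lookup P j))

-- L lists the elements satisfying P, each exactly once.
record Enumerates {a p} {X : Set a} (L : List X) (P : X → Set p) : Set (a ⊔ p) where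
  field
    unique : Unique L
    exact  : ∀ x → x ∈ L ⇔ P x

module _ {c ℓ} (K : Field c ℓ) where
  open Field K

  sum : List Carrier → Carrier
  sum = List.foldr _+_ 0#

  product : List Carrier → Carrier
  product = List.foldr _*_ 1#

module PathWeights {c ℓ} (K : Field c ℓ) (R : ℕ → ℤ → Field.Carrier K) (m : ℕ → ℤ) where
  open Field K
  open Weights K R m

  stepWeight : Step → Carrier
  stepWeight up       = 1#
  stepWeight (down e) = y e
  stepWeight (flat e) = y e

  pathWeight : List Step → Carrier
  pathWeight ss = product K (List.map stepWeight ss)

  tupleWeight : ∀ {k} → Vec (List Step) k → Carrier
  tupleWeight P = product K (List.map pathWeight (Vec.toList P))

{-# OPTIONS --safe #-}
module Submission where

open import Defs
open import Data.Integer.Base using (ℤ; +_)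
open import Data.List.Base using (map)
open import Data.Nat.Base using (ℕ; _≤_; _∸_)
open import Data.Product.Base using (_×_; ∃-syntax)
open import Relation.Binary.PropositionalEquality.Core using (_≡_)

import Algebra.Properties.CommutativeSemigroup as CommutativeSemigroupProperties
import Algebra.Properties.Semiring.Mult as Mult
open import Data.Empty using (⊥)
open import Data.Fin.Base as Fin using (Fin; zero; suc; toℕ; fromℕ; fromℕ<; inject₁; _↑ˡ_; _↑ʳ_)
import Data.Fin.Properties as Finₚ
open import Data.Fin.Relation.Unary.Top using (view; ‵fromℕ; ‵inject₁)
open import Data.Integer.Base as ℤ using (-[1+_]; ∣_∣)
import Data.Integer.Properties as ℤₚ
import Data.Integer.Tactic.RingSolver as ℤSolver
open import Data.List.Base as List using (List; []; _∷_; _++_; length; filter; applyUpTo)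
import Data.List.Properties as Listₚ
open import Data.List.Membership.Propositional using (_∈_; _∉_)
open import Data.List.Membership.Propositional.Properties using (∈-map⁺; ∈-map⁻; ∈-filter⁺; ∈-filter⁻; ∈-applyUpTo⁺; ∈-applyUpTo⁻; ∈-++⁺ˡ; ∈-++⁺ʳ; ∈-++⁻)
open import Data.List.Relation.Binary.Disjoint.Propositional using (Disjoint)
open import Data.List.Relation.Unary.All as All using ([]; _∷_)
open import Data.List.Relation.Unary.AllPairs using ([]; _∷_)
open import Data.List.Relation.Unary.Any using (here; there)
open import Data.List.Relation.Unary.Unique.Propositional using (Unique)
import Data.List.Relation.Unary.Unique.Propositional.Properties as Unique
open import Data.Maybe.Base using (Maybe; just; nothing; maybe′)
open import Data.Maybe.Properties using (just-injective)
open import Data.Nat.Base as ℕ using (zero; suc; _<_; s≤s; z≤n; ⌊_/2⌋; parity)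
open import Data.Nat.Induction using (<-rec)
import Data.Nat.Properties as ℕₚ
import Data.Nat.Tactic.RingSolver as ℕSolver
open import Data.Parity.Base using (0ℙ; 1ℙ)
open import Data.Product.Base using (_,_; proj₁; proj₂)
open import Data.Product.Properties using (≡-dec)
open import Data.Sum.Base using (_⊎_; inj₁; inj₂; [_,_]′)
open import Data.Unit.Base using (⊤; tt)
open import Data.Vec.Base as Vec using (Vec; []; _∷_; _∷ʳ_; _[_]≔_; lookup; tabulate; updateAt)
import Data.Vec.Properties as Vecₚ
open import Data.Vec.Relation.Binary.Pointwise.Inductive as Pointwise using (Pointwise; []; _∷_)
open import Function.Base using (_∘_)
open import Function.Bundles using (_⇔_; mk⇔; Equivalence)
import Level
open import Relation.Binary.PropositionalEquality as ≡ using (_≢_)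
open import Relation.Nullary.Decidable.Core using (Dec; yes; no; ¬?; _×-dec_)
open import Relation.Nullary.Negation.Core using (¬_; contradiction)

-- The proof rests on three facts.
--
-- Moments.  On a chain, two consecutive steps between vertices of even height
-- involve only the sums y(2j+1) + y(2j+2) and the products y(2j) y(2j+1).  The
-- Q-system says that these are unchanged when a horizontal edge is straightened
-- (and the rest of the Motzkin path raised by one), and that dropping the first
-- edge amounts to a translation of n.  Hence R(1,0) times the weighted number of
-- paths from (0,0) to (2j,0) is R(1,j) for every tree T_M.
--
-- Lindström–Gessel–Viennot.  The sum over disjoint tuples is the determinant of
-- the matrix of path counts, a Hankel matrix in the R(1,j).
--
-- Hankel determinant.  In the chain of the path m(α) = t + α - 1 the Hankel
-- matrix starting at R(1,t) reduces by unitriangular row operations to a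
-- triangular one, with pivots R(j+1,t+j) / R(j,t+j-1).  Their product telescopes
-- to R(k,t+k-1), and t = n - k + 1 gives R(k,n).
--
-- Divisions are legitimate because every R(α,n) is a subtraction-free rational
-- function of the initial data, hence not zero by algebraic independence.

-- Trees of different Motzkin paths have chains of different lengths, and their flat steps last two
-- columns, so they cannot be matched step by step. They agree only when watched every second column
-- at even heights. To straighten an edge deep inside a tree while all that lies below it stays
-- fixed, the comparison is made for an arbitrary contribution entering at height 0; the
-- straightening then runs from the top of the tree downwards. The translation of n is an instance
-- of the same move: once the first edge is dropped, visits to height 0 become flat steps, which
-- look like a horizontal edge labelled 1 because λ(0,n) = 1. The determinant is treated as an
-- alternating multilinear function of its rows, without permutations. The disjoint tuples satisfy
-- the same recursion as the determinant, so their list and the value of their sum are built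
-- together and no sign-reversing involution occurs. Planarity enters through cones: two disjoint
-- paths keep one point inside the downward cone of the other, and the parity of x + h leaves just
-- enough room for a step of length two.

double : ℕ → ℕ
double zero    = 0
double (suc j) = 2 ℕ.+ double j

Levels : Set
Levels = List (Maybe ℕ × ℕ)

-- The parts of T_M, bottom to top: a level is the label of the horizontal
-- edge at a chain vertex, if any, and the label of the vertical edge above it.
blocks : (ℕ → ℤ) → ℕ → ℕ → Levels
blocks m zero    a = (nothing , suc (double a)) ∷ []
blocks m (suc j) a with m (suc a) ℤₚ.≟ m a
... | yes _ = (just (suc (double a)) , double (suc a)) ∷ blocks m j (suc a)
... | no _  = (nothing , suc (double a)) ∷ (nothing , double (suc a)) ∷ blocks m j (suc a)

parity-double : ∀ a → parity (double a) ≡ 0ℙ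
parity-double zero    = ≡.refl
parity-double (suc a) = parity-double a

parity-odd : ∀ a → parity (suc (double a)) ≡ 1ℙ
parity-odd zero    = ≡.refl
parity-odd (suc a) = parity-odd a

⌊double/2⌋ : ∀ a → ⌊ double a /2⌋ ≡ a
⌊double/2⌋ zero    = ≡.refl
⌊double/2⌋ (suc a) = ≡.cong suc (⌊double/2⌋ a)

-- Lattice paths in the plane

module LatticeGeometry where
  open import Data.Nat.Base using (_+_)
  open import Data.Nat.Properties
  open import Data.Nat.Tactic.RingSolver using (solve-∀)
  open import Relation.Binary.PropositionalEquality using (refl; sym; trans; cong; subst; subst₂)

  move : Point → Step → Point
  move (x , h) up       = suc x , suc h
  move (x , h) (down e) = suc x , h ∸ 1
  move (x , h) (flat e) = suc (suc x) , h

  vertices-∷ : ∀ p s ss → vertices p (s ∷ ss) ≡ p ∷ vertices (move p s) ss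
  vertices-∷ p up       ss = refl
  vertices-∷ p (down e) ss = refl
  vertices-∷ p (flat e) ss = refl

  move-advances : ∀ p s → proj₁ p < proj₁ (move p s)
  move-advances p up       = ≤-refl
  move-advances p (down e) = ≤-refl
  move-advances p (flat e) = m<n⇒m<1+n ≤-refl

  start∈vertices : ∀ p ss → p ∈ vertices p ss
  start∈vertices p []       = here refl
  start∈vertices p (s ∷ ss) = subst (p ∈_) (sym (vertices-∷ p s ss)) (here refl)

  later-vertex : ∀ {q} p ss → q ∈ vertices p ss → q ≡ p ⊎ proj₁ p < proj₁ q
  later-vertex p []       (here q≡p) = inj₁ q≡p
  later-vertex p (s ∷ ss) q∈ with subst (_ ∈_) (vertices-∷ p s ss) q∈
  ... | here q≡p  = inj₁ q≡p
  ... | there q∈′ with later-vertex (move p s) ss q∈′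
  ...   | inj₁ refl = inj₂ (move-advances p s)
  ...   | inj₂ lt   = inj₂ (<-trans (move-advances p s) lt)

  -- The steps available at a point form a finite list. A sum over first steps then makes sense, and
  -- the determinant argument need not know the tree.
  data Path (steps : Point → List Step) : Point → List Step → Point → Set where
    done : ∀ {p} → Path steps p [] p
    step : ∀ {p q s ss} → s ∈ steps p → Path steps (move p s) ss q → Path steps p (s ∷ ss) q

  path-advances : ∀ {steps p ss q} → Path steps p ss q → proj₁ p ≤ proj₁ q
  path-advances done             = ≤-refl
  path-advances (step {p} {s = s} _ path) = ≤-trans (<⇒≤ (move-advances p s)) (path-advances path)

  path-to-itself : ∀ {steps p ss} → Path steps p ss p → ss ≡ []
  path-to-itself done                      = refl
  path-to-itself (step {p} {s = s} _ path) = contradiction (path-advances path) (<⇒≱ (move-advances p s))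

  Even : ℕ → Set
  Even n = ∃[ c ] n ≡ c + c

  even+even : ∀ {m n} → Even m → Even n → Even (m + n)
  even+even (c , refl) (d , refl) = c + d , lemma c d
    where
    lemma : ∀ c d → c + c + (d + d) ≡ c + d + (c + d)
    lemma = solve-∀

  -- Lattice points have even x + h, so two points on different diagonals are at least 2 apart, and
  -- 2 is the most that a step can change. This is why paths cannot cross without sharing a vertex.
  even-gap : ∀ {m n} → m < n → Even (m + n) → 2 + m ≤ n
  even-gap {m} {n} m<n (c , eq) with m≤n⇒m<n∨m≡n m<n
  ... | inj₁ lt   = lt
  ... | inj₂ refl = contradiction eq (odd m c)
    where
    odd : ∀ m c → m + suc m ≢ c + c
    odd zero    (suc c) eq with trans (suc-injective eq) (+-suc c c)
    ... | ()
    odd (suc m) (suc c) eq = odd m c (suc-injective (suc-injective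
      (trans (cong suc (sym (+-suc m (suc m)))) (trans eq (cong suc (+-suc c c))))))

  -- Lattice points visited by two disjoint paths, the first one above the
  -- second one; the slack in the last condition allows for paths that have not
  -- yet left their starting point, which lies at an abscissa ≤ X.
  record Above (X : ℕ) (p q : Point) : Set where
    constructor above
    field
      diagonal     : proj₂ q + proj₁ p ≤ proj₂ p + proj₁ q
      antidiagonal : (proj₂ q ≡ 0 × proj₁ q ≤ X) ⊎ proj₁ q + proj₂ q ≤ proj₁ p + proj₂ p

  OnGrid : Point → Set
  OnGrid (x , h) = Even (x + h)

  NoDescentBelow0 : Point → Step → Set
  NoDescentBelow0 (x , h) (down e) = 1 ≤ h
  NoDescentBelow0 p       _        = ⊤

  move-onGrid : ∀ p s → NoDescentBelow0 p s → OnGrid p → OnGrid (move p s)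
  move-onGrid (x , h)     up       _ (c , eq) = suc c , cong suc (trans (+-suc x h) (trans (cong suc eq) (sym (+-suc c c))))
  move-onGrid (x , suc h) (down e) _ (c , eq) = c , trans (sym (+-suc x h)) eq
  move-onGrid (x , h)     (flat e) _ (c , eq) = suc c , cong suc (trans (cong suc eq) (sym (+-suc c c)))

  private
    even-sum : ∀ {x h x′ h′} → OnGrid (x , h) → OnGrid (x′ , h′) → Even (h′ + x + (h + x′))
    even-sum {x} {h} {x′} {h′} e e′ = subst Even (lemma x h x′ h′) (even+even e e′)
      where
      lemma : ∀ x h x′ h′ → x + h + (x′ + h′) ≡ h′ + x + (h + x′)
      lemma = solve-∀

  -- Apart from its slack, `Above X p q` says that q lies in the cone with slopes ±1 hanging down
  -- from p. Moving p can only hurt `diagonal`, by at most 2. There is room for 2 unless p and q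
  -- share a diagonal, and then either alternative of `antidiagonal`, with x ≤ x′, forces p = q.
  move-upper : ∀ {X} p q s → OnGrid p → OnGrid q → NoDescentBelow0 p s → p ≢ q → proj₁ p ≤ proj₁ q →
    Above X p q → Above X (move p s) q
  move-upper {X} p@(x , h) q@(x′ , h′) s ep eq ok p≢q x≤x′ (above diag anti) =
    above (diag′ s ok) ([ inj₁ , (λ le → inj₂ (≤-trans le (anti′ s ok))) ]′ anti)
    where
    strict : h′ + x ≢ h + x′
    strict eq = [ case₁ , case₂ ]′ anti
      where
      coincide : x ≡ x′ → ⊥
      coincide refl = p≢q (cong (x ,_) (sym (+-cancelʳ-≡ x h′ h eq)))
      case₁ : h′ ≡ 0 × x′ ≤ X → ⊥
      case₁ (refl , _) = coincide (≤-antisym x≤x′ (subst (x′ ≤_) (sym eq) (m≤n+m x′ h)))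
      case₂ : x′ + h′ ≤ x + h → ⊥
      case₂ le = coincide (≤-antisym x≤x′ (≮⇒≥ λ x<x′ → <⇒≱ (+-mono-< x<x′ x<x′) (+-cancelʳ-≤ (h + h′) _ _
        (subst₂ _≤_ (lhs x′ h h′) (rhs x h h′) (subst (λ z → x′ + h′ + (h + x′) ≤ x + h + z) (sym eq) (+-monoˡ-≤ (h + x′) le))))))
        where
        lhs : ∀ x′ h h′ → x′ + h′ + (h + x′) ≡ x′ + x′ + (h + h′)
        lhs = solve-∀
        rhs : ∀ x h h′ → x + h + (h′ + x) ≡ x + x + (h + h′)
        rhs = solve-∀
    gap : 2 + (h′ + x) ≤ h + x′
    gap = even-gap (≤∧≢⇒< diag strict) (even-sum {x} {h} {x′} {h′} ep eq)
    diag′ : ∀ s → NoDescentBelow0 p s → h′ + proj₁ (move p s) ≤ proj₂ (move p s) + x′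
    diag′ up       ok = subst (_≤ suc (h + x′)) (sym (+-suc h′ x)) (s≤s diag)
    diag′ (down e) ok = subst₂ _≤_ (sym (+-suc h′ x)) (+-∸-comm x′ ok) (∸-monoˡ-≤ 1 gap)
    diag′ (flat e) ok = subst (_≤ h + x′) (sym (trans (+-suc h′ (suc x)) (cong suc (+-suc h′ x)))) gap
    anti′ : ∀ s → NoDescentBelow0 p s → x + h ≤ proj₁ (move p s) + proj₂ (move p s)
    anti′ up       ok = ≤-trans (+-monoʳ-≤ x (n≤1+n h)) (n≤1+n _)
    anti′ (down e) ok = ≤-reflexive (trans (cong (x ℕ.+_) (sym (m+[n∸m]≡n ok))) (+-suc x (h ∸ 1)))
    anti′ (flat e) ok = m≤n+m (x + h) 2

  -- Now only `antidiagonal` can suffer, again by at most 2. The gap comes from `diagonal` and x ≤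
  -- x′ alone, so it is available even to a point still at its start; after its first step that
  -- point no longer relies on the slack.
  move-lower : ∀ {X} p q s → OnGrid p → OnGrid q → NoDescentBelow0 p s → p ≢ q → proj₁ p ≤ proj₁ q →
    Above X q p → Above X q (move p s)
  move-lower {X} p@(x , h) q@(x′ , h′) s ep eq ok p≢q x≤x′ (above diag anti) = above (diag′ s) (inj₂ (anti′ s ok))
    where
    gap : 2 + (x + h) ≤ x′ + h′
    gap with m≤n⇒m<n∨m≡n x≤x′
    ... | inj₁ x<x′ = +-cancelʳ-≤ (x + x′) _ _ (subst₂ _≤_ (lhs x h x′) (rhs x x′ h′) (+-mono-≤ (+-mono-≤ x<x′ x<x′) diag))
      where
      lhs : ∀ x h x′ → suc x + suc x + (h + x′) ≡ 2 + (x + h) + (x + x′)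
      lhs = solve-∀
      rhs : ∀ x x′ h′ → x′ + x′ + (h′ + x) ≡ x′ + h′ + (x + x′)
      rhs = solve-∀
    ... | inj₂ refl = even-gap
      (+-monoʳ-< x (≤∧≢⇒< (+-cancelʳ-≤ x h h′ diag) (λ h≡h′ → p≢q (cong (x ,_) h≡h′))))
      (even+even ep eq)
    diag′ : ∀ s → proj₂ (move p s) + x′ ≤ h′ + proj₁ (move p s)
    diag′ up       = subst (suc (h + x′) ≤_) (sym (+-suc h′ x)) (s≤s diag)
    diag′ (down e) = ≤-trans (+-monoˡ-≤ x′ (m∸n≤m h 1)) (≤-trans diag (+-monoʳ-≤ h′ (n≤1+n x)))
    diag′ (flat e) = ≤-trans diag (+-monoʳ-≤ h′ (m≤n+m x 2))
    anti′ : ∀ s → NoDescentBelow0 p s → proj₁ (move p s) + proj₂ (move p s) ≤ x′ + h′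
    anti′ up       ok = subst (_≤ x′ + h′) (sym (cong suc (+-suc x h))) gap
    anti′ (down e) ok = ≤-trans (≤-reflexive (sym (trans (cong (x ℕ.+_) (sym (m+[n∸m]≡n ok))) (+-suc x (h ∸ 1))))) (≤-trans (m≤n+m _ 2) gap)
    anti′ (flat e) ok = gap

  record DisjointPaths (steps : Point → List Step) (T : ℕ → ℕ) {k} (ps : Vec Point k) (P : Vec (List Step) k) : Set where
    field
      isPath   : ∀ i → Path steps (lookup ps i) (lookup P i) (T (toℕ i) , 0)
      disjoint : ∀ i j → i ≢ j → Disjoint (vertices (lookup ps i) (lookup P i)) (vertices (lookup ps j) (lookup P j))

  record Admissible (X : ℕ) {k} (ps : Vec Point k) : Set where
    field
      onGrid   : ∀ i → OnGrid (lookup ps i)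
      distinct : ∀ i j → i ≢ j → lookup ps i ≢ lookup ps j
      ordered  : ∀ i j → i Fin.< j → Above X (lookup ps i) (lookup ps j)

open LatticeGeometry

-- The tree T_M

module TreeShape where
  open import Data.Nat.Base using (_+_; _*_)
  open import Data.Nat.Properties
  open import Data.List.Membership.DecPropositional _≟_ using (_∈?_)
  open import Relation.Binary.PropositionalEquality using (refl; sym; trans; cong; cong₂; subst)

  double-injective : ∀ {a b} → double a ≡ double b → a ≡ b
  double-injective {zero}  {zero}  eq = refl
  double-injective {suc a} {suc b} eq = cong suc (double-injective (suc-injective (suc-injective eq)))

  odd≢even : ∀ a b → suc (double a) ≢ double b
  odd≢even (suc a) (suc b) eq = odd≢even a b (suc-injective (suc-injective eq))

  2*≡double : ∀ a → 2 * a ≡ double a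
  2*≡double zero    = refl
  2*≡double (suc a) = cong suc (trans (+-suc a (a + 0)) (cong suc (2*≡double a)))

  odd-label : ∀ a → 2 * suc a ∸ 1 ≡ suc (double a)
  odd-label a = cong (_∸ 1) (2*≡double (suc a))

  even-label : ∀ a → 2 * suc a ∸ 2 ≡ double a
  even-label a = cong (_∸ 2) (2*≡double (suc a))

  -- `applyUpTo` recurses by composing its function with `suc`. Here the current label stays visible
  -- as a number, in step with the recursion of `blocks`.
  interval : ℕ → ℕ → List ℕ
  interval zero    a = []
  interval (suc n) a = a ∷ interval n (suc a)

  applyUpTo≡interval : ∀ f n a → (∀ i → f i ≡ a + i) → applyUpTo f n ≡ interval n a
  applyUpTo≡interval f zero    a eq = refl
  applyUpTo≡interval f (suc n) a eq = cong₂ _∷_ (trans (eq 0) (+-identityʳ a))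
    (applyUpTo≡interval (f ∘ suc) n (suc a) (λ i → trans (eq (suc i)) (+-suc a i)))

  nth : ∀ {a} {X : Set a} → List X → ℕ → Maybe X
  nth []       k       = nothing
  nth (x ∷ xs) zero    = just x
  nth (x ∷ xs) (suc k) = nth xs k

  nth-complete : ∀ {a} {X : Set a} (xs : List X) i → nth xs (toℕ i) ≡ just (List.lookup xs i)
  nth-complete (x ∷ xs) zero    = refl
  nth-complete (x ∷ xs) (suc i) = nth-complete xs i

  nth-sound : ∀ {a} {X : Set a} (xs : List X) k {x} → nth xs k ≡ just x → ∃[ i ] toℕ i ≡ k × List.lookup xs i ≡ x
  nth-sound (x ∷ xs) zero    refl = zero , refl , refl
  nth-sound (x ∷ xs) (suc k) eq with nth-sound xs k eq
  ... | i , refl , eq′ = suc i , refl , eq′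

  nth-beyond : ∀ {a} {X : Set a} (xs : List X) k → length xs ≤ k → nth xs k ≡ nothing
  nth-beyond []       k       _         = refl
  nth-beyond (x ∷ xs) (suc k) (s≤s len) = nth-beyond xs k len

  downAt : Levels → ℕ → Maybe ℕ
  downAt ls = nth (List.map proj₂ ls)

  flatAt : Levels → ℕ → Maybe ℕ
  flatAt []             h       = nothing
  flatAt ((e , _) ∷ ls) zero    = e
  flatAt (_ ∷ ls)       (suc h) = flatAt ls h

  flatAt-beyond : ∀ ls h → length ls ≤ h → flatAt ls h ≡ nothing
  flatAt-beyond []       h       _         = refl
  flatAt-beyond (_ ∷ ls) (suc h) (s≤s len) = flatAt-beyond ls h len

  module Shape (r′ : ℕ) (m : ℕ → ℤ) where
    private
      r : ℕ
      r = suc r′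
    open Tree r m

    -- Edges 1 and 2 are vertical for every path because H starts at 2, so `blocks` takes over at a
    -- = 1.
    levels : Levels
    levels = (nothing , 1) ∷ (nothing , 2) ∷ blocks m r′ 1

    ∈H⇒ : ∀ {α} → α ∈ H → ∃[ a ] α ≡ suc a × 1 ≤ a × a < r × m (suc a) ≡ m a
    ∈H⇒ α∈ with ∈-filter⁻ (λ α → m α ℤₚ.≟ m (α ∸ 1)) {xs = applyUpTo (2 ℕ.+_) r′} α∈
    ... | α∈′ , eq with ∈-applyUpTo⁻ (2 ℕ.+_) {n = r′} α∈′
    ...   | i , i<r′ , refl = suc i , refl , s≤s z≤n , s≤s i<r′ , eq

    ⇒∈H : ∀ {a} → 1 ≤ a → a < r → m (suc a) ≡ m a → suc a ∈ H
    ⇒∈H {suc a} _ (s≤s a<r′) eq = ∈-filter⁺ (λ α → m α ℤₚ.≟ m (α ∸ 1)) (∈-applyUpTo⁺ (2 ℕ.+_) a<r′) eq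

    ∈horizontal⇒ : ∀ {e} → e ∈ horizontalEdges → ∃[ a ] e ≡ suc (double a) × 1 ≤ a × a < r × m (suc a) ≡ m a
    ∈horizontal⇒ e∈ with ∈-map⁻ (λ α → 2 * α ∸ 1) e∈
    ... | α , α∈ , refl with ∈H⇒ α∈
    ...   | a , refl , rest = a , odd-label a , rest

    ⇒∈horizontal : ∀ {a} → 1 ≤ a → a < r → m (suc a) ≡ m a → suc (double a) ∈ horizontalEdges
    ⇒∈horizontal {a} 1≤a a<r eq = subst (_∈ horizontalEdges) (odd-label a) (∈-map⁺ (λ α → 2 * α ∸ 1) (⇒∈H 1≤a a<r eq))

    even∉horizontal : ∀ a → double a ∉ horizontalEdges
    even∉horizontal a e∈ with ∈horizontal⇒ e∈
    ... | b , eq , _ = odd≢even b a (sym eq)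

    odd∉horizontal : ∀ a → (a < r → m (suc a) ≢ m a) → suc (double a) ∉ horizontalEdges
    odd∉horizontal a hyp e∈ with ∈horizontal⇒ e∈
    ... | b , eq , _ , b<r , same with double-injective {a} {b} (suc-injective eq)
    ...   | refl = hyp b<r same

    private
      vertical? : ∀ e → Dec (e ∉ horizontalEdges)
      vertical? e = ¬? (e ∈? horizontalEdges)

    -- Labels are consumed in pairs 2a + 1, 2a + 2, of which only the first can be horizontal; j
    -- counts the pairs left. The surplus label 2r + 1 is vertical since H ends at r.
    vertical-blocks : ∀ j a → 1 ≤ a → a + j ≡ r → filter vertical? (interval (suc (double j)) (suc (double a))) ≡ List.map proj₂ (blocks m j a)
    vertical-blocks zero a 1≤a a+0≡r = Listₚ.filter-accept vertical? {xs = []}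
      (odd∉horizontal a (λ a<r → contradiction (trans (sym (+-identityʳ a)) a+0≡r) (<⇒≢ a<r)))
    vertical-blocks (suc j) a 1≤a a+1+j≡r with m (suc a) ℤₚ.≟ m a
      | vertical-blocks j (suc a) (s≤s z≤n) (trans (sym (+-suc a j)) a+1+j≡r)
    ... | yes eq | ih = trans (Listₚ.filter-reject vertical? (λ ∉ → ∉ (⇒∈horizontal 1≤a a<r eq)))
      (trans (Listₚ.filter-accept vertical? (even∉horizontal (suc a))) (cong (double (suc a) ∷_) ih))
      where
      a<r : a < r
      a<r = subst (a <_) a+1+j≡r (m<m+n a (s≤s z≤n))
    ... | no neq | ih = trans (Listₚ.filter-accept vertical? (odd∉horizontal a (λ _ → neq)))
      (cong (suc (double a) ∷_) (trans (Listₚ.filter-accept vertical? (even∉horizontal (suc a))) (cong (double (suc a) ∷_) ih)))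

    2r+1 : 2 * r + 1 ≡ suc (double r)
    2r+1 = trans (+-comm (2 * r) 1) (cong suc (2*≡double r))

    verticalEdges≡ : verticalEdges ≡ List.map proj₂ levels
    verticalEdges≡ = trans (cong (filter vertical?) (trans (cong (applyUpTo suc) 2r+1) (applyUpTo≡interval suc _ 1 (λ _ → refl))))
      (trans (Listₚ.filter-accept vertical? 1∉horizontal)
      (cong (1 ∷_) (trans (Listₚ.filter-accept vertical? (even∉horizontal 1)) (cong (2 ∷_) (vertical-blocks r′ 1 ≤-refl refl)))))
      where
      1∉horizontal : 1 ∉ horizontalEdges
      1∉horizontal e∈ with ∈horizontal⇒ e∈
      ... | suc b , () , _

    -- Each α contributes 2 in all: one to either length if its odd edge is horizontal, both to the
    -- chain otherwise.
    count : ∀ j a → length (filter (λ α → m α ℤₚ.≟ m (α ∸ 1)) (interval j (suc a))) + length (blocks m j a) ≡ suc (double j)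
    count zero    a = refl
    count (suc j) a with m (suc a) ℤₚ.≟ m a | count j (suc a)
    ... | yes _ | ih = cong suc (trans (+-suc _ _) (cong suc ih))
    ... | no _  | ih = trans (+-suc _ _) (cong suc (trans (+-suc _ _) (cong suc ih)))

    N≡length : N ≡ length levels
    N≡length = trans (cong (_∸ s) (trans 2r+1 (sym total))) (m+n∸m≡n s (length levels))
      where
      total : s + length levels ≡ suc (double r)
      total = trans (cong (λ l → length (filter (λ α → m α ℤₚ.≟ m (α ∸ 1)) l) + length levels) (applyUpTo≡interval (2 ℕ.+_) r′ 2 (λ _ → refl)))
        (trans (+-suc _ _) (cong suc (trans (+-suc _ _) (cong suc (count r′ 1)))))

    vertical⇔ : ∀ e h → Edge e (v h) (v (suc h)) ⇔ downAt levels h ≡ just e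
    vertical⇔ e h = mk⇔
      (λ { (vertical i refl refl) → trans (cong (λ l → nth l (toℕ i)) (sym verticalEdges≡)) (nth-complete verticalEdges i) })
      (λ eq → let (i , i≡ , e≡) = nth-sound verticalEdges h (trans (cong (λ l → nth l h) verticalEdges≡) eq) in vertical i i≡ e≡)

    -- The list in the conclusion starts with the edge below the block, so its entry h is the
    -- vertical edge ending at level h. That edge is 2b, to whose upper endpoint the horizontal edge
    -- 2b + 1 is attached.
    flat-blocks⇒ : ∀ j a h {e} → flatAt (blocks m j a) h ≡ just e →
      ∃[ b ] e ≡ suc (double b) × m (suc b) ≡ m b × a ≤ b × b < a + j × nth (double a ∷ List.map proj₂ (blocks m j a)) h ≡ just (double b)
    flat-blocks⇒ zero a (suc h) ()
    flat-blocks⇒ (suc j) a h eq with m (suc a) ℤₚ.≟ m a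
    flat-blocks⇒ (suc j) a zero    refl | yes same = a , refl , same , ≤-refl , m<m+n a (s≤s z≤n) , refl
    flat-blocks⇒ (suc j) a (suc h) eq   | yes same with flat-blocks⇒ j (suc a) h eq
    ... | b , e≡ , same′ , a<b , b< , nth≡ = b , e≡ , same′ , <⇒≤ a<b , subst (b <_) (sym (+-suc a j)) b< , nth≡
    flat-blocks⇒ (suc j) a (suc (suc h)) eq | no _ with flat-blocks⇒ j (suc a) h eq
    ... | b , e≡ , same′ , a<b , b< , nth≡ = b , e≡ , same′ , <⇒≤ a<b , subst (b <_) (sym (+-suc a j)) b< , nth≡

    flat-blocks⇐ : ∀ j a h {b} → m (suc b) ≡ m b → b < a + j → nth (double a ∷ List.map proj₂ (blocks m j a)) h ≡ just (double b) →
      flatAt (blocks m j a) h ≡ just (suc (double b))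
    flat-blocks⇐ zero a zero {b} same b< eq with double-injective {a} {b} (just-injective eq)
    ... | refl = contradiction (+-identityʳ a) (>⇒≢ b<)
    flat-blocks⇐ zero a (suc zero) {b} same b< eq = contradiction (just-injective eq) (odd≢even a b)
    flat-blocks⇐ (suc j) a h same b< eq with m (suc a) ℤₚ.≟ m a
    flat-blocks⇐ (suc j) a zero {b} same b< eq | yes _ with double-injective {a} {b} (just-injective eq)
    ... | refl = refl
    flat-blocks⇐ (suc j) a (suc h) {b} same b< eq | yes _ = flat-blocks⇐ j (suc a) h same (subst (b <_) (+-suc a j) b<) eq
    flat-blocks⇐ (suc j) a zero {b} same b< eq | no neq with double-injective {a} {b} (just-injective eq)
    ... | refl = contradiction same neq
    flat-blocks⇐ (suc j) a (suc zero) {b} same b< eq | no neq = contradiction (just-injective eq) (odd≢even a b)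
    flat-blocks⇐ (suc j) a (suc (suc h)) {b} same b< eq | no neq = flat-blocks⇐ j (suc a) h same (subst (b <_) (+-suc a j) b<) eq

    flat⇒edge : ∀ e h → flatAt levels h ≡ just e → ∃[ α ] Edge e (v h) (leaf α)
    flat⇒edge e (suc (suc h)) eq with flat-blocks⇒ r′ 1 h eq
    ... | b , refl , same , 1≤b , b<r , nth≡ = suc b , horizontal (⇒∈H 1≤b b<r same) (sym (odd-label b))
      (Equivalence.from (vertical⇔ _ (suc h)) (trans nth≡ (cong just (sym (even-label b)))))

    edge⇒flat : ∀ {e h α} → Edge e (v h) (leaf α) → flatAt levels h ≡ just e
    edge⇒flat (horizontal {k = k} α∈ e≡ edge) with ∈H⇒ α∈
    ... | a , refl , 1≤a , a<r , same with Equivalence.to (vertical⇔ _ k) edge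
    -- The lowest vertical edge has label 1, which is not even.
    edge⇒flat (horizontal {k = zero} α∈ e≡ edge) | a , refl , 1≤a , a<r , same | eq =
      contradiction (trans (just-injective eq) (even-label a)) (odd≢even 0 a)
    edge⇒flat (horizontal {k = suc h} α∈ e≡ edge) | a , refl , 1≤a , a<r , same | eq =
      trans (flat-blocks⇐ r′ 1 h same a<r (trans eq (cong just (even-label a)))) (cong just (trans (sym (odd-label a)) (sym e≡)))

  fromMaybe : ∀ {a} {X : Set a} → (ℕ → X) → Maybe ℕ → List X
  fromMaybe f = maybe′ (λ e → f e ∷ []) []

  fromMaybe-unique : ∀ {a} {X : Set a} (f : ℕ → X) me → Unique (fromMaybe f me)
  fromMaybe-unique f nothing  = []
  fromMaybe-unique f (just e) = All.[] ∷ []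

  ∈-fromMaybe⁻ : ∀ {a} {X : Set a} {f : ℕ → X} me {x} → x ∈ fromMaybe f me → ∃[ e ] me ≡ just e × x ≡ f e
  ∈-fromMaybe⁻ (just e) (here refl) = e , refl , refl

  module Steps (ls : Levels) where
    ups downs flats : ℕ → List Step
    ups h with h <? length ls
    ... | yes _ = up ∷ []
    ... | no _  = []
    downs zero    = []
    downs (suc h) = fromMaybe down (downAt ls h)
    flats h = fromMaybe flat (flatAt ls h)

    steps : Point → List Step
    steps (x , h) = ups h ++ downs h ++ flats h

    ∈-ups⁻ : ∀ h {s} → s ∈ ups h → s ≡ up × h < length ls
    ∈-ups⁻ h s∈ with h <? length ls
    ∈-ups⁻ h (here refl) | yes h< = refl , h<

    ∈-downs⁻ : ∀ h {s} → s ∈ downs h → ∃[ h′ ] ∃[ e ] h ≡ suc h′ × downAt ls h′ ≡ just e × s ≡ down e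
    ∈-downs⁻ (suc h) s∈ with ∈-fromMaybe⁻ (downAt ls h) s∈
    ... | e , eq , s≡ = h , e , refl , eq , s≡

    ∈-steps⁻ : ∀ x h {s} → s ∈ steps (x , h) →
      (s ≡ up × h < length ls) ⊎ (∃[ h′ ] ∃[ e ] h ≡ suc h′ × downAt ls h′ ≡ just e × s ≡ down e) ⊎ (∃[ e ] flatAt ls h ≡ just e × s ≡ flat e)
    ∈-steps⁻ x h s∈ with ∈-++⁻ (ups h) s∈
    ... | inj₁ s∈ups = inj₁ (∈-ups⁻ h s∈ups)
    ... | inj₂ s∈′ with ∈-++⁻ (downs h) s∈′
    ...   | inj₁ s∈downs = inj₂ (inj₁ (∈-downs⁻ h s∈downs))
    ...   | inj₂ s∈flats = inj₂ (inj₂ (∈-fromMaybe⁻ (flatAt ls h) s∈flats))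

    up∈steps : ∀ x h → h < length ls → up ∈ steps (x , h)
    up∈steps x h h< = ∈-++⁺ˡ up∈ups
      where
      up∈ups : up ∈ ups h
      up∈ups with h <? length ls
      ... | yes _  = here refl
      ... | no h≮  = contradiction h< h≮

    down∈steps : ∀ x h {e} → downAt ls h ≡ just e → down e ∈ steps (x , suc h)
    down∈steps x h eq = ∈-++⁺ʳ (ups (suc h)) (∈-++⁺ˡ (subst (λ me → _ ∈ fromMaybe down me) (sym eq) (here refl)))

    flat∈steps : ∀ x h {e} → flatAt ls h ≡ just e → flat e ∈ steps (x , h)
    flat∈steps x h eq = ∈-++⁺ʳ (ups h) (∈-++⁺ʳ (downs h) (subst (λ me → _ ∈ fromMaybe flat me) (sym eq) (here refl)))

    steps-unique : ∀ p → Unique (steps p)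
    steps-unique (x , h) = Unique.++⁺ (ups-unique h) (Unique.++⁺ (downs-unique h) (fromMaybe-unique flat (flatAt ls h)) downs≠flats) ups≠rest
      where
      ups-unique : ∀ h → Unique (ups h)
      ups-unique h with h <? length ls
      ... | yes _ = All.[] ∷ []
      ... | no _  = []
      downs-unique : ∀ h → Unique (downs h)
      downs-unique zero    = []
      downs-unique (suc h) = fromMaybe-unique down (downAt ls h)
      downs≠flats : ∀ {s} → ¬ (s ∈ downs h × s ∈ flats h)
      downs≠flats (s∈d , s∈f) with ∈-downs⁻ h s∈d | ∈-fromMaybe⁻ (flatAt ls h) s∈f
      ... | _ , _ , _ , _ , refl | _ , _ , ()
      ups≠rest : ∀ {s} → ¬ (s ∈ ups h × s ∈ downs h ++ flats h)
      ups≠rest (s∈u , s∈r) with ∈-ups⁻ h s∈u | ∈-++⁻ (downs h) s∈r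
      ... | refl , _ | inj₁ s∈d with ∈-downs⁻ h s∈d
      ...   | _ , _ , _ , _ , ()
      ups≠rest (s∈u , s∈r) | refl , _ | inj₂ s∈f with ∈-fromMaybe⁻ (flatAt ls h) s∈f
      ... | _ , _ , ()

    no-descent-below-0 : ∀ p {s} → s ∈ steps p → NoDescentBelow0 p s
    no-descent-below-0 (x , h) {up}     s∈ = tt
    no-descent-below-0 (x , h) {flat e} s∈ = tt
    no-descent-below-0 (x , h) {down e} s∈ with ∈-steps⁻ x h s∈
    ... | inj₂ (inj₁ (_ , _ , refl , _)) = s≤s z≤n
    ... | inj₂ (inj₂ (_ , _ , ()))

  module _ (r′ : ℕ) (m : ℕ → ℤ) where
    open Shape r′ m
    open Tree (suc r′) m using (N)
    open Steps levels
    open LatticePaths (suc r′) m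

    IsPath⇒Path : ∀ {p ss q} → IsPath p ss q → Path steps p ss q
    IsPath⇒Path (stop _)          = done
    IsPath⇒Path (up∷ {x} {h} h<N path)  = step (up∈steps x h (subst (h <_) N≡length h<N)) (IsPath⇒Path path)
    IsPath⇒Path (down∷ {x} {h} edge path)  = step (down∈steps x h (Equivalence.to (vertical⇔ _ h) edge)) (IsPath⇒Path path)
    IsPath⇒Path (flat∷ {x} {h} edge path)  = step (flat∈steps x h (edge⇒flat edge)) (IsPath⇒Path path)

    -- `stop` asks for h ≤ N, which `Path` does not record; it is immediate here because the path
    -- ends at height 0.
    Path⇒IsPath : ∀ {p ss x} → Path steps p ss (x , 0) → IsPath p ss (x , 0)
    Path⇒IsPath done = stop z≤n
    Path⇒IsPath (step {x , h} s∈ path) with ∈-steps⁻ x h s∈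
    ... | inj₁ (refl , h<) = up∷ (subst (h <_) (sym N≡length) h<) (Path⇒IsPath path)
    ... | inj₂ (inj₁ (h′ , e , refl , eq , refl)) = down∷ (Equivalence.from (vertical⇔ e h′) eq) (Path⇒IsPath path)
    ... | inj₂ (inj₂ (e , eq , refl)) = flat∷ (proj₂ (flat⇒edge e h eq)) (Path⇒IsPath path)

open TreeShape

-- Arithmetic in the field

module OverField {c ℓ} (K : Field c ℓ) where
  open Field K hiding (zero)
  open import Relation.Binary.Reasoning.Setoid setoid
  open import Algebra.Solver.Ring.NaturalCoefficients.Default commutativeSemiring using (solve; _:=_; _:+_; _:*_)

  NonZero : Carrier → Set ℓ
  NonZero x = ¬ x ≈ 0#

  *-cancelʳ-nonZero : ∀ {x y z} → NonZero z → x * z ≈ y * z → x ≈ y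
  *-cancelʳ-nonZero {x} {y} {z} z≉0 eq = begin
    x              ≈⟨ lemma x ⟨
    x * z * z ⁻¹   ≈⟨ *-congʳ eq ⟩
    y * z * z ⁻¹   ≈⟨ lemma y ⟩
    y              ∎
    where
    lemma : ∀ u → u * z * z ⁻¹ ≈ u
    lemma u = trans (*-assoc _ _ _) (trans (*-congˡ (inverseʳ z z≉0)) (*-identityʳ u))

  *-nonZero : ∀ {x y} → NonZero x → NonZero y → NonZero (x * y)
  *-nonZero x≉0 y≉0 xy≈0 = x≉0 (*-cancelʳ-nonZero y≉0 (trans xy≈0 (sym (zeroˡ _))))

  ⁻¹-nonZero : ∀ {x} → NonZero x → NonZero (x ⁻¹)
  ⁻¹-nonZero {x} x≉0 eq = 1≉0 (trans (sym (inverseʳ x x≉0)) (trans (*-congˡ eq) (zeroʳ x)))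

  ÷-* : ∀ x {y} → NonZero y → x ÷ y * y ≈ x
  ÷-* x {y} y≉0 = trans (*-assoc _ _ _)
    (trans (*-congˡ (trans (*-comm _ _) (inverseʳ y y≉0))) (*-identityʳ x))

  ÷-nonZero : ∀ {x y} → NonZero x → NonZero y → NonZero (x ÷ y)
  ÷-nonZero x≉0 y≉0 = *-nonZero x≉0 (⁻¹-nonZero y≉0)

  1⁻¹≈1 : 1# ⁻¹ ≈ 1#
  1⁻¹≈1 = trans (sym (*-identityˡ _)) (inverseʳ 1# 1≉0)

  ÷-cong : ∀ {x x′ y y′} → x ≈ x′ → y ≈ y′ → x ÷ y ≈ x′ ÷ y′
  ÷-cong p q = *-cong p (⁻¹-cong q)

  x÷1≈x : ∀ x → x ÷ 1# ≈ x
  x÷1≈x x = trans (*-congˡ 1⁻¹≈1) (*-identityʳ x)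

  -- All edge weights have the shape (a ÷ b) ÷ (p ÷ q).
  clear-denominators : ∀ a {b p q} → NonZero b → NonZero p → NonZero q →
    (a ÷ b) ÷ (p ÷ q) * (b * p) ≈ a * q
  clear-denominators a {b} {p} {q} b≉0 p≉0 q≉0 = *-cancelʳ-nonZero (⁻¹-nonZero q≉0) (begin
    (a ÷ b) ÷ (p ÷ q) * (b * p) * q ⁻¹        ≈⟨ solve 4 (λ z b p i → z :* (b :* p) :* i := z :* (p :* i) :* b) refl _ b p (q ⁻¹) ⟩
    (a ÷ b) ÷ (p ÷ q) * (p ÷ q) * b           ≈⟨ *-congʳ (÷-* (a ÷ b) (÷-nonZero p≉0 q≉0)) ⟩
    a ÷ b * b                                 ≈⟨ ÷-* a b≉0 ⟩
    a                                         ≈⟨ *-identityʳ a ⟨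
    a * 1#                                    ≈⟨ *-congˡ (inverseʳ q q≉0) ⟨
    a * (q ÷ q)                               ≈⟨ *-assoc _ _ _ ⟨
    a * q * q ⁻¹                              ∎)

  -- Nonvanishing of the solution of the Q-system

  -- With natural coefficients nothing can cancel in sums and products, which makes nonvanishing
  -- stable under both.
  ℕPoly : ℕ → Set
  ℕPoly zero    = ℕ
  ℕPoly (suc n) = List (ℕPoly n)

  toPoly : ∀ {n} → ℕPoly n → Poly n
  toPoly {zero}  a = + a
  toPoly {suc n} p = List.map toPoly p

  -- The value at (1,...,1), hence additive and multiplicative. Being at least 1 certifies that the
  -- polynomial is not zero.
  total : ∀ {n} → ℕPoly n → ℕ
  total {zero}  a       = a
  total {suc n} []      = 0
  total {suc n} (a ∷ p) = total a ℕ.+ total {suc n} p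

  add : ∀ {n} → ℕPoly n → ℕPoly n → ℕPoly n
  add {zero}  a       b       = a ℕ.+ b
  add {suc n} []      q       = q
  add {suc n} (a ∷ p) []      = a ∷ p
  add {suc n} (a ∷ p) (b ∷ q) = add a b ∷ add {suc n} p q

  const : ∀ {n} → ℕ → ℕPoly n
  const {zero}  a = a
  const {suc n} a = const a ∷ []

  mutual
    mul : ∀ {n} → ℕPoly n → ℕPoly n → ℕPoly n
    mul {zero}  a       b = a ℕ.* b
    mul {suc n} []      q = []
    mul {suc n} (a ∷ p) q = add {suc n} (scale a q) (const 0 ∷ mul {suc n} p q)

    scale : ∀ {n} → ℕPoly n → ℕPoly (suc n) → ℕPoly (suc n)
    scale a []      = []
    scale a (b ∷ q) = mul a b ∷ scale a q

  var : ∀ {n} → Fin n → ℕPoly n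
  var zero    = const 0 ∷ const 1 ∷ []
  var (suc i) = var i ∷ []

  total-add : ∀ {n} (p q : ℕPoly n) → total (add p q) ≡ total p ℕ.+ total q
  total-add {zero}  a       b       = ≡.refl
  total-add {suc n} []      q       = ≡.refl
  total-add {suc n} (a ∷ p) []      = ≡.sym (ℕₚ.+-identityʳ _)
  total-add {suc n} (a ∷ p) (b ∷ q) = ≡.trans (≡.cong₂ ℕ._+_ (total-add a b) (total-add {suc n} p q)) (CommutativeSemigroupProperties.interchange ℕₚ.+-commutativeSemigroup (total a) _ _ _)

  total-const : ∀ {n} a → total {n} (const a) ≡ a
  total-const {zero}  a = ≡.refl
  total-const {suc n} a = ≡.trans (ℕₚ.+-identityʳ _) (total-const {n} a)

  mutual
    total-mul : ∀ {n} (p q : ℕPoly n) → total (mul p q) ≡ total p ℕ.* total q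
    total-mul {zero}  a       b = ≡.refl
    total-mul {suc n} []      q = ≡.refl
    total-mul {suc n} (a ∷ p) q = ≡.trans (total-add {suc n} (scale a q) (const 0 ∷ mul {suc n} p q))
      (≡.trans (≡.cong₂ ℕ._+_ (total-scale a q) (≡.cong₂ ℕ._+_ (total-const {n} 0) (total-mul {suc n} p q)))
               (≡.sym (ℕₚ.*-distribʳ-+ (total {suc n} q) (total a) (total {suc n} p))))

    total-scale : ∀ {n} (a : ℕPoly n) q → total {suc n} (scale a q) ≡ total a ℕ.* total {suc n} q
    total-scale a []      = ≡.sym (ℕₚ.*-zeroʳ (total a))
    total-scale {n} a (b ∷ q) = ≡.trans (≡.cong₂ ℕ._+_ (total-mul a b) (total-scale a q)) (≡.sym (ℕₚ.*-distribˡ-+ (total a) (total b) (total {suc n} q)))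

  total-var : ∀ {n} (i : Fin n) → total (var i) ≡ 1
  total-var {suc n} zero    = ≡.cong₂ ℕ._+_ (total-const {n} 0) (≡.trans (ℕₚ.+-identityʳ _) (total-const {n} 1))
  total-var (suc i) = ≡.trans (ℕₚ.+-identityʳ _) (total-var i)

  IsZero⇒total≡0 : ∀ {n} (p : ℕPoly n) → IsZero {n} (toPoly p) → total p ≡ 0
  IsZero⇒total≡0 {zero}  a       eq       = ℤₚ.+-injective eq
  IsZero⇒total≡0 {suc n} []      []       = ≡.refl
  IsZero⇒total≡0 {suc n} (a ∷ p) (z ∷ zs) = ≡.cong₂ ℕ._+_ (IsZero⇒total≡0 a z) (IsZero⇒total≡0 {suc n} p zs)

  ⟦_⟧ : ∀ {n} → ℕPoly n → Vec Carrier n → Carrier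
  ⟦ p ⟧ xs = eval K xs (toPoly p)

  eval-add : ∀ {n} (xs : Vec Carrier n) p q → ⟦ add p q ⟧ xs ≈ ⟦ p ⟧ xs + ⟦ q ⟧ xs
  eval-add []       a       b       = Mult.×-homo-+ semiring 1# a b
  eval-add (x ∷ xs) []      q       = sym (+-identityˡ _)
  eval-add (x ∷ xs) (a ∷ p) []      = sym (+-identityʳ _)
  eval-add (x ∷ xs) (a ∷ p) (b ∷ q) = begin
    ⟦ add a b ⟧ xs + x * ⟦ add p q ⟧ (x ∷ xs)
      ≈⟨ +-cong (eval-add xs a b) (*-congˡ (eval-add (x ∷ xs) p q)) ⟩
    ⟦ a ⟧ xs + ⟦ b ⟧ xs + x * (⟦ p ⟧ (x ∷ xs) + ⟦ q ⟧ (x ∷ xs))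
      ≈⟨ solve 5 (λ a b x p q → a :+ b :+ x :* (p :+ q) := a :+ x :* p :+ (b :+ x :* q)) refl _ _ _ _ _ ⟩
    ⟦ a ⟧ xs + x * ⟦ p ⟧ (x ∷ xs) + (⟦ b ⟧ xs + x * ⟦ q ⟧ (x ∷ xs)) ∎

  eval-const-0 : ∀ {n} (xs : Vec Carrier n) → ⟦ const 0 ⟧ xs ≈ 0#
  eval-const-0 []       = refl
  eval-const-0 (x ∷ xs) = trans (+-cong (eval-const-0 xs) (zeroʳ x)) (+-identityʳ _)

  eval-const-1 : ∀ {n} (xs : Vec Carrier n) → ⟦ const 1 ⟧ xs ≈ 1#
  eval-const-1 []       = +-identityʳ _
  eval-const-1 (x ∷ xs) = trans (+-cong (eval-const-1 xs) (zeroʳ x)) (+-identityʳ _)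

  mutual
    eval-mul : ∀ {n} (xs : Vec Carrier n) p q → ⟦ mul p q ⟧ xs ≈ ⟦ p ⟧ xs * ⟦ q ⟧ xs
    eval-mul []       a       b = Mult.×1-homo-* semiring a b
    eval-mul (x ∷ xs) []      q = sym (zeroˡ _)
    eval-mul (x ∷ xs) (a ∷ p) q = begin
      ⟦ add (scale a q) (const 0 ∷ mul p q) ⟧ (x ∷ xs)
        ≈⟨ eval-add (x ∷ xs) (scale a q) (const 0 ∷ mul p q) ⟩
      ⟦ scale a q ⟧ (x ∷ xs) + (⟦ const 0 ⟧ xs + x * ⟦ mul p q ⟧ (x ∷ xs))
        ≈⟨ +-cong (eval-scale x xs a q) (trans (+-cong (eval-const-0 xs) (*-congˡ (eval-mul (x ∷ xs) p q))) (+-identityˡ _)) ⟩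
      ⟦ a ⟧ xs * ⟦ q ⟧ (x ∷ xs) + x * (⟦ p ⟧ (x ∷ xs) * ⟦ q ⟧ (x ∷ xs))
        ≈⟨ solve 4 (λ a q x p → a :* q :+ x :* (p :* q) := (a :+ x :* p) :* q) refl _ _ _ _ ⟩
      (⟦ a ⟧ xs + x * ⟦ p ⟧ (x ∷ xs)) * ⟦ q ⟧ (x ∷ xs) ∎

    eval-scale : ∀ {n} x (xs : Vec Carrier n) a q → ⟦ scale a q ⟧ (x ∷ xs) ≈ ⟦ a ⟧ xs * ⟦ q ⟧ (x ∷ xs)
    eval-scale x xs a []      = sym (zeroʳ _)
    eval-scale x xs a (b ∷ q) = begin
      ⟦ mul a b ⟧ xs + x * ⟦ scale a q ⟧ (x ∷ xs)
        ≈⟨ +-cong (eval-mul xs a b) (*-congˡ (eval-scale x xs a q)) ⟩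
      ⟦ a ⟧ xs * ⟦ b ⟧ xs + x * (⟦ a ⟧ xs * ⟦ q ⟧ (x ∷ xs))
        ≈⟨ solve 4 (λ a b x q → a :* b :+ x :* (a :* q) := a :* (b :+ x :* q)) refl _ _ _ _ ⟩
      ⟦ a ⟧ xs * (⟦ b ⟧ xs + x * ⟦ q ⟧ (x ∷ xs)) ∎

  eval-var : ∀ {n} (xs : Vec Carrier n) i → ⟦ var i ⟧ xs ≈ lookup xs i
  eval-var (x ∷ xs) zero    = begin
    ⟦ const 0 ⟧ xs + x * (⟦ const 1 ⟧ xs + x * 0#)  ≈⟨ +-cong (eval-const-0 xs) (*-congˡ (+-cong (eval-const-1 xs) (zeroʳ x))) ⟩
    0# + x * (1# + 0#)                              ≈⟨ trans (+-identityˡ _) (trans (*-congˡ (+-identityʳ _)) (*-identityʳ x)) ⟩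
    x                                               ∎
  eval-var (x ∷ xs) (suc i) = trans (+-cong (eval-var xs i) (zeroʳ x)) (+-identityʳ _)

  -- Subtraction-free rational functions of xs.
  module Positivity {n} (xs : Vec Carrier n) where

    record Positive (z : Carrier) : Set ℓ where
      constructor positive
      field
        num den : ℕPoly n
        num>0   : 1 ≤ total num
        den>0   : 1 ≤ total den
        ratio   : z * ⟦ den ⟧ xs ≈ ⟦ num ⟧ xs

    mul>0 : ∀ (p q : ℕPoly n) → 1 ≤ total p → 1 ≤ total q → 1 ≤ total (mul p q)
    mul>0 p q p>0 q>0 = ≡.subst (1 ≤_) (≡.sym (total-mul p q)) (ℕₚ.*-mono-≤ p>0 q>0)

    positive-resp : ∀ {z z′} → z ≈ z′ → Positive z → Positive z′
    positive-resp eq (positive p q p>0 q>0 z) = positive p q p>0 q>0 (trans (*-congʳ (sym eq)) z)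

    positive-1 : Positive 1#
    positive-1 = positive (const 1) (const 1) 1>0 1>0 (*-identityˡ _)
      where
      1>0 : 1 ≤ total {n} (const 1)
      1>0 = ≡.subst (1 ≤_) (≡.sym (total-const {n} 1)) ℕₚ.≤-refl

    positive-var : ∀ i → Positive (lookup xs i)
    positive-var i = positive (var i) (const 1)
      (≡.subst (1 ≤_) (≡.sym (total-var i)) ℕₚ.≤-refl) (≡.subst (1 ≤_) (≡.sym (total-const {n} 1)) ℕₚ.≤-refl)
      (trans (*-congˡ (eval-const-1 xs)) (trans (*-identityʳ _) (sym (eval-var xs i))))

    positive-* : ∀ {y z} → Positive y → Positive z → Positive (y * z)
    positive-* {y} {z} (positive p q p>0 q>0 y≈) (positive p′ q′ p′>0 q′>0 z≈) =
      positive (mul p p′) (mul q q′) (mul>0 p p′ p>0 p′>0) (mul>0 q q′ q>0 q′>0) (begin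
        y * z * ⟦ mul q q′ ⟧ xs            ≈⟨ *-congˡ (eval-mul xs q q′) ⟩
        y * z * (⟦ q ⟧ xs * ⟦ q′ ⟧ xs)     ≈⟨ solve 4 (λ y z q q′ → y :* z :* (q :* q′) := y :* q :* (z :* q′)) refl _ _ _ _ ⟩
        y * ⟦ q ⟧ xs * (z * ⟦ q′ ⟧ xs)     ≈⟨ *-cong y≈ z≈ ⟩
        ⟦ p ⟧ xs * ⟦ p′ ⟧ xs               ≈⟨ eval-mul xs p p′ ⟨
        ⟦ mul p p′ ⟧ xs                    ∎)

    positive-+ : ∀ {y z} → Positive y → Positive z → Positive (y + z)
    positive-+ {y} {z} (positive p q p>0 q>0 y≈) (positive p′ q′ p′>0 q′>0 z≈) =
      positive (add (mul p q′) (mul p′ q)) (mul q q′)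
        (≡.subst (1 ≤_) (≡.sym (total-add (mul p q′) (mul p′ q))) (ℕₚ.m≤n⇒m≤n+o _ (mul>0 p q′ p>0 q′>0))) (mul>0 q q′ q>0 q′>0) (begin
        (y + z) * ⟦ mul q q′ ⟧ xs                               ≈⟨ *-congˡ (eval-mul xs q q′) ⟩
        (y + z) * (⟦ q ⟧ xs * ⟦ q′ ⟧ xs)                        ≈⟨ solve 4 (λ y z q q′ → (y :+ z) :* (q :* q′) := y :* q :* q′ :+ z :* q′ :* q) refl _ _ _ _ ⟩
        y * ⟦ q ⟧ xs * ⟦ q′ ⟧ xs + z * ⟦ q′ ⟧ xs * ⟦ q ⟧ xs     ≈⟨ +-cong (*-congʳ y≈) (*-congʳ z≈) ⟩
        ⟦ p ⟧ xs * ⟦ q′ ⟧ xs + ⟦ p′ ⟧ xs * ⟦ q ⟧ xs             ≈⟨ +-cong (eval-mul xs p q′) (eval-mul xs p′ q) ⟨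
        ⟦ mul p q′ ⟧ xs + ⟦ mul p′ q ⟧ xs                       ≈⟨ eval-add xs (mul p q′) (mul p′ q) ⟨
        ⟦ add (mul p q′) (mul p′ q) ⟧ xs                        ∎)

    -- Cross multiplication, so that nothing is inverted before it is known not to vanish.
    -- Denominators move into the numerator, which is why `Positive` constrains both.
    positive-quotient : ∀ {y z u} → y * z ≈ u → Positive z → Positive u → Positive y
    positive-quotient {y} {z} {u} yz≈u (positive p q p>0 q>0 z≈) (positive p′ q′ p′>0 q′>0 u≈) =
      positive (mul p′ q) (mul p q′) (mul>0 p′ q p′>0 q>0) (mul>0 p q′ p>0 q′>0) (begin
        y * ⟦ mul p q′ ⟧ xs              ≈⟨ *-congˡ (trans (eval-mul xs p q′) (*-congʳ (sym z≈))) ⟩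
        y * (z * ⟦ q ⟧ xs * ⟦ q′ ⟧ xs)   ≈⟨ solve 4 (λ y z q q′ → y :* (z :* q :* q′) := y :* z :* q′ :* q) refl _ _ _ _ ⟩
        y * z * ⟦ q′ ⟧ xs * ⟦ q ⟧ xs     ≈⟨ *-congʳ (trans (*-congʳ yz≈u) u≈) ⟩
        ⟦ p′ ⟧ xs * ⟦ q ⟧ xs             ≈⟨ eval-mul xs p′ q ⟨
        ⟦ mul p′ q ⟧ xs                  ∎)

    positive⇒nonZero : AlgebraicallyIndependent K xs → ∀ {z} → Positive z → NonZero z
    positive⇒nonZero indep {z} (positive p q p>0 _ z≈) z≈0 = contradiction
      (IsZero⇒total≡0 p (indep (toPoly p) (trans (sym z≈) (trans (*-congʳ z≈0) (zeroˡ _)))))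
      (ℕₚ.m<n⇒n≢0 p>0)

  module Propagation (r : ℕ) (R : ℕ → ℤ → Carrier) (QS : IsQSystem K r R)
    (m : ℕ → ℤ) (asc : AscendingMotzkin r m) where
    open IsQSystem QS
    open Positivity (initialData K r R m)

    P : ℕ → ℤ → Set ℓ
    P α n = Positive (R α n)

    left : ∀ n → P 0 n
    left n = positive-resp (sym (left-boundary n)) positive-1

    right : ∀ n → P (suc r) n
    right n = positive-resp (sym (right-boundary n)) positive-1

    start₀ : ∀ a → a < r → P (suc a) (m (suc a))
    start₀ a a<r = positive-resp (reflexive (≡.trans (Vecₚ.lookup-++ˡ (Vec.tabulate f) (Vec.tabulate g) i)
      (≡.trans (Vecₚ.lookup∘tabulate f i) (≡.cong (λ b → R (suc b) (m (suc b))) (Finₚ.toℕ-fromℕ< a<r))))) (positive-var (i ↑ˡ r))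
      where
      i = fromℕ< a<r
      f g : Fin r → Carrier
      f i = R (suc (toℕ i)) (m (suc (toℕ i)))
      g i = R (suc (toℕ i)) (m (suc (toℕ i)) ℤ.+ + 1)

    start₁ : ∀ a → a < r → P (suc a) (m (suc a) ℤ.+ + 1)
    start₁ a a<r = positive-resp (reflexive (≡.trans (Vecₚ.lookup-++ʳ (Vec.tabulate f) (Vec.tabulate g) i)
      (≡.trans (Vecₚ.lookup∘tabulate g i) (≡.cong (λ b → R (suc b) (m (suc b) ℤ.+ + 1)) (Finₚ.toℕ-fromℕ< a<r))))) (positive-var (r ↑ʳ i))
      where
      i = fromℕ< a<r
      f g : Fin r → Carrier
      f i = R (suc (toℕ i)) (m (suc (toℕ i)))
      g i = R (suc (toℕ i)) (m (suc (toℕ i)) ℤ.+ + 1)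

    P-resp : ∀ {α n n′} → n ≡ n′ → P α n → P α n′
    P-resp {α} eq = ≡.subst (P α) eq

    step-up : ∀ a n → a < r → P (suc a) n → P (suc a) (n ℤ.- + 1) → P (suc (suc a)) n → P a n → P (suc a) (n ℤ.+ + 1)
    step-up a n a<r p p₋ p⁺ p⁻ = positive-quotient (recursion (suc a) n (s≤s z≤n) a<r) p₋ (positive-+ (positive-* p p) (positive-* p⁺ p⁻))

    step-down : ∀ a n → a < r → P (suc a) n → P (suc a) (n ℤ.+ + 1) → P (suc (suc a)) n → P a n → P (suc a) (n ℤ.- + 1)
    step-down a n a<r p p₊ p⁺ p⁻ = positive-quotient (trans (*-comm _ _) (recursion (suc a) n (s≤s z≤n) a<r)) p₊ (positive-+ (positive-* p p) (positive-* p⁺ p⁻))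

    Up : ℕ → Set ℓ
    Up j = ∀ a → a < r → P (suc a) (m (suc a) ℤ.+ + j)

    -- The layers are translates of the path. In the recursion that yields layer j + 2 at α, the
    -- right neighbour lies on layer j or j + 1, while the left one lies on layer j + 1 or, where
    -- the path rises, on layer j + 2 itself. The new layer is therefore filled from left to right.
    up-step : ∀ j → Up j → Up (suc j) → Up (suc (suc j))
    up-step j u₀ u₁ a a<r = P-resp {suc a} (top (m (suc a)) (+ j))
      (step-up a N a<r (u₁ a a<r) (P-resp {suc a} (bottom (m (suc a)) (+ j)) (u₀ a a<r)) (next (ℕₚ.m≤n⇒m<n∨m≡n a<r)) (previous a a<r))
      where
      N : ℤ
      N = m (suc a) ℤ.+ + suc j
      top : ∀ x j → x ℤ.+ (+ 1 ℤ.+ j) ℤ.+ + 1 ≡ x ℤ.+ (+ 2 ℤ.+ j)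
      top = ℤSolver.solve-∀
      bottom : ∀ x j → x ℤ.+ j ≡ x ℤ.+ (+ 1 ℤ.+ j) ℤ.- + 1
      bottom = ℤSolver.solve-∀
      shift : ∀ x j → x ℤ.+ + 1 ℤ.+ j ≡ x ℤ.+ (+ 1 ℤ.+ j)
      shift = ℤSolver.solve-∀
      shift₂ : ∀ x j → x ℤ.+ (+ 2 ℤ.+ j) ≡ x ℤ.+ + 1 ℤ.+ (+ 1 ℤ.+ j)
      shift₂ = ℤSolver.solve-∀
      next : suc a < r ⊎ suc a ≡ r → P (suc (suc a)) N
      next (inj₂ ≡.refl) = right N
      next (inj₁ a+1<r) with asc (suc a) (s≤s z≤n) a+1<r
      ... | inj₁ eq = P-resp {suc (suc a)} (≡.cong (ℤ._+ + suc j) eq) (u₁ (suc a) a+1<r)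
      ... | inj₂ eq = P-resp {suc (suc a)} (≡.trans (≡.cong (ℤ._+ + j) eq) (shift (m (suc a)) (+ j))) (u₀ (suc a) a+1<r)
      previous : ∀ a → a < r → P a (m (suc a) ℤ.+ + suc j)
      previous zero    _   = left _
      previous (suc b) b<r with asc (suc b) (s≤s z≤n) b<r
      ... | inj₁ eq = P-resp {suc b} (≡.cong (ℤ._+ + suc j) (≡.sym eq)) (u₁ b (ℕₚ.<⇒≤ b<r))
      ... | inj₂ eq = P-resp {suc b} (≡.trans (shift₂ (m (suc b)) (+ j)) (≡.cong (ℤ._+ + suc j) (≡.sym eq))) (up-step j u₀ u₁ b (ℕₚ.<⇒≤ b<r))

    Down : ℕ → Set ℓ
    Down j = ∀ a → a < r → P (suc a) (m (suc a) ℤ.+ + 1 ℤ.- + j)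

    -- The mirror image: where the path rises, the right neighbour belongs to the layer under
    -- construction, so the recursion runs on the distance b to the right boundary.
    down-step : ∀ j → Down j → Down (suc j) → ∀ b a → a ℕ.+ suc b ≡ r → P (suc a) (m (suc a) ℤ.+ + 1 ℤ.- + suc (suc j))
    down-step j d₀ d₁ b a a+b+1≡r = P-resp {suc a} (bottom (m (suc a)) (+ j))
      (step-down a N a<r (d₁ a a<r) (P-resp {suc a} (top (m (suc a)) (+ j)) (d₀ a a<r)) (next b a+b+1≡r) (previous a a<r))
      where
      a<r : a < r
      a<r = ≡.subst (a <_) a+b+1≡r (ℕₚ.m<m+n a (s≤s z≤n))
      N : ℤ
      N = m (suc a) ℤ.+ + 1 ℤ.- + suc j
      bottom : ∀ x j → x ℤ.+ + 1 ℤ.- (+ 1 ℤ.+ j) ℤ.- + 1 ≡ x ℤ.+ + 1 ℤ.- (+ 2 ℤ.+ j)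
      bottom = ℤSolver.solve-∀
      top : ∀ x j → x ℤ.+ + 1 ℤ.- j ≡ x ℤ.+ + 1 ℤ.- (+ 1 ℤ.+ j) ℤ.+ + 1
      top = ℤSolver.solve-∀
      shift : ∀ x j → x ℤ.+ + 1 ℤ.- j ≡ x ℤ.+ + 1 ℤ.+ + 1 ℤ.- (+ 1 ℤ.+ j)
      shift = ℤSolver.solve-∀
      shift₂ : ∀ x j → x ℤ.+ + 1 ℤ.+ + 1 ℤ.- (+ 2 ℤ.+ j) ≡ x ℤ.+ + 1 ℤ.- (+ 1 ℤ.+ j)
      shift₂ = ℤSolver.solve-∀
      previous : ∀ a → a < r → P a (m (suc a) ℤ.+ + 1 ℤ.- + suc j)
      previous zero    _   = left _
      previous (suc b) b<r with asc (suc b) (s≤s z≤n) b<r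
      ... | inj₁ eq = P-resp {suc b} (≡.cong (λ z → z ℤ.+ + 1 ℤ.- + suc j) (≡.sym eq)) (d₁ b (ℕₚ.<⇒≤ b<r))
      ... | inj₂ eq = P-resp {suc b} (≡.trans (shift (m (suc b)) (+ j)) (≡.cong (λ z → z ℤ.+ + 1 ℤ.- + suc j) (≡.sym eq))) (d₀ b (ℕₚ.<⇒≤ b<r))
      next : ∀ b → a ℕ.+ suc b ≡ r → P (suc (suc a)) N
      next zero    eq = ≡.subst (λ z → P (suc z) N) (≡.sym (≡.trans (≡.sym (ℕₚ.+-comm a 1)) eq)) (right N)
      next (suc b) eq with asc (suc a) (s≤s z≤n) (≡.subst (_< r) (ℕₚ.+-comm a 1) (≡.subst (a ℕ.+ 1 <_) eq (ℕₚ.+-monoʳ-< a (s≤s (s≤s z≤n)))))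
      ... | inj₁ e = P-resp {suc (suc a)} (≡.cong (λ z → z ℤ.+ + 1 ℤ.- + suc j) e) (d₁ (suc a) (≡.subst (suc a <_) (≡.trans (≡.sym (ℕₚ.+-suc a (suc b))) eq) (ℕₚ.m<m+n (suc a) (s≤s z≤n))))
      ... | inj₂ e = P-resp {suc (suc a)} (≡.trans (≡.cong (λ z → z ℤ.+ + 1 ℤ.- + suc (suc j)) e) (shift₂ (m (suc a)) (+ j)))
                       (down-step j d₀ d₁ b (suc a) (≡.trans (≡.sym (ℕₚ.+-suc a (suc b))) eq))

    up-from : ∀ j → Up j × Up (suc j)
    up-from zero    = (λ a a<r → P-resp {suc a} (≡.sym (ℤₚ.+-identityʳ _)) (start₀ a a<r)) , start₁
    up-from (suc j) = proj₂ (up-from j) , up-step j (proj₁ (up-from j)) (proj₂ (up-from j))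

    down-from : ∀ j → Down j × Down (suc j)
    down-from zero    = (λ a a<r → P-resp {suc a} (≡.sym (ℤₚ.+-identityʳ _)) (start₁ a a<r))
                 , (λ a a<r → P-resp {suc a} (cancel (m (suc a))) (start₀ a a<r))
      where
      cancel : ∀ x → x ≡ x ℤ.+ + 1 ℤ.- + 1
      cancel = ℤSolver.solve-∀
    down-from (suc j) = proj₂ (down-from j) , λ a a<r → down-step j (proj₁ (down-from j)) (proj₂ (down-from j)) (r ∸ suc a) a
      (≡.trans (ℕₚ.+-suc a _) (ℕₚ.m+[n∸m]≡n a<r))

    all-positive : ∀ α n → α ≤ suc r → P α n
    all-positive zero    n _   = left n
    all-positive (suc a) n (s≤s a≤r) with ℕₚ.m≤n⇒m<n∨m≡n a≤r
    ... | inj₂ ≡.refl = right n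
    ... | inj₁ a<r    = split (n ℤ.- m (suc a)) ≡.refl
      where
      restore : ∀ n x → x ℤ.+ (n ℤ.- x) ≡ n
      restore = ℤSolver.solve-∀
      -- Layers of `Down` are counted from m + 1, so 1 + j below m is layer j + 2.
      flip : ∀ x j → x ℤ.+ + 1 ℤ.- (+ 1 ℤ.+ (+ 1 ℤ.+ j)) ≡ x ℤ.+ (ℤ.- (+ 1 ℤ.+ j))
      flip = ℤSolver.solve-∀
      split : ∀ d → d ≡ n ℤ.- m (suc a) → P (suc a) n
      split (+ j)    eq = P-resp {suc a} (≡.trans (≡.cong (λ z → m (suc a) ℤ.+ z) eq) (restore n (m (suc a)))) (proj₁ (up-from j) a a<r)
      split -[1+ j ] eq = P-resp {suc a} (≡.trans (flip (m (suc a)) (+ j)) (≡.trans (≡.cong (λ z → m (suc a) ℤ.+ z) eq) (restore n (m (suc a))))) (proj₁ (down-from (suc (suc j))) a a<r)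

    nonZero : AlgebraicallyIndependent K (initialData K r R m) → ∀ α n → α ≤ suc r → NonZero (R α n)
    nonZero indep α n α≤ = positive⇒nonZero indep (all-positive α n α≤)

  -- Identities between the edge weights

  -- As m₁ = 0 and the path ascends, the weights involve indices n ≥ 0 only. Natural indices
  -- suffice, with the recursion shifted to avoid predecessors.
  record NonZeroQSystem (r : ℕ) (Q : ℕ → ℕ → Carrier) : Set ℓ where
    field
      left-boundary  : ∀ i → Q 0 i ≈ 1#
      right-boundary : ∀ i → Q (suc r) i ≈ 1#
      recursion      : ∀ a i → a < r →
        Q (suc a) (suc (suc i)) * Q (suc a) i ≈
        Q (suc a) (suc i) * Q (suc a) (suc i) + Q (suc (suc a)) (suc i) * Q a (suc i)
      nonZero        : ∀ a i → a ≤ suc r → NonZero (Q a i)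

  module EdgeWeights {r : ℕ} {Q : ℕ → ℕ → Carrier} (QS : NonZeroQSystem r Q) where
    open NonZeroQSystem QS

    lam : ℕ → ℕ → Carrier
    lam a i = Q a (suc i) ÷ Q a i

    -- In terms of the Motzkin path, hor (α - 1) and ver (α - 1) are the values
    -- of y (2α - 1) on a horizontal and on a vertical edge, and evn (α - 1) is
    -- the value of y (2α).
    hor ver evn : ℕ → ℕ → Carrier
    hor a i = lam (suc a) i ÷ lam a i
    ver a i = lam (suc a) (suc i) ÷ lam a i
    evn a i = (Q (suc (suc a)) (suc i) ÷ Q (suc a) (suc i)) ÷ (Q (suc a) i ÷ Q a i)

    -- The recursion at (a + 1, n + 1), times p₀ and over q₀ q₁ p₁. On the tree: a flat step,
    -- together with the up-down step through the edge above, weighs as much as the up-down step of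
    -- the straightened chain.
    hor+evn≈ver : ∀ a n → a < r → hor a n + evn a n ≈ ver a n
    hor+evn≈ver a n a<r = *-cancelʳ-nonZero (*-nonZero (*-nonZero q₀≉0 q₁≉0) p₁≉0) (begin
      (hor a n + evn a n) * (q₀ * q₁ * p₁)
        ≈⟨ solve 5 (λ h e q₀ q₁ p₁ → (h :+ e) :* (q₀ :* q₁ :* p₁) := h :* (q₀ :* p₁) :* q₁ :+ e :* (q₁ :* q₀) :* p₁) refl (hor a n) (evn a n) q₀ q₁ p₁ ⟩
      hor a n * (q₀ * p₁) * q₁ + evn a n * (q₁ * q₀) * p₁
        ≈⟨ +-cong (*-congʳ (clear-denominators q₁ q₀≉0 p₁≉0 p₀≉0)) (*-congʳ (clear-denominators s₁ q₁≉0 q₀≉0 p₀≉0)) ⟩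
      q₁ * p₀ * q₁ + s₁ * p₀ * p₁
        ≈⟨ solve 4 (λ q₁ p₀ s₁ p₁ → q₁ :* p₀ :* q₁ :+ s₁ :* p₀ :* p₁ := (q₁ :* q₁ :+ s₁ :* p₁) :* p₀) refl q₁ p₀ s₁ p₁ ⟩
      (q₁ * q₁ + s₁ * p₁) * p₀
        ≈⟨ *-congʳ (recursion a n a<r) ⟨
      q₂ * q₀ * p₀
        ≈⟨ solve 3 (λ q₂ q₀ p₀ → q₂ :* q₀ :* p₀ := q₂ :* p₀ :* q₀) refl q₂ q₀ p₀ ⟩
      q₂ * p₀ * q₀
        ≈⟨ *-congʳ (clear-denominators q₂ q₁≉0 p₁≉0 p₀≉0) ⟨
      ver a n * (q₁ * p₁) * q₀
        ≈⟨ solve 4 (λ v q₁ p₁ q₀ → v :* (q₁ :* p₁) :* q₀ := v :* (q₀ :* q₁ :* p₁)) refl (ver a n) q₁ p₁ q₀ ⟩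
      ver a n * (q₀ * q₁ * p₁) ∎)
      where
      p₀ p₁ q₀ q₁ q₂ s₁ : Carrier
      p₀ = Q a n
      p₁ = Q a (suc n)
      q₀ = Q (suc a) n
      q₁ = Q (suc a) (suc n)
      q₂ = Q (suc a) (suc (suc n))
      s₁ = Q (suc (suc a)) (suc n)
      a≤ : a ≤ suc r
      a≤ = ℕₚ.<⇒≤ (ℕₚ.m<n⇒m<1+n a<r)
      p₀≉0 = nonZero a n a≤
      p₁≉0 = nonZero a (suc n) a≤
      q₀≉0 = nonZero (suc a) n (ℕₚ.m<n⇒m<1+n a<r)
      q₁≉0 = nonZero (suc a) (suc n) (ℕₚ.m<n⇒m<1+n a<r)

    hor≈ver-top : ∀ n → hor r n ≈ ver r n
    hor≈ver-top n = ÷-cong (trans (lam≈1 n) (sym (lam≈1 (suc n)))) refl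
      where
      lam≈1 : ∀ i → lam (suc r) i ≈ 1#
      lam≈1 i = trans (÷-cong (right-boundary (suc i)) (right-boundary i)) (x÷1≈x 1#)

    -- The recursion used for `hor+evn≈ver`, multiplied by s₂ in place of p₀: it splits the next odd
    -- weight instead of this one.
    ver≈hor+evn : ∀ a i → a < r → ver (suc a) i ≈ hor (suc a) (suc i) + evn a (suc i)
    ver≈hor+evn a i a<r = *-cancelʳ-nonZero (*-nonZero (*-nonZero s₁≉0 p₁≉0) p₂≉0) (begin
      ver (suc a) i * (s₁ * p₁ * p₂)
        ≈⟨ *-assoc _ _ _ ⟨
      ver (suc a) i * (s₁ * p₁) * p₂
        ≈⟨ *-congʳ (clear-denominators s₂ s₁≉0 p₁≉0 p₀≉0) ⟩
      s₂ * p₀ * p₂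
        ≈⟨ solve 3 (λ s₂ p₀ p₂ → s₂ :* p₀ :* p₂ := s₂ :* (p₂ :* p₀)) refl s₂ p₀ p₂ ⟩
      s₂ * (p₂ * p₀)
        ≈⟨ *-congˡ (recursion a i a<r) ⟩
      s₂ * (p₁ * p₁ + s₁ * u₁)
        ≈⟨ solve 4 (λ s₂ p₁ s₁ u₁ → s₂ :* (p₁ :* p₁ :+ s₁ :* u₁) := s₂ :* p₁ :* p₁ :+ s₂ :* u₁ :* s₁) refl s₂ p₁ s₁ u₁ ⟩
      s₂ * p₁ * p₁ + s₂ * u₁ * s₁
        ≈⟨ +-cong (*-congʳ (clear-denominators s₂ s₁≉0 p₂≉0 p₁≉0)) (*-congʳ (clear-denominators s₂ p₂≉0 p₁≉0 u₁≉0)) ⟨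
      hor (suc a) (suc i) * (s₁ * p₂) * p₁ + evn a (suc i) * (p₂ * p₁) * s₁
        ≈⟨ solve 5 (λ h e s₁ p₁ p₂ → h :* (s₁ :* p₂) :* p₁ :+ e :* (p₂ :* p₁) :* s₁ := (h :+ e) :* (s₁ :* p₁ :* p₂)) refl (hor (suc a) (suc i)) (evn a (suc i)) s₁ p₁ p₂ ⟩
      (hor (suc a) (suc i) + evn a (suc i)) * (s₁ * p₁ * p₂) ∎)
      where
      p₀ p₁ p₂ s₁ s₂ u₁ : Carrier
      p₀ = Q (suc a) i
      p₁ = Q (suc a) (suc i)
      p₂ = Q (suc a) (suc (suc i))
      s₁ = Q (suc (suc a)) (suc i)
      s₂ = Q (suc (suc a)) (suc (suc i))
      u₁ = Q a (suc i)
      p₀≉0 = nonZero (suc a) i (ℕₚ.m<n⇒m<1+n a<r)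
      p₁≉0 = nonZero (suc a) (suc i) (ℕₚ.m<n⇒m<1+n a<r)
      p₂≉0 = nonZero (suc a) (suc (suc i)) (ℕₚ.m<n⇒m<1+n a<r)
      s₁≉0 = nonZero (suc (suc a)) (suc i) (s≤s a<r)
      u₁≉0 = nonZero a (suc i) (ℕₚ.<⇒≤ (ℕₚ.m<n⇒m<1+n a<r))

    -- Both sides are the Laurent monomial t₂ p₀ / q₁²; no recursion is involved.
    ver*evn≈evn*ver : ∀ a n → a < r → ver (suc a) n * evn a n ≈ evn a (suc n) * ver a n
    ver*evn≈evn*ver a n a<r = *-cancelʳ-nonZero
      (*-nonZero (*-nonZero (*-nonZero t₁≉0 q₁≉0) (*-nonZero q₁≉0 q₀≉0)) (*-nonZero q₂≉0 p₁≉0)) (begin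
      ver (suc a) n * evn a n * (t₁ * q₁ * (q₁ * q₀) * (q₂ * p₁))
        ≈⟨ solve 4 (λ v e x y → v :* e :* (x :* y) := v :* e :* x :* y) refl (ver (suc a) n) (evn a n) _ _ ⟩
      ver (suc a) n * evn a n * (t₁ * q₁ * (q₁ * q₀)) * (q₂ * p₁)
        ≈⟨ *-congʳ (solve 4 (λ v e x y → v :* e :* (x :* y) := v :* x :* (e :* y)) refl (ver (suc a) n) (evn a n) _ _) ⟩
      ver (suc a) n * (t₁ * q₁) * (evn a n * (q₁ * q₀)) * (q₂ * p₁)
        ≈⟨ *-congʳ (*-cong (clear-denominators t₂ t₁≉0 q₁≉0 q₀≉0) (clear-denominators t₁ q₁≉0 q₀≉0 p₀≉0)) ⟩
      t₂ * q₀ * (t₁ * p₀) * (q₂ * p₁)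
        ≈⟨ solve 6 (λ t₁ t₂ q₀ q₂ p₀ p₁ → t₂ :* q₀ :* (t₁ :* p₀) :* (q₂ :* p₁) := t₂ :* p₁ :* (q₂ :* p₀) :* (t₁ :* q₀)) refl t₁ t₂ q₀ q₂ p₀ p₁ ⟩
      t₂ * p₁ * (q₂ * p₀) * (t₁ * q₀)
        ≈⟨ *-congʳ (*-cong (clear-denominators t₂ q₂≉0 q₁≉0 p₁≉0) (clear-denominators q₂ q₁≉0 p₁≉0 p₀≉0)) ⟨
      evn a (suc n) * (q₂ * q₁) * (ver a n * (q₁ * p₁)) * (t₁ * q₀)
        ≈⟨ solve 7 (λ e v q₀ q₁ q₂ p₁ t₁ → e :* (q₂ :* q₁) :* (v :* (q₁ :* p₁)) :* (t₁ :* q₀) := e :* v :* (t₁ :* q₁ :* (q₁ :* q₀) :* (q₂ :* p₁))) refl (evn a (suc n)) (ver a n) q₀ q₁ q₂ p₁ t₁ ⟩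
      evn a (suc n) * ver a n * (t₁ * q₁ * (q₁ * q₀) * (q₂ * p₁)) ∎)
      where
      p₀ p₁ q₀ q₁ q₂ t₁ t₂ : Carrier
      p₀ = Q a n
      p₁ = Q a (suc n)
      q₀ = Q (suc a) n
      q₁ = Q (suc a) (suc n)
      q₂ = Q (suc a) (suc (suc n))
      t₁ = Q (suc (suc a)) (suc n)
      t₂ = Q (suc (suc a)) (suc (suc n))
      a≤ : a ≤ suc r
      a≤ = ℕₚ.<⇒≤ (ℕₚ.m<n⇒m<1+n a<r)
      p₀≉0 = nonZero a n a≤
      p₁≉0 = nonZero a (suc n) a≤
      q₀≉0 = nonZero (suc a) n (ℕₚ.m<n⇒m<1+n a<r)
      q₁≉0 = nonZero (suc a) (suc n) (ℕₚ.m<n⇒m<1+n a<r)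
      q₂≉0 = nonZero (suc a) (suc (suc n)) (ℕₚ.m<n⇒m<1+n a<r)
      t₁≉0 = nonZero (suc (suc a)) (suc n) (s≤s a<r)

    when : ∀ {P : Set} → Dec P → Carrier → Carrier
    when (yes _) x = x
    when (no _)  x = 0#

    -- Setting the weights beyond the last edge 2r + 1 to zero removes the upper
    -- bound on the heights.
    Ver Evn : ℕ → ℕ → Carrier
    Ver a i = when (a ℕₚ.≤? r) (ver a i)
    Evn a i = when (a ℕₚ.<? r) (evn a i)

    Ver≈ver : ∀ {a} i → a ≤ r → Ver a i ≈ ver a i
    Ver≈ver {a} i a≤r with a ℕₚ.≤? r
    ... | yes _  = refl
    ... | no a≰r = contradiction a≤r a≰r

    Ver≈0 : ∀ {a} i → r < a → Ver a i ≈ 0#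
    Ver≈0 {a} i r<a with a ℕₚ.≤? r
    ... | yes a≤r = contradiction a≤r (ℕₚ.<⇒≱ r<a)
    ... | no _    = refl

    Evn≈evn : ∀ {a} i → a < r → Evn a i ≈ evn a i
    Evn≈evn {a} i a<r with a ℕₚ.<? r
    ... | yes _  = refl
    ... | no a≮r = contradiction a<r a≮r

    Evn≈0 : ∀ {a} i → r ≤ a → Evn a i ≈ 0#
    Evn≈0 {a} i r≤a with a ℕₚ.<? r
    ... | yes a<r = contradiction a<r (ℕₚ.≤⇒≯ r≤a)
    ... | no _    = refl

    hor+Evn≈Ver : ∀ a n → a ≤ r → hor a n + Evn a n ≈ Ver a n
    hor+Evn≈Ver a n a≤r with a ℕₚ.<? r
    ... | yes a<r = trans (hor+evn≈ver a n a<r) (sym (Ver≈ver n a≤r))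
    ... | no a≮r with ℕₚ.≤-antisym a≤r (ℕₚ.≮⇒≥ a≮r)
    ...   | _≡_.refl = trans (+-identityʳ _) (trans (hor≈ver-top n) (sym (Ver≈ver n a≤r)))

    -- `hor (suc a) (suc i)` can absorb either even weight: the lower one turns it into
    -- `Ver (suc a) i`, the upper one into `Ver (suc a) (suc i)`.
    Ver+Evn≈Ver+Evn : ∀ a i → Ver (suc a) i + Evn (suc a) (suc i) ≈ Ver (suc a) (suc i) + Evn a (suc i)
    Ver+Evn≈Ver+Evn a i with suc a ℕₚ.≤? r
    ... | yes a<r = begin
      ver (suc a) i + Evn (suc a) (suc i)                            ≈⟨ +-congʳ (ver≈hor+evn a i a<r) ⟩
      hor (suc a) (suc i) + evn a (suc i) + Evn (suc a) (suc i)      ≈⟨ solve 3 (λ x y z → x :+ y :+ z := x :+ z :+ y) refl _ _ _ ⟩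
      hor (suc a) (suc i) + Evn (suc a) (suc i) + evn a (suc i)      ≈⟨ +-congʳ (hor+Evn≈Ver (suc a) (suc i) a<r) ⟩
      Ver (suc a) (suc i) + evn a (suc i)                            ≈⟨ +-congʳ (Ver≈ver (suc i) a<r) ⟩
      ver (suc a) (suc i) + evn a (suc i)                            ∎
    ... | no a≮r = +-congˡ (Evn≈0 (suc i) (ℕₚ.≤-trans (ℕₚ.≮⇒≥ a≮r) (ℕₚ.n≤1+n a)))

    Ver*Evn≈Evn*Ver : ∀ a n → Ver (suc a) n * Evn a n ≈ Evn a (suc n) * Ver a n
    Ver*Evn≈Evn*Ver a n with a ℕₚ.<? r
    ... | yes a<r = trans (ver*evn≈evn*ver a n a<r) (*-congˡ (sym (Ver≈ver n (ℕₚ.<⇒≤ a<r))))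
    ... | no a≮r  = trans (zeroʳ _) (sym (zeroˡ _))

  -- Transfer along a chain

  -- Values of weighted path counts with l remaining columns, as a function of the
  -- height; f and d are the weights of the flat steps and of the down steps
  -- h + 1 → h, and a is the contribution entering at height 0.
  mutual
    V : (f d a : ℕ → Carrier) → ℕ → ℕ → Carrier
    V f d a zero    h = 0#
    V f d a (suc l) h = below f d a l h + (V f d a l (suc h) + level f d a l h)

    below : (f d a : ℕ → Carrier) → ℕ → ℕ → Carrier
    below f d a l zero    = a l
    below f d a l (suc h) = d h * V f d a l h

    level : (f d a : ℕ → Carrier) → ℕ → ℕ → Carrier
    level f d a zero    h = 0#
    level f d a (suc l) h = f h * V f d a l h

  infix 4 _≋_
  _≋_ : (s t : ℕ → Carrier) → Set ℓ
  s ≋ t = ∀ i → s i ≈ t i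

  𝟎 δ : ℕ → Carrier
  𝟎 _ = 0#
  δ zero    = 1#
  δ (suc _) = 0#

  -- The sources are compared only below l, which is all that the induction in `Equivalent-cons` can
  -- offer.
  V-cong : ∀ {f f′ d d′} → f ≋ f′ → d ≋ d′ → ∀ l {a a′} → (∀ i → i < l → a i ≈ a′ i) →
    ∀ h → V f d a l h ≈ V f′ d′ a′ l h
  V-cong f≈ d≈ zero    a≈ h = refl
  V-cong {f} {f′} {d} {d′} f≈ d≈ (suc l) {a} {a′} a≈ h =
    +-cong (below≈ h) (+-cong (ih (suc h)) (level≈ l a≈ h))
    where
    ih : ∀ h → V f d a l h ≈ V f′ d′ a′ l h
    ih = V-cong f≈ d≈ l (λ i i<l → a≈ i (ℕₚ.m<n⇒m<1+n i<l))
    below≈ : ∀ h → below f d a l h ≈ below f′ d′ a′ l h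
    below≈ zero    = a≈ l ℕₚ.≤-refl
    below≈ (suc h) = *-cong (d≈ h) (ih h)
    level≈ : ∀ l → (∀ i → i < suc l → a i ≈ a′ i) → ∀ h → level f d a l h ≈ level f′ d′ a′ l h
    level≈ zero    a≈ h = refl
    level≈ (suc l) a≈ h = *-cong (f≈ h) (V-cong f≈ d≈ l (λ i i<l → a≈ i (ℕₚ.m<n⇒m<1+n (ℕₚ.m<n⇒m<1+n i<l))) h)

  level≈0 : ∀ {f d a} l {h} → f h ≈ 0# → level f d a l h ≈ 0#
  level≈0 zero    eq = refl
  level≈0 (suc l) eq = trans (*-congʳ eq) (zeroˡ _)

  cons : Carrier → (ℕ → Carrier) → ℕ → Carrier
  cons x s zero    = x
  cons x s (suc h) = s h

  module _ {f d a : ℕ → Carrier} {x y : Carrier} where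
    private
      W : ℕ → ℕ → Carrier
      W = V (cons x f) (cons y d) a
      b : ℕ → Carrier
      b i = y * W i 0

    -- From height 1 upwards the bottom vertex is felt only through what it passes on, so it can be
    -- replaced by a source of the shorter chain.
    V-cons : ∀ l h → W l (suc h) ≈ V f d b l h
    V-cons zero    h = refl
    V-cons (suc l) h = +-cong (below≈ h) (+-cong (V-cons l (suc h)) (level≈ l h))
      where
      below≈ : ∀ h → cons y d h * W l h ≈ below f d b l h
      below≈ zero    = refl
      below≈ (suc h) = *-congˡ (V-cons l h)
      level≈ : ∀ l h → level (cons x f) (cons y d) a l (suc h) ≈ level f d b l h
      level≈ zero    h = refl
      level≈ (suc l) h = *-congˡ (V-cons l h)

  -- The source ranges over all sequences, since a level added underneath becomes a source that is
  -- not known in advance.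
  Equivalent : (f d f′ d′ : ℕ → Carrier) → Set _
  Equivalent f d f′ d′ = ∀ a l → V f d a l 0 ≈ V f′ d′ a l 0

  -- The source seen by the upper chain consists of the values at height 0 with fewer columns, hence
  -- strong induction on l.
  Equivalent-cons : ∀ {f d f′ d′ x y} → Equivalent f d f′ d′ →
    Equivalent (cons x f) (cons y d) (cons x f′) (cons y d′)
  Equivalent-cons {f} {d} {f′} {d′} {x} {y} f,d∼f′,d′ a = <-rec _ agree
    where
    W W′ : ℕ → ℕ → Carrier
    W  = V (cons x f)  (cons y d)  a
    W′ = V (cons x f′) (cons y d′) a
    agree : ∀ l → (∀ {i} → i < l → W i 0 ≈ W′ i 0) → W l 0 ≈ W′ l 0
    agree zero    ih = refl
    agree (suc l) ih = +-congˡ (+-cong above≈ (level≈ l ih))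
      where
      above≈ : W l 1 ≈ W′ l 1
      above≈ = begin
        W l 1                              ≈⟨ V-cons l 0 ⟩
        V f d (λ i → y * W i 0) l 0        ≈⟨ f,d∼f′,d′ _ l ⟩
        V f′ d′ (λ i → y * W i 0) l 0      ≈⟨ V-cong (λ _ → refl) (λ _ → refl) l (λ i i<l → *-congˡ (ih (ℕₚ.m<n⇒m<1+n i<l))) 0 ⟩
        V f′ d′ (λ i → y * W′ i 0) l 0     ≈⟨ V-cons l 0 ⟨
        W′ l 1                             ∎
      level≈ : ∀ l → (∀ {i} → i < suc l → W i 0 ≈ W′ i 0) →
        level (cons x f) (cons y d) a l 0 ≈ level (cons x f′) (cons y d′) a l 0
      level≈ zero    ih = refl
      level≈ (suc l) ih = *-congˡ (ih (ℕₚ.m<n⇒m<1+n ℕₚ.≤-refl))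

  Equivalent-trans : ∀ {f d f′ d′ f″ d″} → Equivalent f d f′ d′ → Equivalent f′ d′ f″ d″ → Equivalent f d f″ d″
  Equivalent-trans p q a l = trans (p a l) (q a l)

  Equivalent-reflexive : ∀ {f d f′ d′} → f ≋ f′ → d ≋ d′ → Equivalent f d f′ d′
  Equivalent-reflexive f≈ d≈ a l = V-cong f≈ d≈ l (λ _ _ → refl) 0

  two-steps : ∀ {f d a} l h → f (1 ℕ.+ h) ≈ 0# → f (2 ℕ.+ h) ≈ 0# → f (3 ℕ.+ h) ≈ 0# →
    V f d a (2 ℕ.+ l) (2 ℕ.+ h) ≈
    V f d a l (4 ℕ.+ h) + ((d (2 ℕ.+ h) + d (1 ℕ.+ h)) * V f d a l (2 ℕ.+ h) + d (1 ℕ.+ h) * d h * V f d a l h)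
  two-steps {f} {d} {a} l h f₁ f₂ f₃ = begin
    d₁ * (d₀ * W 0 + (W 2 + level f d a l (1 ℕ.+ h))) + (d₂ * W 2 + (W 4 + level f d a l (3 ℕ.+ h)) + level f d a (suc l) (2 ℕ.+ h))
      ≈⟨ +-cong (*-congˡ (+-congˡ (+-congˡ (level≈0 l f₁)))) (+-cong (+-congˡ (+-congˡ (level≈0 l f₃))) (level≈0 (suc l) f₂)) ⟩
    d₁ * (d₀ * W 0 + (W 2 + 0#)) + (d₂ * W 2 + (W 4 + 0#) + 0#)
      ≈⟨ +-cong (*-congˡ (+-congˡ (+-identityʳ _))) (trans (+-identityʳ _) (+-congˡ (+-identityʳ _))) ⟩
    d₁ * (d₀ * W 0 + W 2) + (d₂ * W 2 + W 4)
      ≈⟨ solve 6 (λ d₀ d₁ d₂ w₀ w₂ w₄ → d₁ :* (d₀ :* w₀ :+ w₂) :+ (d₂ :* w₂ :+ w₄) := w₄ :+ ((d₂ :+ d₁) :* w₂ :+ d₁ :* d₀ :* w₀)) refl d₀ d₁ d₂ (W 0) (W 2) (W 4) ⟩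
    W 4 + ((d₂ + d₁) * W 2 + d₁ * d₀ * W 0) ∎
    where
    d₀ d₁ d₂ : Carrier
    d₀ = d h
    d₁ = d (1 ℕ.+ h)
    d₂ = d (2 ℕ.+ h)
    W : ℕ → Carrier
    W i = V f d a l (i ℕ.+ h)

  two-steps-base : ∀ {f d a} l → f 1 ≈ 0# →
    V f d a (2 ℕ.+ l) 0 ≈ a (suc l) + (V f d a l 2 + (f 0 + d 0) * V f d a l 0)
  two-steps-base {f} {d} {a} l f₁ = +-congˡ (begin
    d 0 * W 0 + (W 2 + level f d a l 1) + f 0 * W 0   ≈⟨ +-congʳ (+-congˡ (trans (+-congˡ (level≈0 l f₁)) (+-identityʳ _))) ⟩
    d 0 * W 0 + W 2 + f 0 * W 0                       ≈⟨ solve 4 (λ d₀ w₀ w₂ f₀ → d₀ :* w₀ :+ w₂ :+ f₀ :* w₀ := w₂ :+ (f₀ :+ d₀) :* w₀) refl (d 0) (W 0) (W 2) (f 0) ⟩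
    W 2 + (f 0 + d 0) * W 0                           ∎)
    where
    W : ℕ → Carrier
    W = V f d a l

  -- Two consecutive steps between even heights have the same weights in both systems.
  flatten : ∀ {o s t} → o + s 0 ≈ t 0 →
    (∀ j → s (2 ℕ.+ double j) + s (1 ℕ.+ double j) ≈ t (2 ℕ.+ double j) + t (1 ℕ.+ double j)) →
    (∀ j → s (1 ℕ.+ double j) * s (double j) ≈ t (1 ℕ.+ double j) * t (double j)) →
    Equivalent (cons o 𝟎) s 𝟎 t
  flatten {o} {s} {t} base sum prod a l = even l 0
    where
    U W : ℕ → ℕ → Carrier
    U = V (cons o 𝟎) s a
    W = V 𝟎 t a
    even : ∀ l j → U l (double j) ≈ W l (double j)
    even zero          j       = refl
    even (suc zero)    zero    = refl
    even (suc zero)    (suc j) = +-congʳ (trans (zeroʳ _) (sym (zeroʳ _)))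
    even (suc (suc l)) zero    = begin
      U (2 ℕ.+ l) 0                                ≈⟨ two-steps-base l refl ⟩
      a (suc l) + (U l 2 + (o + s 0) * U l 0)      ≈⟨ +-congˡ (+-cong (even l 1) (*-cong (trans base (sym (+-identityˡ _))) (even l 0))) ⟩
      a (suc l) + (W l 2 + (0# + t 0) * W l 0)     ≈⟨ two-steps-base l refl ⟨
      W (2 ℕ.+ l) 0                                ∎
    even (suc (suc l)) (suc j) = begin
      U (2 ℕ.+ l) (2 ℕ.+ h)
        ≈⟨ two-steps l h refl refl refl ⟩
      U l (4 ℕ.+ h) + ((s (2 ℕ.+ h) + s (1 ℕ.+ h)) * U l (2 ℕ.+ h) + s (1 ℕ.+ h) * s h * U l h)
        ≈⟨ +-cong (even l (2 ℕ.+ j)) (+-cong (*-cong (sum j) (even l (suc j))) (*-cong (prod j) (even l j))) ⟩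
      W l (4 ℕ.+ h) + ((t (2 ℕ.+ h) + t (1 ℕ.+ h)) * W l (2 ℕ.+ h) + t (1 ℕ.+ h) * t h * W l h)
        ≈⟨ two-steps l h refl refl refl ⟨
      W (2 ℕ.+ l) (2 ℕ.+ h) ∎
      where
      h : ℕ
      h = double j

  -- A path through the first edge alternates between excursions above height 1
  -- and visits to height 0; the latter act as flat steps at height 1.
  first-edge : ∀ x s l → V 𝟎 (cons x s) δ (2 ℕ.+ l) 0 ≈ x * V (cons x 𝟎) s δ l 0
  first-edge x s l = begin
    0# + (W l 0 + 0# * _)   ≈⟨ trans (+-identityˡ _) (trans (+-congˡ (zeroˡ _)) (+-identityʳ _)) ⟩
    W l 0                   ≈⟨ over l 0 ⟩
    x * U l 0               ∎
    where
    U W : ℕ → ℕ → Carrier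
    U = V (cons x 𝟎) s δ
    -- The extra column on this side is the final descent through the first edge; its weight is the
    -- factor x.
    W l h = V 𝟎 (cons x s) δ (suc l) (suc h)
    ground : ∀ l → V 𝟎 (cons x s) δ l 1 + level 𝟎 (cons x s) δ l 0 ≈ level (cons x 𝟎) s δ l 0
    over : ∀ l h → W l h ≈ x * U l h
    ground zero    = +-identityʳ _
    ground (suc l) = trans (+-congˡ (zeroˡ _)) (trans (+-identityʳ _) (over l 0))
    over zero    h       = begin
      cons x s h * 0# + (0# + 0#)   ≈⟨ +-cong (zeroʳ _) (+-identityʳ _) ⟩
      0# + 0#                       ≈⟨ +-identityʳ _ ⟩
      0#                            ≈⟨ zeroʳ x ⟨
      x * 0#                        ∎
    over (suc l) zero    = begin
      x * (δ l + (V 𝟎 (cons x s) δ l 1 + level 𝟎 (cons x s) δ l 0)) + (W l 1 + 0# * _)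
        ≈⟨ +-cong (*-congˡ (+-congˡ (ground l))) (trans (+-congˡ (zeroˡ _)) (trans (+-identityʳ _) (over l 1))) ⟩
      x * (δ l + level (cons x 𝟎) s δ l 0) + x * U l 1
        ≈⟨ solve 4 (λ x p q r → x :* (p :+ q) :+ x :* r := x :* (p :+ (r :+ q))) refl x _ _ _ ⟩
      x * (δ l + (U l 1 + level (cons x 𝟎) s δ l 0)) ∎
    over (suc l) (suc h) = begin
      s h * W l h + (W l (2 ℕ.+ h) + 0# * _)
        ≈⟨ +-cong (*-congˡ (over l h)) (trans (+-congˡ (zeroˡ _)) (trans (+-identityʳ _) (over l (2 ℕ.+ h)))) ⟩
      s h * (x * U l h) + x * U l (2 ℕ.+ h)
        ≈⟨ solve 4 (λ s x u w → s :* (x :* u) :+ x :* w := x :* (s :* u :+ w)) refl (s h) x _ _ ⟩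
      x * (s h * U l h + U l (2 ℕ.+ h))
        ≈⟨ *-congˡ (+-congˡ (trans (+-congˡ (level≈0 l refl)) (+-identityʳ _))) ⟨
      x * (s h * U l h + (U l (2 ℕ.+ h) + level (cons x 𝟎) s δ l (suc h))) ∎

  module _ {f d a : ℕ → Carrier} where
    -- A path that has climbed past the last nonzero weight cannot come back. This reconciles `V`,
    -- whose heights are unbounded, with up steps that stop at N.
    V-above-top : ∀ {N} → (∀ h → N ≤ h → d h ≈ 0#) → (∀ h → N ≤ h → f h ≈ 0#) →
      ∀ l h → N < h → V f d a l h ≈ 0#
    V-above-top d≈0 f≈0 zero    h       N<h       = refl
    V-above-top d≈0 f≈0 (suc l) (suc h) (s≤s N≤h) = begin
      d h * V f d a l h + (V f d a l (2 ℕ.+ h) + level f d a l (suc h))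
        ≈⟨ +-cong (trans (*-congʳ (d≈0 h N≤h)) (zeroˡ _))
                  (+-cong (V-above-top d≈0 f≈0 l (2 ℕ.+ h) (ℕₚ.m<n⇒m<1+n (s≤s N≤h))) (level≈0 l (f≈0 (suc h) (ℕₚ.m≤n⇒m≤1+n N≤h)))) ⟩
      0# + (0# + 0#)  ≈⟨ trans (+-identityˡ _) (+-identityˡ _) ⟩
      0#              ∎

    V-short : ∀ l h → l ≤ h → V f d a l h ≈ 0#
    V-short zero    h       l≤h       = refl
    V-short (suc l) (suc h) (s≤s l≤h) = begin
      d h * V f d a l h + (V f d a l (2 ℕ.+ h) + level f d a l (suc h))
        ≈⟨ +-cong (trans (*-congˡ (V-short l h l≤h)) (zeroʳ _))
                  (+-cong (V-short l (2 ℕ.+ h) (ℕₚ.m≤n⇒m≤1+n (ℕₚ.m≤n⇒m≤1+n l≤h))) (level≈ l l≤h)) ⟩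
      0# + (0# + 0#)  ≈⟨ trans (+-identityˡ _) (+-identityˡ _) ⟩
      0#              ∎
      where
      level≈ : ∀ l → l ≤ h → level f d a l (suc h) ≈ 0#
      level≈ zero    l≤h = refl
      level≈ (suc l) l<h = trans (*-congˡ (V-short l (suc h) (ℕₚ.m≤n⇒m≤1+n (ℕₚ.<⇒≤ l<h)))) (zeroʳ _)

  descent : (ℕ → Carrier) → ℕ → Carrier
  descent d zero    = 1#
  descent d (suc h) = d h * descent d h

  V-descent : ∀ {f d} h → V f d δ (suc h) h ≈ descent d h
  V-descent zero = trans (+-congˡ (+-identityʳ _)) (+-identityʳ _)
  V-descent {f} {d} (suc h) = begin
    d h * V f d δ (suc h) h + (V f d δ (suc h) (2 ℕ.+ h) + f (suc h) * V f d δ h (suc h))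
      ≈⟨ +-cong (*-congˡ (V-descent h)) (+-cong (V-short (suc h) (2 ℕ.+ h) (ℕₚ.n≤1+n _)) (trans (*-congˡ (V-short h (suc h) (ℕₚ.n≤1+n h))) (zeroʳ _))) ⟩
    d h * descent d h + (0# + 0#)  ≈⟨ trans (+-congˡ (+-identityʳ _)) (+-identityʳ _) ⟩
    d h * descent d h              ∎

  -- Chains weighted by a Q-system

  flatWeights downWeights : (ℕ → Carrier) → Levels → ℕ → Carrier
  flatWeights y []              = 𝟎
  flatWeights y ((e , _) ∷ ls)  = cons (maybe′ y 0# e) (flatWeights y ls)
  downWeights y []              = 𝟎
  downWeights y ((_ , e) ∷ ls)  = cons (y e) (downWeights y ls)

  cons-cong : ∀ {x x′ s s′} → x ≈ x′ → s ≋ s′ → cons x s ≋ cons x′ s′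
  cons-cong p q zero    = p
  cons-cong p q (suc h) = q h

  module Chain {r : ℕ} {Q : ℕ → ℕ → Carrier} (QS : NonZeroQSystem r Q) where
    open NonZeroQSystem QS
    open EdgeWeights QS

    -- The weights above the top of edge 2a when m a = n and all later edges are
    -- vertical.
    maximal : ℕ → ℕ → ℕ → Carrier
    maximal a n zero          = Ver a n
    maximal a n (suc zero)    = Evn a (suc n)
    maximal a n (suc (suc h)) = maximal (suc a) (suc n) h

    -- The same above a horizontal edge 2a + 1.
    raised : ℕ → ℕ → ℕ → Carrier
    raised a n = cons (Evn a n) (maximal (suc a) n)

    maximal-raised : ∀ a n h → maximal a n (suc h) ≡ raised a (suc n) h
    maximal-raised a n zero    = ≡.refl
    maximal-raised a n (suc h) = ≡.refl

    -- The hypotheses of `flatten` are `hor+Evn≈Ver`, `Ver+Evn≈Ver+Evn` and `Ver*Evn≈Evn*Ver`, the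
    -- last two repeated along the chain every two heights.
    flatten-maximal : ∀ a n → a ≤ r → Equivalent (cons (hor a n) 𝟎) (raised a n) 𝟎 (maximal a n)
    flatten-maximal a n a≤r = flatten (hor+Evn≈Ver a n a≤r) (sums a n) (products a n)
      where
      sums : ∀ a n j → raised a n (2 ℕ.+ double j) + raised a n (1 ℕ.+ double j)
                     ≈ maximal a n (2 ℕ.+ double j) + maximal a n (1 ℕ.+ double j)
      sums a n zero    = trans (+-comm _ _) (Ver+Evn≈Ver+Evn a n)
      sums a n (suc j) = sums (suc a) (suc n) j
      products : ∀ a n j → raised a n (1 ℕ.+ double j) * raised a n (double j)
                         ≈ maximal a n (1 ℕ.+ double j) * maximal a n (double j)
      products a n zero    = Ver*Evn≈Evn*Ver a n
      products a n (suc j) = trans (*-congˡ (reflexive (maximal-raised (suc a) n (double j)))) (products (suc a) (suc n) j)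

    maximal≈0 : ∀ a n → r < a → maximal a n ≋ 𝟎
    maximal≈0 a n r<a zero          = Ver≈0 n r<a
    maximal≈0 a n r<a (suc zero)    = Evn≈0 (suc n) (ℕₚ.<⇒≤ r<a)
    maximal≈0 a n r<a (suc (suc h)) = maximal≈0 (suc a) (suc n) (ℕₚ.m<n⇒m<1+n r<a) h

    -- The chain of the Motzkin path m α = t + α - 1.
    fundamental : ℕ → ℕ → Carrier
    fundamental t = cons (lam 1 t) (raised 0 t)

    private
      lam0≈1 : ∀ i → lam 0 i ≈ 1#
      lam0≈1 i = trans (÷-cong (left-boundary (suc i)) (left-boundary i)) (x÷1≈x 1#)

    -- The flat step at height 0 is read as the horizontal edge of a fictitious column a = 0. As
    -- λ(0,n) = 1, its weight `hor 0 t` is λ(1,t) and the straightened weight `ver 0 t` is λ(1,t+1),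
    -- so straightening gives the chain of t + 1.
    fundamental-shift : ∀ t → Equivalent (cons (lam 1 t) 𝟎) (raised 0 t) 𝟎 (fundamental (suc t))
    fundamental-shift t = Equivalent-trans
      (Equivalent-reflexive (cons-cong (sym hor≈) (λ _ → refl)) (λ _ → refl))
      (Equivalent-trans (flatten-maximal 0 t z≤n) (Equivalent-reflexive (λ _ → refl) maximal≋))
      where
      hor≈ : hor 0 t ≈ lam 1 t
      hor≈ = trans (÷-cong refl (lam0≈1 t)) (x÷1≈x _)
      maximal≋ : maximal 0 t ≋ fundamental (suc t)
      maximal≋ zero          = trans (Ver≈ver t z≤n) (trans (÷-cong refl (lam0≈1 t)) (x÷1≈x _))
      maximal≋ (suc h)       = reflexive (maximal-raised 0 t h)

    -- Induction on j with t free: dropping the first edge costs two columns and yields the factor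
    -- λ(1,t), which turns `Q 1 t` into `Q 1 (suc t)`.
    fundamental-moments : ∀ t j → Q 1 t * V 𝟎 (fundamental t) δ (suc (double j)) 0 ≈ Q 1 (t ℕ.+ j)
    fundamental-moments t zero    = begin
      Q 1 t * (1# + (0# + 0#))   ≈⟨ *-congˡ (trans (+-congˡ (+-identityʳ _)) (+-identityʳ _)) ⟩
      Q 1 t * 1#                 ≈⟨ *-identityʳ _ ⟩
      Q 1 t                      ≡⟨ ≡.cong (Q 1) (ℕₚ.+-identityʳ t) ⟨
      Q 1 (t ℕ.+ 0)              ∎
    fundamental-moments t (suc j) = begin
      Q 1 t * V 𝟎 (fundamental t) δ (3 ℕ.+ double j) 0
        ≈⟨ *-congˡ (first-edge (lam 1 t) (raised 0 t) (suc (double j))) ⟩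
      Q 1 t * (lam 1 t * V (cons (lam 1 t) 𝟎) (raised 0 t) δ (suc (double j)) 0)
        ≈⟨ *-congˡ (*-congˡ (fundamental-shift t δ (suc (double j)))) ⟩
      Q 1 t * (lam 1 t * V 𝟎 (fundamental (suc t)) δ (suc (double j)) 0)
        ≈⟨ *-assoc _ _ _ ⟨
      Q 1 t * lam 1 t * V 𝟎 (fundamental (suc t)) δ (suc (double j)) 0
        ≈⟨ *-congʳ (trans (*-comm _ _) (÷-* (Q 1 (suc t)) (nonZero 1 t (s≤s z≤n)))) ⟩
      Q 1 (suc t) * V 𝟎 (fundamental (suc t)) δ (suc (double j)) 0
        ≈⟨ fundamental-moments (suc t) j ⟩
      Q 1 (suc t ℕ.+ j)
        ≡⟨ ≡.cong (Q 1) (ℕₚ.+-suc t j) ⟨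
      Q 1 (t ℕ.+ suc j) ∎

    maximal-even : ∀ a n i → maximal a n (double i) ≡ Ver (i ℕ.+ a) (i ℕ.+ n)
    maximal-even a n zero    = ≡.refl
    maximal-even a n (suc i) = ≡.trans (maximal-even (suc a) (suc n) i) (≡.cong₂ Ver (ℕₚ.+-suc i a) (ℕₚ.+-suc i n))

    maximal-odd : ∀ a n i → maximal a n (suc (double i)) ≡ Evn (i ℕ.+ a) (suc (i ℕ.+ n))
    maximal-odd a n zero    = ≡.refl
    maximal-odd a n (suc i) = ≡.trans (maximal-odd (suc a) (suc n) i) (≡.cong₂ Evn (ℕₚ.+-suc i a) (≡.cong suc (ℕₚ.+-suc i n)))

    evn*ver : ∀ a n → a < r →
      evn a (suc n) * ver a n * (Q (suc a) (suc n) * Q (suc a) (suc n)) ≈ Q (suc (suc a)) (suc (suc n)) * Q a n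
    evn*ver a n a<r = *-cancelʳ-nonZero (*-nonZero q₂≉0 p₁≉0) (begin
      evn a (suc n) * ver a n * (q₁ * q₁) * (q₂ * p₁)
        ≈⟨ solve 5 (λ e v q₁ q₂ p₁ → e :* v :* (q₁ :* q₁) :* (q₂ :* p₁) := e :* (q₂ :* q₁) :* (v :* (q₁ :* p₁))) refl (evn a (suc n)) (ver a n) q₁ q₂ p₁ ⟩
      evn a (suc n) * (q₂ * q₁) * (ver a n * (q₁ * p₁))
        ≈⟨ *-cong (clear-denominators _ q₂≉0 q₁≉0 p₁≉0) (clear-denominators q₂ q₁≉0 p₁≉0 p₀≉0) ⟩
      t₂ * p₁ * (q₂ * p₀)
        ≈⟨ solve 4 (λ t₂ p₁ q₂ p₀ → t₂ :* p₁ :* (q₂ :* p₀) := t₂ :* p₀ :* (q₂ :* p₁)) refl t₂ p₁ q₂ p₀ ⟩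
      t₂ * p₀ * (q₂ * p₁) ∎)
      where
      p₀ p₁ q₁ q₂ t₂ : Carrier
      p₀ = Q a n
      p₁ = Q a (suc n)
      q₁ = Q (suc a) (suc n)
      q₂ = Q (suc a) (suc (suc n))
      t₂ = Q (suc (suc a)) (suc (suc n))
      p₀≉0 = nonZero a n (ℕₚ.<⇒≤ (ℕₚ.m<n⇒m<1+n a<r))
      p₁≉0 = nonZero a (suc n) (ℕₚ.<⇒≤ (ℕₚ.m<n⇒m<1+n a<r))
      q₁≉0 = nonZero (suc a) (suc n) (ℕₚ.m<n⇒m<1+n a<r)
      q₂≉0 = nonZero (suc a) (suc (suc n)) (ℕₚ.m<n⇒m<1+n a<r)

    pivot : ℕ → ℕ → Carrier
    pivot t j = Q 1 t * descent (fundamental t) (double j)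

    -- Each new pivot gains the weights of two edges. By `evn*ver` their product is the quotient of
    -- two consecutive ratios of the claimed kind, so the induction telescopes. The case j = 0
    -- stands apart because the first edge carries λ(1,t) and not a `Ver`.
    pivot-ratio : ∀ t j → j < r → pivot t (suc j) * Q (suc j) (j ℕ.+ t) ≈ Q (suc (suc j)) (suc (j ℕ.+ t))
    pivot-ratio t zero 0<r = begin
      Q 1 t * (Evn 0 t * (lam 1 t * 1#)) * Q 1 t
        ≈⟨ *-congʳ (*-congˡ (*-cong (Evn≈evn t 0<r) (*-identityʳ _))) ⟩
      Q 1 t * (evn 0 t * lam 1 t) * Q 1 t
        ≈⟨ solve 3 (λ q e l → q :* (e :* l) :* q := e :* ((l :* q) :* q)) refl (Q 1 t) (evn 0 t) (lam 1 t) ⟩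
      evn 0 t * (lam 1 t * Q 1 t * Q 1 t)
        ≈⟨ *-congˡ (*-congʳ (÷-* (Q 1 (suc t)) q≉0)) ⟩
      evn 0 t * (Q 1 (suc t) * Q 1 t)
        ≈⟨ clear-denominators (Q 2 (suc t)) (nonZero 1 (suc t) (s≤s z≤n)) q≉0 (nonZero 0 t z≤n) ⟩
      Q 2 (suc t) * Q 0 t
        ≈⟨ trans (*-congˡ (left-boundary t)) (*-identityʳ _) ⟩
      Q 2 (suc t) ∎
      where
      q≉0 = nonZero 1 t (s≤s z≤n)
    pivot-ratio t (suc i) i<r = *-cancelʳ-nonZero q₀≉0 (begin
      Q 1 t * (fundamental t (3 ℕ.+ double i) * (fundamental t (2 ℕ.+ double i) * D)) * q₁ * q₀
        ≈⟨ *-congʳ (*-congʳ (*-congˡ (*-cong odd≈ (*-congʳ even≈)))) ⟩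
      Q 1 t * (e * (v * D)) * q₁ * q₀
        ≈⟨ solve 6 (λ x e v D q₁ q₀ → x :* (e :* (v :* D)) :* q₁ :* q₀ := e :* v :* q₁ :* (x :* D :* q₀)) refl (Q 1 t) e v D q₁ q₀ ⟩
      e * v * q₁ * (Q 1 t * D * q₀)
        ≈⟨ *-congˡ (pivot-ratio t i (ℕₚ.<⇒≤ i<r)) ⟩
      e * v * q₁ * q₁
        ≈⟨ *-assoc _ _ _ ⟩
      e * v * (q₁ * q₁)
        ≈⟨ evn*ver (suc i) (i ℕ.+ t) i<r ⟩
      Q (3 ℕ.+ i) (2 ℕ.+ (i ℕ.+ t)) * q₀ ∎)
      where
      D q₀ q₁ e v : Carrier
      D  = descent (fundamental t) (double (suc i))
      q₀ = Q (suc i) (i ℕ.+ t)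
      q₁ = Q (2 ℕ.+ i) (suc (i ℕ.+ t))
      e  = evn (suc i) (suc (i ℕ.+ t))
      v  = ver (suc i) (i ℕ.+ t)
      q₀≉0 = nonZero (suc i) (i ℕ.+ t) (ℕₚ.m≤n⇒m≤1+n (ℕₚ.<⇒≤ i<r))
      odd≈ : fundamental t (3 ℕ.+ double i) ≈ e
      odd≈ = trans (reflexive (≡.trans (maximal-odd 1 t i) (≡.cong (λ a → Evn a (suc (i ℕ.+ t))) (ℕₚ.+-comm i 1)))) (Evn≈evn _ i<r)
      even≈ : fundamental t (2 ℕ.+ double i) ≈ v
      even≈ = trans (reflexive (≡.trans (maximal-even 1 t i) (≡.cong (λ a → Ver a (i ℕ.+ t)) (ℕₚ.+-comm i 1)))) (Ver≈ver _ (ℕₚ.<⇒≤ i<r))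

    module _ (m : ℕ → ℤ) (M : ℕ → ℕ) (y : ℕ → Carrier)
      (same : ∀ a → 1 ≤ a → a < r → m (suc a) ≡ m a → M (suc a) ≡ M a)
      (rise : ∀ a → 1 ≤ a → a < r → ¬ m (suc a) ≡ m a → M (suc a) ≡ suc (M a))
      (y-hor : ∀ a → 1 ≤ a → a < r → m (suc a) ≡ m a → y (suc (double a)) ≈ hor a (M a))
      (y-ver : ∀ a → 1 ≤ a → a < r → ¬ m (suc a) ≡ m a → y (suc (double a)) ≈ ver a (M a))
      (y-top : y (suc (double r)) ≈ ver r (M r))
      (y-evn : ∀ a → a < r → y (double (suc a)) ≈ evn a (M (suc a)))
      where

      -- Induction from the top of the tree: when edge 2a + 1 is reached, everything above it is
      -- already a chain. If the edge is horizontal, that chain is `raised` and `flatten-maximal`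
      -- applies; if it is vertical, the weights already agree.
      blocks∼maximal : ∀ j a → 1 ≤ a → a ℕ.+ j ≡ r →
        Equivalent (flatWeights y (blocks m j a)) (downWeights y (blocks m j a)) 𝟎 (maximal a (M a))
      blocks∼maximal zero a 1≤a a≡r with ≡.trans (≡.sym (ℕₚ.+-identityʳ a)) a≡r
      -- At a = r only edge 2r + 1 is left; the rest of `maximal` is the zero padding of `Ver` and
      -- `Evn`.
      ... | ≡.refl = Equivalent-reflexive flat≋ down≋
        where
        flat≋ : cons 0# 𝟎 ≋ 𝟎
        flat≋ zero    = refl
        flat≋ (suc h) = refl
        down≋ : cons (y (suc (double r))) 𝟎 ≋ maximal r (M r)
        down≋ zero          = trans y-top (sym (Ver≈ver (M r) ℕₚ.≤-refl))
        down≋ (suc zero)    = sym (Evn≈0 _ ℕₚ.≤-refl)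
        down≋ (suc (suc h)) = sym (maximal≈0 (suc r) (suc (M r)) ℕₚ.≤-refl h)
      blocks∼maximal (suc j) a 1≤a a+1+j≡r with m (suc a) ℤₚ.≟ m a
        | blocks∼maximal j (suc a) (s≤s z≤n) (≡.trans (≡.sym (ℕₚ.+-suc a j)) a+1+j≡r)
      ... | yes eq | ih = Equivalent-trans
        (Equivalent-cons ih)
        (Equivalent-trans (Equivalent-reflexive (cons-cong (y-hor a 1≤a a<r eq) (λ _ → refl)) down≋) (flatten-maximal a (M a) (ℕₚ.<⇒≤ a<r)))
        where
        a<r : a < r
        a<r = ≡.subst (a <_) a+1+j≡r (ℕₚ.m<m+n a (s≤s z≤n))
        down≋ : cons (y (double (suc a))) (maximal (suc a) (M (suc a))) ≋ raised a (M a)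
        down≋ = cons-cong
          (trans (y-evn a a<r) (trans (sym (Evn≈evn _ a<r)) (reflexive (≡.cong (Evn a) (same a 1≤a a<r eq)))))
          (λ h → reflexive (≡.cong (λ n → maximal (suc a) n h) (same a 1≤a a<r eq)))
      ... | no neq | ih = Equivalent-trans
        (Equivalent-cons (Equivalent-cons ih)) (Equivalent-reflexive flat≋ down≋)
        where
        a<r : a < r
        a<r = ≡.subst (a <_) a+1+j≡r (ℕₚ.m<m+n a (s≤s z≤n))
        flat≋ : cons 0# (cons 0# 𝟎) ≋ 𝟎
        flat≋ zero          = refl
        flat≋ (suc zero)    = refl
        flat≋ (suc (suc h)) = refl
        down≋ : cons (y (suc (double a))) (cons (y (double (suc a))) (maximal (suc a) (M (suc a)))) ≋ maximal a (M a)
        down≋ zero          = trans (y-ver a 1≤a a<r neq) (sym (Ver≈ver _ (ℕₚ.<⇒≤ a<r)))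
        down≋ (suc zero)    = trans (y-evn a a<r) (trans (sym (Evn≈evn _ a<r)) (reflexive (≡.cong (Evn a) (rise a 1≤a a<r neq))))
        down≋ (suc (suc h)) = reflexive (≡.cong (λ n → maximal (suc a) n h) (rise a 1≤a a<r neq))

  -- Determinants

  -- Rows are infinite: a determinant of k rows reads columns 0 to k - 1, so deleting the last
  -- column just means no longer reading it.
  Row : Set c
  Row = ℕ → Carrier

  infixl 6 _⊕_
  infixr 7 _⊙_
  _⊕_ : Row → Row → Row
  (r ⊕ s) i = r i + s i
  _⊙_ : Carrier → Row → Row
  (x ⊙ r) i = x * r i

  sign : ℕ → Carrier
  sign zero    = 1#
  sign (suc k) = - sign k

  mutual
    -- Expansion along column j; the last row gets the sign +.
    expand : ∀ {k} → ℕ → (Vec Row k → Carrier) → Vec Row (suc k) → Carrier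
    expand {k} j F (r ∷ rs) = sign k * (r j * F rs) + expand-tail j F r rs

    expand-tail : ∀ {k} → ℕ → (Vec Row k → Carrier) → Row → Vec Row k → Carrier
    expand-tail j F r []       = 0#
    expand-tail j F r (s ∷ rs) = expand j (λ v → F (r ∷ v)) (s ∷ rs)

  det : ∀ {k} → Vec Row k → Carrier
  det {zero}  v = 1#
  det {suc k} v = expand k det v

  infix 4 _≋ᵛ_
  _≋ᵛ_ : ∀ {k} → Vec Row k → Vec Row k → Set _
  _≋ᵛ_ = Pointwise _≋_

  ≋ᵛ-refl : ∀ {k} {v : Vec Row k} → v ≋ᵛ v
  ≋ᵛ-refl = Pointwise.refl (λ _ → refl)

  expand-cong : ∀ {r k} {_∼_ : Row → Row → Set r} j {F G : Vec Row k → Carrier} → (∀ {p q} → p ∼ q → p j ≈ q j) →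
    (∀ {u v} → Pointwise _∼_ u v → F u ≈ G v) → ∀ {u v} → Pointwise _∼_ u v → expand j F u ≈ expand j G v
  expand-cong j col F≈G (p ∷ [])      = +-congʳ (*-congˡ (*-cong (col p) (F≈G [])))
  expand-cong j col F≈G (p ∷ q ∷ qs)  =
    +-cong (*-congˡ (*-cong (col p) (F≈G (q ∷ qs)))) (expand-cong j col (λ u≈v → F≈G (p ∷ u≈v)) (q ∷ qs))

  -- Restricted to the columns in use, because identities such as `row-step` are available only for
  -- the end points that belong to the tuple.
  det-cong : ∀ {k} {u v : Vec Row k} → Pointwise (λ r s → ∀ j → j < k → r j ≈ s j) u v → det u ≈ det v
  det-cong {zero}  u≈v = refl
  det-cong {suc k} u≈v = expand-cong k (λ p → p k ℕₚ.≤-refl)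
    (λ u≈v → det-cong (Pointwise.map (λ p j j<k → p j (ℕₚ.m<n⇒m<1+n j<k)) u≈v)) u≈v

  expand-cong-fun : ∀ {k} j {F G : Vec Row k → Carrier} → (∀ v → F v ≈ G v) →
    ∀ v → expand j F v ≈ expand j G v
  expand-cong-fun j F≈G (r ∷ [])     = +-congʳ (*-congˡ (*-congˡ (F≈G [])))
  expand-cong-fun j F≈G (r ∷ s ∷ rs) =
    +-cong (*-congˡ (*-congˡ (F≈G (s ∷ rs)))) (expand-cong-fun j (λ v → F≈G (r ∷ v)) (s ∷ rs))

  expand-+ : ∀ {k} j (F G : Vec Row k → Carrier) → ∀ v →
    expand j (λ u → F u + G u) v ≈ expand j F v + expand j G v
  expand-+ j F G (r ∷ []) = begin
    1# * (r j * (F [] + G [])) + 0#                      ≈⟨ +-identityʳ _ ⟩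
    1# * (r j * (F [] + G []))                           ≈⟨ solve 4 (λ o x f g → o :* (x :* (f :+ g)) := o :* (x :* f) :+ o :* (x :* g)) refl 1# (r j) (F []) (G []) ⟩
    1# * (r j * F []) + 1# * (r j * G [])                ≈⟨ +-cong (+-identityʳ _) (+-identityʳ _) ⟨
    1# * (r j * F []) + 0# + (1# * (r j * G []) + 0#)    ∎
  expand-+ {suc k} j F G (r ∷ s ∷ rs) = begin
    sign (suc k) * (r j * (F (s ∷ rs) + G (s ∷ rs))) + expand j (λ u → F (r ∷ u) + G (r ∷ u)) (s ∷ rs)
      ≈⟨ +-congˡ (expand-+ j (F ∘ (r ∷_)) (G ∘ (r ∷_)) (s ∷ rs)) ⟩
    sign (suc k) * (r j * (F (s ∷ rs) + G (s ∷ rs))) + (expand j (F ∘ (r ∷_)) (s ∷ rs) + expand j (G ∘ (r ∷_)) (s ∷ rs))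
      ≈⟨ solve 6 (λ o x f g p q → o :* (x :* (f :+ g)) :+ (p :+ q) := o :* (x :* f) :+ p :+ (o :* (x :* g) :+ q)) refl (sign (suc k)) (r j) (F (s ∷ rs)) (G (s ∷ rs)) _ _ ⟩
    sign (suc k) * (r j * F (s ∷ rs)) + expand j (F ∘ (r ∷_)) (s ∷ rs) + (sign (suc k) * (r j * G (s ∷ rs)) + expand j (G ∘ (r ∷_)) (s ∷ rs)) ∎

  expand-* : ∀ {k} j x (F : Vec Row k → Carrier) → ∀ v → expand j (λ u → x * F u) v ≈ x * expand j F v
  expand-* j x F (r ∷ []) = begin
    1# * (r j * (x * F [])) + 0#      ≈⟨ +-identityʳ _ ⟩
    1# * (r j * (x * F []))           ≈⟨ solve 4 (λ o y x f → o :* (y :* (x :* f)) := x :* (o :* (y :* f))) refl 1# (r j) x (F []) ⟩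
    x * (1# * (r j * F []))           ≈⟨ *-congˡ (+-identityʳ _) ⟨
    x * (1# * (r j * F []) + 0#)      ∎
  expand-* {suc k} j x F (r ∷ s ∷ rs) = begin
    sign (suc k) * (r j * (x * F (s ∷ rs))) + expand j (λ u → x * F (r ∷ u)) (s ∷ rs)
      ≈⟨ +-congˡ (expand-* j x (F ∘ (r ∷_)) (s ∷ rs)) ⟩
    sign (suc k) * (r j * (x * F (s ∷ rs))) + x * expand j (F ∘ (r ∷_)) (s ∷ rs)
      ≈⟨ solve 5 (λ o y x f p → o :* (y :* (x :* f)) :+ x :* p := x :* (o :* (y :* f) :+ p)) refl (sign (suc k)) (r j) x (F (s ∷ rs)) _ ⟩
    x * (sign (suc k) * (r j * F (s ∷ rs)) + expand j (F ∘ (r ∷_)) (s ∷ rs)) ∎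

  expand-0 : ∀ {k} j {F : Vec Row k → Carrier} → (∀ v → F v ≈ 0#) → ∀ v → expand j F v ≈ 0#
  expand-0 j {F} F≈0 v = begin
    expand j F v                ≈⟨ expand-cong-fun j (λ u → trans (F≈0 u) (sym (zeroˡ _))) v ⟩
    expand j (λ u → 0# * 1#) v  ≈⟨ expand-* j 0# (λ _ → 1#) v ⟩
    0# * _                      ≈⟨ zeroˡ _ ⟩
    0#                          ∎

  -- Stated for arbitrary F so that `expand j` can be shown to preserve it; `det` then inherits it
  -- by induction on its size.
  record Alternating {k} (F : Vec Row k → Carrier) : Set (c Level.⊔ ℓ) where
    field
      cong       : ∀ {u v} → u ≋ᵛ v → F u ≈ F v
      additive   : ∀ i v r s → F (v [ i ]≔ (r ⊕ s)) ≈ F (v [ i ]≔ r) + F (v [ i ]≔ s)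
      scaling    : ∀ i v x r → F (v [ i ]≔ (x ⊙ r)) ≈ x * F (v [ i ]≔ r)
      equal-rows : ∀ {i j} v → i ≢ j → Vec.lookup v i ≡ Vec.lookup v j → F v ≈ 0#

  open Alternating

  fix-first : ∀ {k} {F : Vec Row (suc k) → Carrier} → Alternating F → ∀ r → Alternating (λ v → F (r ∷ v))
  fix-first alt r .cong u≈v              = alt .cong ((λ _ → refl) ∷ u≈v)
  fix-first alt r .additive i v          = alt .additive (suc i) (r ∷ v)
  fix-first alt r .scaling i v           = alt .scaling (suc i) (r ∷ v)
  fix-first alt r .equal-rows v i≢j      = alt .equal-rows (r ∷ v) (i≢j ∘ Finₚ.suc-injective)

  -- Polarisation of the vanishing of F at two equal rows r + s.
  swap : ∀ {k} {F : Vec Row (2 ℕ.+ k) → Carrier} → Alternating F → ∀ r s v → F (r ∷ s ∷ v) + F (s ∷ r ∷ v) ≈ 0#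
  swap {F = F} alt r s v = begin
    F (r ∷ s ∷ v) + F (s ∷ r ∷ v)
      ≈⟨ +-cong (+-identityˡ _) (+-identityʳ _) ⟨
    0# + F (r ∷ s ∷ v) + (F (s ∷ r ∷ v) + 0#)
      ≈⟨ +-cong (+-congʳ (equal r)) (+-congˡ (equal s)) ⟨
    F (r ∷ r ∷ v) + F (r ∷ s ∷ v) + (F (s ∷ r ∷ v) + F (s ∷ s ∷ v))
      ≈⟨ +-cong (alt .additive (suc zero) (r ∷ r ∷ v) r s) (alt .additive (suc zero) (s ∷ r ∷ v) r s) ⟨
    F (r ∷ (r ⊕ s) ∷ v) + F (s ∷ (r ⊕ s) ∷ v)
      ≈⟨ alt .additive zero (r ∷ (r ⊕ s) ∷ v) r s ⟨
    F ((r ⊕ s) ∷ (r ⊕ s) ∷ v)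
      ≈⟨ equal (r ⊕ s) ⟩
    0# ∎
    where
    equal : ∀ t → F (t ∷ t ∷ v) ≈ 0#
    equal t = alt .equal-rows {zero} {suc zero} (t ∷ t ∷ v) (λ ()) ≡.refl

  cancel-signs : ∀ k x y → sign (suc k) * (x * y) + sign k * (x * y) ≈ 0#
  cancel-signs k x y = begin
    - sign k * (x * y) + sign k * (x * y)    ≈⟨ distribʳ _ _ _ ⟨
    (- sign k + sign k) * (x * y)            ≈⟨ *-congʳ (-‿inverseˡ _) ⟩
    0# * (x * y)                             ≈⟨ zeroˡ _ ⟩
    0#                                       ∎

  -- Deleting r leaves the same minor in both orders, with opposite signs, and likewise for s. The
  -- minors that keep both rows cancel by `swap` for F.
  expand-swap : ∀ {k} j {F : Vec Row (suc k) → Carrier} → Alternating F → ∀ r s v →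
    expand j F (r ∷ s ∷ v) + expand j F (s ∷ r ∷ v) ≈ 0#
  expand-swap {k} j {F} alt r s v = begin
    sign (suc k) * (r j * F (s ∷ v)) + (sign k * (s j * F (r ∷ v)) + T r s) +
    (sign (suc k) * (s j * F (r ∷ v)) + (sign k * (r j * F (s ∷ v)) + T s r))
      ≈⟨ solve 6 (λ a b t c d u → a :+ (b :+ t) :+ (c :+ (d :+ u)) := (a :+ d) :+ (c :+ b) :+ (t :+ u)) refl
           (sign (suc k) * (r j * F (s ∷ v))) (sign k * (s j * F (r ∷ v))) (T r s)
           (sign (suc k) * (s j * F (r ∷ v))) (sign k * (r j * F (s ∷ v))) (T s r) ⟩
    (sign (suc k) * (r j * F (s ∷ v)) + sign k * (r j * F (s ∷ v))) +
    (sign (suc k) * (s j * F (r ∷ v)) + sign k * (s j * F (r ∷ v))) + (T r s + T s r)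
      ≈⟨ +-cong (+-cong (cancel-signs k _ _) (cancel-signs k _ _)) (tails v alt) ⟩
    0# + 0# + 0#
      ≈⟨ trans (+-identityʳ _) (+-identityʳ _) ⟩
    0# ∎
    where
    T : Row → Row → Carrier
    T r s = expand-tail j (λ u → F (r ∷ u)) s v
    tails : ∀ {k} (v : Vec Row k) {F : Vec Row (suc k) → Carrier} → Alternating F →
      expand-tail j (λ u → F (r ∷ u)) s v + expand-tail j (λ u → F (s ∷ u)) r v ≈ 0#
    tails []      alt     = +-identityʳ _
    tails (t ∷ v) {F} alt = trans (sym (expand-+ j (λ u → F (r ∷ s ∷ u)) (λ u → F (s ∷ r ∷ u)) (t ∷ v)))
                                  (expand-0 j (swap alt r s) (t ∷ v))

  -- If the copy of r comes second, adjacent signs cancel. Otherwise r is swapped past its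
  -- neighbour, which brings it one row closer to its copy.
  expand-repeated : ∀ {k} j {F : Vec Row k → Carrier} → Alternating F → ∀ r v i → Vec.lookup v i ≡ r → expand j F (r ∷ v) ≈ 0#
  expand-repeated {suc k} j {F} alt r (.r ∷ v) zero ≡.refl = begin
    sign (suc k) * (r j * F (r ∷ v)) + (sign k * (r j * F (r ∷ v)) + expand-tail j (λ u → F (r ∷ u)) r v)
      ≈⟨ +-assoc _ _ _ ⟨
    sign (suc k) * (r j * F (r ∷ v)) + sign k * (r j * F (r ∷ v)) + expand-tail j (λ u → F (r ∷ u)) r v
      ≈⟨ +-cong (cancel-signs k _ _) (tail v alt) ⟩
    0# + 0#
      ≈⟨ +-identityʳ _ ⟩
    0# ∎
    where
    tail : ∀ {k} (v : Vec Row k) {F : Vec Row (suc k) → Carrier} → Alternating F → expand-tail j (λ u → F (r ∷ u)) r v ≈ 0#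
    tail []      alt = refl
    tail (t ∷ v) alt = expand-0 j (λ u → alt .equal-rows {zero} {suc zero} (r ∷ r ∷ u) (λ ()) ≡.refl) (t ∷ v)
  expand-repeated {suc (suc k)} j {F} alt r (s ∷ v@(_ ∷ _)) (suc i) eq = begin
    expand j F (r ∷ s ∷ v)
      ≈⟨ +-identityʳ _ ⟨
    expand j F (r ∷ s ∷ v) + 0#
      ≈⟨ +-congˡ (begin
        sign (2 ℕ.+ k) * (s j * F (r ∷ v)) + expand j (λ u → F (s ∷ u)) (r ∷ v)
          ≈⟨ +-cong (*-congˡ (*-congˡ (alt .equal-rows {zero} {suc i} (r ∷ v) (λ ()) (≡.sym eq)))) (expand-repeated j (fix-first alt s) r v i eq) ⟩
        sign (2 ℕ.+ k) * (s j * 0#) + 0#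
          ≈⟨ trans (+-identityʳ _) (trans (*-congˡ (zeroʳ _)) (zeroʳ _)) ⟩
        0# ∎) ⟨
    expand j F (r ∷ s ∷ v) + expand j F (s ∷ r ∷ v)
      ≈⟨ expand-swap j alt r s v ⟩
    0# ∎

  expand-alternating : ∀ {k} j {F : Vec Row k → Carrier} → Alternating F → Alternating (expand j F)
  expand-alternating j alt .cong = expand-cong j (λ p → p j) (alt .cong)
  expand-alternating {zero} j {F} alt .additive zero (_ ∷ []) r s = begin
    1# * ((r j + s j) * F []) + 0#                       ≈⟨ +-identityʳ _ ⟩
    1# * ((r j + s j) * F [])                            ≈⟨ solve 4 (λ o x y f → o :* ((x :+ y) :* f) := o :* (x :* f) :+ o :* (y :* f)) refl 1# (r j) (s j) (F []) ⟩
    1# * (r j * F []) + 1# * (s j * F [])                ≈⟨ +-cong (+-identityʳ _) (+-identityʳ _) ⟨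
    1# * (r j * F []) + 0# + (1# * (s j * F []) + 0#)    ∎
  expand-alternating {suc k} j {F} alt .additive zero (_ ∷ v@(_ ∷ _)) r s = begin
    σ * ((r j + s j) * F v) + expand j (λ u → F ((r ⊕ s) ∷ u)) v
      ≈⟨ +-congˡ (trans (expand-cong-fun j (λ u → alt .additive zero (r ∷ u) r s) v) (expand-+ j (λ u → F (r ∷ u)) (λ u → F (s ∷ u)) v)) ⟩
    σ * ((r j + s j) * F v) + (expand j (λ u → F (r ∷ u)) v + expand j (λ u → F (s ∷ u)) v)
      ≈⟨ solve 6 (λ o x y f p q → o :* ((x :+ y) :* f) :+ (p :+ q) := o :* (x :* f) :+ p :+ (o :* (y :* f) :+ q)) refl σ (r j) (s j) (F v) _ _ ⟩
    σ * (r j * F v) + expand j (λ u → F (r ∷ u)) v + (σ * (s j * F v) + expand j (λ u → F (s ∷ u)) v) ∎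
    where
    σ : Carrier
    σ = sign (suc k)
  expand-alternating {suc k} j {F} alt .additive (suc i) (t ∷ v@(_ ∷ _)) r s = begin
    expand j F (t ∷ (v [ i ]≔ (r ⊕ s)))
      ≈⟨ unfold (r ⊕ s) ⟩
    σ * (t j * F (v [ i ]≔ (r ⊕ s))) + expand j (λ u → F (t ∷ u)) (v [ i ]≔ (r ⊕ s))
      ≈⟨ +-cong (*-congˡ (*-congˡ (alt .additive i v r s))) (expand-alternating j (fix-first alt t) .additive i v r s) ⟩
    σ * (t j * (F (v [ i ]≔ r) + F (v [ i ]≔ s))) + (expand j (λ u → F (t ∷ u)) (v [ i ]≔ r) + expand j (λ u → F (t ∷ u)) (v [ i ]≔ s))
      ≈⟨ solve 6 (λ o x f g p q → o :* (x :* (f :+ g)) :+ (p :+ q) := o :* (x :* f) :+ p :+ (o :* (x :* g) :+ q)) refl σ (t j) (F (v [ i ]≔ r)) (F (v [ i ]≔ s)) _ _ ⟩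
    σ * (t j * F (v [ i ]≔ r)) + expand j (λ u → F (t ∷ u)) (v [ i ]≔ r) + (σ * (t j * F (v [ i ]≔ s)) + expand j (λ u → F (t ∷ u)) (v [ i ]≔ s))
      ≈⟨ +-cong (unfold r) (unfold s) ⟨
    expand j F (t ∷ (v [ i ]≔ r)) + expand j F (t ∷ (v [ i ]≔ s)) ∎
    where
    σ : Carrier
    σ = sign (suc k)
    unfold : ∀ w → expand j F (t ∷ (v [ i ]≔ w)) ≈ σ * (t j * F (v [ i ]≔ w)) + expand j (λ u → F (t ∷ u)) (v [ i ]≔ w)
    unfold w with v [ i ]≔ w
    ... | _ ∷ _ = refl
  expand-alternating {zero} j {F} alt .scaling zero (_ ∷ []) x r = begin
    1# * ((x * r j) * F []) + 0#      ≈⟨ +-identityʳ _ ⟩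
    1# * ((x * r j) * F [])           ≈⟨ solve 4 (λ o x y f → o :* ((x :* y) :* f) := x :* (o :* (y :* f))) refl 1# x (r j) (F []) ⟩
    x * (1# * (r j * F []))           ≈⟨ *-congˡ (+-identityʳ _) ⟨
    x * (1# * (r j * F []) + 0#)      ∎
  expand-alternating {suc k} j {F} alt .scaling zero (_ ∷ v@(_ ∷ _)) x r = begin
    σ * ((x * r j) * F v) + expand j (λ u → F ((x ⊙ r) ∷ u)) v
      ≈⟨ +-congˡ (trans (expand-cong-fun j (λ u → alt .scaling zero (r ∷ u) x r) v) (expand-* j x (λ u → F (r ∷ u)) v)) ⟩
    σ * ((x * r j) * F v) + x * expand j (λ u → F (r ∷ u)) v
      ≈⟨ solve 5 (λ o x y f p → o :* ((x :* y) :* f) :+ x :* p := x :* (o :* (y :* f) :+ p)) refl σ x (r j) (F v) _ ⟩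
    x * (σ * (r j * F v) + expand j (λ u → F (r ∷ u)) v) ∎
    where
    σ : Carrier
    σ = sign (suc k)
  expand-alternating {suc k} j {F} alt .scaling (suc i) (t ∷ v@(_ ∷ _)) x r = begin
    expand j F (t ∷ (v [ i ]≔ (x ⊙ r)))
      ≈⟨ unfold (x ⊙ r) ⟩
    σ * (t j * F (v [ i ]≔ (x ⊙ r))) + expand j (λ u → F (t ∷ u)) (v [ i ]≔ (x ⊙ r))
      ≈⟨ +-cong (*-congˡ (*-congˡ (alt .scaling i v x r))) (expand-alternating j (fix-first alt t) .scaling i v x r) ⟩
    σ * (t j * (x * F (v [ i ]≔ r))) + x * expand j (λ u → F (t ∷ u)) (v [ i ]≔ r)
      ≈⟨ solve 5 (λ o y x f p → o :* (y :* (x :* f)) :+ x :* p := x :* (o :* (y :* f) :+ p)) refl σ (t j) x (F (v [ i ]≔ r)) _ ⟩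
    x * (σ * (t j * F (v [ i ]≔ r)) + expand j (λ u → F (t ∷ u)) (v [ i ]≔ r))
      ≈⟨ *-congˡ (unfold r) ⟨
    x * expand j F (t ∷ (v [ i ]≔ r)) ∎
    where
    σ : Carrier
    σ = sign (suc k)
    unfold : ∀ w → expand j F (t ∷ (v [ i ]≔ w)) ≈ σ * (t j * F (v [ i ]≔ w)) + expand j (λ u → F (t ∷ u)) (v [ i ]≔ w)
    unfold w with v [ i ]≔ w
    ... | _ ∷ _ = refl
  expand-alternating j alt .equal-rows {zero}  {zero}  v       i≢j eq = contradiction ≡.refl i≢j
  expand-alternating j alt .equal-rows {zero}  {suc b} (r ∷ v) i≢j eq = expand-repeated j alt r v b (≡.sym eq)
  expand-alternating j alt .equal-rows {suc a} {zero}  (r ∷ v) i≢j eq = expand-repeated j alt r v a eq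
  expand-alternating {suc k} j {F} alt .equal-rows {suc a} {suc b} (r ∷ v@(_ ∷ _)) i≢j eq = begin
    sign (suc k) * (r j * F v) + expand j (λ u → F (r ∷ u)) v
      ≈⟨ +-cong (*-congˡ (*-congˡ (alt .equal-rows v i≢j′ eq))) (expand-alternating j (fix-first alt r) .equal-rows v i≢j′ eq) ⟩
    sign (suc k) * (r j * 0#) + 0#
      ≈⟨ trans (+-identityʳ _) (trans (*-congˡ (zeroʳ _)) (zeroʳ _)) ⟩
    0# ∎
    where
    i≢j′ : a ≢ b
    i≢j′ = i≢j ∘ ≡.cong suc

  det-alternating : ∀ {k} → Alternating (det {k})
  det-alternating {zero} .cong _ = refl
  det-alternating {zero} .equal-rows {()}
  det-alternating {suc k} = expand-alternating k det-alternating

  expand-zero-column : ∀ {k} j (F : Vec Row k → Carrier) v → (∀ i → Vec.lookup v i j ≈ 0#) → expand j F v ≈ 0#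
  expand-zero-column {k} j F (r ∷ v) col≈0 = begin
    sign k * (r j * F v) + expand-tail j F r v
      ≈⟨ +-cong (*-congˡ (*-congʳ (col≈0 zero))) (tail v F (λ i → col≈0 (suc i))) ⟩
    sign k * (0# * F v) + 0#
      ≈⟨ trans (+-identityʳ _) (trans (*-congˡ (zeroˡ _)) (zeroʳ _)) ⟩
    0# ∎
    where
    tail : ∀ {k} (v : Vec Row k) (F : Vec Row k → Carrier) → (∀ i → Vec.lookup v i j ≈ 0#) → expand-tail j F r v ≈ 0#
    tail []      F col≈0 = refl
    tail (s ∷ v) F col≈0 = expand-zero-column j (λ u → F (r ∷ u)) (s ∷ v) col≈0

  expand-last-row : ∀ {k} j (F : Vec Row k → Carrier) v r → (∀ i → Vec.lookup v i j ≈ 0#) → expand j F (v ∷ʳ r) ≈ r j * F v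
  expand-last-row j F []      r col≈0 = trans (+-identityʳ _) (*-identityˡ _)
  expand-last-row {suc k} j F (s ∷ v) r col≈0 = begin
    expand j F (s ∷ (v ∷ʳ r))
      ≈⟨ unfold (v ∷ʳ r) ⟩
    sign (suc k) * (s j * F (v ∷ʳ r)) + expand j (λ u → F (s ∷ u)) (v ∷ʳ r)
      ≈⟨ +-cong (*-congˡ (*-congʳ (col≈0 zero))) (expand-last-row j (λ u → F (s ∷ u)) v r (λ i → col≈0 (suc i))) ⟩
    sign (suc k) * (0# * F (v ∷ʳ r)) + r j * F (s ∷ v)
      ≈⟨ trans (+-congʳ (trans (*-congˡ (zeroˡ _)) (zeroʳ _))) (+-identityˡ _) ⟩
    r j * F (s ∷ v) ∎
    where
    unfold : ∀ w → expand j F (s ∷ w) ≈ sign (suc k) * (s j * F w) + expand j (λ u → F (s ∷ u)) w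
    unfold (_ ∷ _) = refl

  expand-scale : ∀ {k} j x y {F G : Vec Row k → Carrier} → (∀ v → F (Vec.map (x ⊙_) v) ≈ y * G v) →
    ∀ v → expand j F (Vec.map (x ⊙_) v) ≈ x * y * expand j G v
  expand-scale {k} j x y {F} {G} hyp (r ∷ v) = begin
    sign k * (x * r j * F (Vec.map (x ⊙_) v)) + expand-tail j F (x ⊙ r) (Vec.map (x ⊙_) v)
      ≈⟨ +-cong (*-congˡ (*-congˡ (hyp v))) (tail v hyp) ⟩
    sign k * (x * r j * (y * G v)) + x * y * expand-tail j G r v
      ≈⟨ solve 6 (λ o x z y g t → o :* (x :* z :* (y :* g)) :+ x :* y :* t := x :* y :* (o :* (z :* g) :+ t)) refl (sign k) x (r j) y (G v) _ ⟩
    x * y * (sign k * (r j * G v) + expand-tail j G r v) ∎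
    where
    tail : ∀ {k} (v : Vec Row k) {F G : Vec Row k → Carrier} → (∀ v → F (Vec.map (x ⊙_) v) ≈ y * G v) →
      expand-tail j F (x ⊙ r) (Vec.map (x ⊙_) v) ≈ x * y * expand-tail j G r v
    tail []      hyp = sym (zeroʳ _)
    tail (s ∷ v) hyp = expand-scale j x y (λ u → hyp (r ∷ u)) (s ∷ v)

  det-scale : ∀ {k} x (v : Vec Row k) → det (Vec.map (x ⊙_) v) ≈ x ^ k * det v
  det-scale {zero}  x v = sym (*-identityʳ _)
  det-scale {suc k} x v = expand-scale k x (x ^ k) (det-scale x) v

  zero-row : ∀ {k} {F : Vec Row k → Carrier} → Alternating F → ∀ i v → F (v [ i ]≔ 𝟎) ≈ 0#
  zero-row {F = F} alt i v = begin
    F (v [ i ]≔ 𝟎)          ≈⟨ alt .cong (update i v) ⟩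
    F (v [ i ]≔ (0# ⊙ 𝟎))   ≈⟨ alt .scaling i v 0# 𝟎 ⟩
    0# * F (v [ i ]≔ 𝟎)     ≈⟨ zeroˡ _ ⟩
    0#                      ∎
    where
    update : ∀ {k} (i : Fin k) v → (v [ i ]≔ 𝟎) ≋ᵛ (v [ i ]≔ (0# ⊙ 𝟎))
    update zero    (_ ∷ v) = (λ _ → sym (zeroˡ _)) ∷ ≋ᵛ-refl
    update (suc i) (_ ∷ v) = (λ _ → refl) ∷ update i v

  combination : ∀ {a} {X : Set a} → (X → Carrier) → (X → Row) → List X → Row
  combination w r []       = 𝟎
  combination w r (x ∷ xs) = (w x ⊙ r x) ⊕ combination w r xs

  linear-combination : ∀ {a} {X : Set a} {k} {F : Vec Row k → Carrier} → Alternating F → ∀ i v w (r : X → Row) xs →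
    F (v [ i ]≔ combination w r xs) ≈ sum K (List.map (λ x → w x * F (v [ i ]≔ r x)) xs)
  linear-combination alt i v w r []       = zero-row alt i v
  linear-combination alt i v w r (x ∷ xs) = trans (alt .additive i v _ _)
    (+-cong (alt .scaling i v (w x) (r x)) (linear-combination alt i v w r xs))

  -- Generated by operations on rows and not by coefficient vectors, so that the multilinearity laws
  -- apply by structural recursion.
  data Span {k} (ws : Vec Row k) : Row → Set (c Level.⊔ ℓ) where
    member : ∀ i → Span ws (Vec.lookup ws i)
    null   : Span ws 𝟎
    plus   : ∀ {r s} → Span ws r → Span ws s → Span ws (r ⊕ s)
    times  : ∀ x {r} → Span ws r → Span ws (x ⊙ r)

  span-weaken : ∀ {k} {ws : Vec Row k} {w r} → Span ws r → Span (w ∷ ws) r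
  span-weaken (member i)  = member (suc i)
  span-weaken null        = null
  span-weaken (plus p q)  = plus (span-weaken p) (span-weaken q)
  span-weaken (times x p) = times x (span-weaken p)

  dependent-row : ∀ {k} {F : Vec Row (suc k) → Carrier} → Alternating F → ∀ {ws r} → Span ws r → F (r ∷ ws) ≈ 0#
  dependent-row alt {ws} (member i)  = alt .equal-rows {zero} {suc i} (_ ∷ ws) (λ ()) ≡.refl
  dependent-row alt {ws} null        = zero-row alt zero (𝟎 ∷ ws)
  dependent-row alt {ws} (plus p q)  = trans (alt .additive zero (𝟎 ∷ ws) _ _)
    (trans (+-cong (dependent-row alt p) (dependent-row alt q)) (+-identityʳ _))
  dependent-row alt {ws} (times x p) = trans (alt .scaling zero (𝟎 ∷ ws) x _)
    (trans (*-congˡ (dependent-row alt p)) (zeroʳ _))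

  data Unitriangular : ∀ {k} → Vec Row k → Vec Row k → Set (c Level.⊔ ℓ) where
    []  : Unitriangular [] []
    _∷_ : ∀ {k} {us ws : Vec Row k} {u w s} → Span ws s × u ≋ w ⊕ s → Unitriangular us ws → Unitriangular (u ∷ us) (w ∷ ws)

  -- The lower rows are replaced first; the surplus s of the top row is then a combination of rows
  -- present in the matrix and contributes nothing.
  unitriangular : ∀ {k} {F : Vec Row k → Carrier} → Alternating F → ∀ {us ws} → Unitriangular us ws → F us ≈ F ws
  unitriangular alt []                = refl
  unitriangular {F = F} alt {u ∷ us} {w ∷ ws} (_∷_ {s = s} (span , u≈) tri) = begin
    F (u ∷ us)              ≈⟨ unitriangular (fix-first alt u) tri ⟩
    F (u ∷ ws)              ≈⟨ alt .cong (u≈ ∷ ≋ᵛ-refl) ⟩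
    F ((w ⊕ s) ∷ ws)        ≈⟨ alt .additive zero (u ∷ ws) w s ⟩
    F (w ∷ ws) + F (s ∷ ws) ≈⟨ +-congˡ (dependent-row alt span) ⟩
    F (w ∷ ws) + 0#         ≈⟨ +-identityʳ _ ⟩
    F (w ∷ ws)              ∎

  -- The Lindström–Gessel–Viennot lemma

  open Enumerates
  open Equivalence using (to; from)

  -- The enumeration travels with the value, so the induction for the determinant also produces the
  -- list required by the theorem.
  HasSum : ∀ {a p} {X : Set a} → (X → Carrier) → (X → Set p) → Carrier → Set _
  HasSum w P S = ∃[ L ] Enumerates L P × S ≈ sum K (List.map w L)

  module _ {a} {X : Set a} {w : X → Carrier} where
    hasSum-empty : ∀ {p} {P : X → Set p} → (∀ x → ¬ P x) → HasSum w P 0#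
    hasSum-empty ¬P = [] , (record { unique = [] ; exact = λ x → mk⇔ (λ ()) (λ Px → contradiction Px (¬P x)) }) , refl

    hasSum-singleton : ∀ {p} {P : X → Set p} z → (∀ x → P x ⇔ x ≡ z) → HasSum w P (w z)
    hasSum-singleton z P⇔ = z ∷ []
      , (record { unique = All.[] ∷ [] ; exact = λ x → mk⇔ (λ { (here ≡.refl) → P⇔ x .from ≡.refl }) (here ∘ P⇔ x .to) })
      , sym (+-identityʳ _)

    hasSum-resp : ∀ {p q} {P : X → Set p} {Q : X → Set q} {S T} → (∀ x → P x ⇔ Q x) → S ≈ T → HasSum w P S → HasSum w Q T
    hasSum-resp P⇔Q S≈T (L , enum , S≈) = L
      , (record { unique = unique enum ; exact = λ x → mk⇔ (P⇔Q x .to ∘ exact enum x .to) (exact enum x .from ∘ P⇔Q x .from) })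
      , trans (sym S≈T) S≈

    sum-++ : ∀ xs ys → sum K (List.map w (xs ++ ys)) ≈ sum K (List.map w xs) + sum K (List.map w ys)
    sum-++ []       ys = sym (+-identityˡ _)
    sum-++ (x ∷ xs) ys = trans (+-congˡ (sum-++ xs ys)) (sym (+-assoc _ _ _))

    hasSum-⊎ : ∀ {p q} {P : X → Set p} {Q : X → Set q} {S T} → (∀ x → P x → ¬ Q x) →
      HasSum w P S → HasSum w Q T → HasSum w (λ x → P x ⊎ Q x) (S + T)
    hasSum-⊎ ¬P×Q (L , enumL , S≈) (M , enumM , T≈) = L ++ M
      , (record
        { unique = Unique.++⁺ (unique enumL) (unique enumM)
            (λ { (x∈L , x∈M) → ¬P×Q _ (exact enumL _ .to x∈L) (exact enumM _ .to x∈M) })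
        ; exact = λ x → mk⇔
            (λ x∈ → [ inj₁ ∘ exact enumL x .to , inj₂ ∘ exact enumM x .to ]′ (∈-++⁻ L x∈))
            [ ∈-++⁺ˡ ∘ exact enumL x .from , ∈-++⁺ʳ L ∘ exact enumM x .from ]′ })
      , trans (+-cong S≈ T≈) (sym (sum-++ L M))

    hasSum-⋃ : ∀ {b q} {I : Set b} {Q : I → X → Set q} {S : I → Carrier} →
      (∀ {i j x} → Q i x → Q j x → i ≡ j) → ∀ {is} → Unique is → (∀ {i} → i ∈ is → HasSum w (Q i) (S i)) →
      HasSum w (λ x → ∃[ i ] i ∈ is × Q i x) (sum K (List.map S is))
    hasSum-⋃ disj {[]}     []          sums = hasSum-empty (λ { x (i , () , _) })
    hasSum-⋃ {I = I} {Q = Q} disj {i ∷ is} (i∉is ∷ uniq) sums =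
      hasSum-resp equiv refl (hasSum-⊎ apart (sums (here ≡.refl)) (hasSum-⋃ disj uniq (sums ∘ there)))
      where
      apart : ∀ x → Q i x → ¬ (∃[ j ] j ∈ is × Q j x)
      apart x Qi (j , j∈ , Qj) = All.lookup i∉is j∈ (disj Qi Qj)
      equiv : ∀ x → (Q i x ⊎ ∃[ j ] j ∈ is × Q j x) ⇔ (∃[ j ] j ∈ (i ∷ is) × Q j x)
      equiv x = mk⇔
        (λ { (inj₁ Qi) → i , here ≡.refl , Qi ; (inj₂ (j , j∈ , Qj)) → j , there j∈ , Qj })
        (λ { (_ , here ≡.refl , Qi) → inj₁ Qi ; (j , there j∈ , Qj) → inj₂ (j , j∈ , Qj) })

  hasSum-map : ∀ {a b p} {X : Set a} {Y : Set b} {w : X → Carrier} {w′ : Y → Carrier} {P : X → Set p} {S} (f : X → Y) x →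
    (∀ {u v} → f u ≡ f v → u ≡ v) → (∀ u → w′ (f u) ≈ x * w u) →
    HasSum w P S → HasSum w′ (λ v → ∃[ u ] P u × v ≡ f u) (x * S)
  hasSum-map {w = w} {w′} {S = S} f x inj weight (L , enum , S≈) = List.map f L
    , (record
      { unique = Unique.map⁺ inj (unique enum)
      ; exact = λ v → mk⇔
          (λ v∈ → let (u , u∈ , v≡) = ∈-map⁻ f v∈ in u , exact enum u .to u∈ , v≡)
          (λ { (u , Pu , ≡.refl) → ∈-map⁺ f (exact enum u .from Pu) }) })
    , trans (*-congˡ S≈) (weighted L)
    where
    weighted : ∀ L → x * sum K (List.map w L) ≈ sum K (List.map w′ (List.map f L))
    weighted []      = zeroʳ x
    weighted (u ∷ L) = trans (distribˡ _ _ _) (+-cong (sym (weight u)) (weighted L))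

  _≟ₚ_ : (p q : Point) → Dec (p ≡ q)
  _≟ₚ_ = ≡-dec ℕₚ._≟_ ℕₚ._≟_

  leftmost : ∀ {k} (ps : Vec Point (suc k)) → ∃[ i ] ∀ j → proj₁ (lookup ps i) ≤ proj₁ (lookup ps j)
  leftmost (p ∷ []) = zero , λ { zero → ℕₚ.≤-refl }
  leftmost (p ∷ ps@(_ ∷ _)) with leftmost ps
  ... | i , min with ℕₚ.≤-total (proj₁ p) (proj₁ (lookup ps i))
  ...   | inj₁ p≤ = zero  , λ { zero → ℕₚ.≤-refl ; (suc j) → ℕₚ.≤-trans p≤ (min j) }
  ...   | inj₂ ≤p = suc i , λ { zero → ≤p ; (suc j) → min j }

  lookup-∷ʳ-fromℕ : ∀ {a} {X : Set a} {k} (v : Vec X k) x → lookup (v ∷ʳ x) (fromℕ k) ≡ x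
  lookup-∷ʳ-fromℕ []      x = ≡.refl
  lookup-∷ʳ-fromℕ (_ ∷ v) x = lookup-∷ʳ-fromℕ v x

  lookup-∷ʳ-inject₁ : ∀ {a} {X : Set a} {k} (v : Vec X k) x i → lookup (v ∷ʳ x) (inject₁ i) ≡ lookup v i
  lookup-∷ʳ-inject₁ (_ ∷ v) x zero    = ≡.refl
  lookup-∷ʳ-inject₁ (_ ∷ v) x (suc i) = lookup-∷ʳ-inject₁ v x i

  total-∷ʳ : ∀ {a} {X : Set a} {k} (g : X → ℕ) (v : Vec X k) x →
    Vec.sum (Vec.map g (v ∷ʳ x)) ≡ Vec.sum (Vec.map g v) ℕ.+ g x
  total-∷ʳ g []      x = ℕₚ.+-identityʳ _
  total-∷ʳ g (z ∷ v) x = ≡.trans (≡.cong (g z ℕ.+_) (total-∷ʳ g v x)) (≡.sym (ℕₚ.+-assoc (g z) _ _))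

  total-update : ∀ {a} {X : Set a} {k} (g : X → ℕ) (v : Vec X k) i x → g x < g (lookup v i) →
    Vec.sum (Vec.map g (v [ i ]≔ x)) < Vec.sum (Vec.map g v)
  total-update g (z ∷ v) zero    x lt = ℕₚ.+-monoˡ-< _ lt
  total-update g (z ∷ v) (suc i) x lt = ℕₚ.+-monoʳ-< (g z) (total-update g v i x lt)

  tupleWeight : (Step → Carrier) → ∀ {k} → Vec (List Step) k → Carrier
  tupleWeight w P = product K (List.map (λ ss → product K (List.map w ss)) (Vec.toList P))

  module LGV
    (w : Step → Carrier) (steps : Point → List Step)
    (steps-unique : ∀ p → Unique (steps p))
    (no-descent-below-0 : ∀ p {s} → s ∈ steps p → NoDescentBelow0 p s)
    -- The i-th path ends at (T i , 0); X bounds the abscissas of the starting points.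
    (k₀ : ℕ) (T : ℕ → ℕ) (X C : ℕ)
    (T-decreasing : ∀ {i j} → i < j → j < k₀ → T j < T i)
    (X≤T : ∀ {i} → i < k₀ → X ≤ T i)
    (T<C : ∀ {i} → i < k₀ → T i < C)
    -- Entry j of `row p` stands for the weighted number of paths from p to (T j, 0); the argument
    -- uses only boundary values and the first-step recursion.
    (row : Point → Row)
    (row-end : ∀ j → row (T j , 0) j ≈ 1#)
    (row-past : ∀ {x} h j → T j < x → row (x , h) j ≈ 0#)
    (row-column : ∀ h j → row (T j , suc h) j ≈ 0#)
    (row-step : ∀ x h j → x ≤ T j → (x , h) ≢ (T j , 0) →
       row (x , h) j ≈ combination w (row ∘ move (x , h)) (steps (x , h)) j)
    where

    tupleWeight-∷ʳ : ∀ {k} (P : Vec (List Step) k) → tupleWeight w (P ∷ʳ []) ≈ 1# * tupleWeight w P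
    tupleWeight-∷ʳ P = trans (lemma P) (sym (*-identityˡ _))
      where
      lemma : ∀ {k} (P : Vec (List Step) k) → tupleWeight w (P ∷ʳ []) ≈ tupleWeight w P
      lemma []       = *-identityˡ _
      lemma (ss ∷ P) = *-congˡ (lemma P)

    tupleWeight-prepend : ∀ {k} i s (P : Vec (List Step) k) → tupleWeight w (updateAt P i (s ∷_)) ≈ w s * tupleWeight w P
    tupleWeight-prepend zero    s (ss ∷ P) = *-assoc _ _ _
    tupleWeight-prepend (suc i) s (ss ∷ P) = begin
      product K (List.map w ss) * tupleWeight w (updateAt P i (s ∷_))  ≈⟨ *-congˡ (tupleWeight-prepend i s P) ⟩
      product K (List.map w ss) * (w s * tupleWeight w P)              ≈⟨ *-assoc _ _ _ ⟨
      product K (List.map w ss) * w s * tupleWeight w P                ≈⟨ *-congʳ (*-comm _ _) ⟩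
      w s * product K (List.map w ss) * tupleWeight w P                ≈⟨ *-assoc _ _ _ ⟩
      w s * (product K (List.map w ss) * tupleWeight w P)              ∎

    open DisjointPaths
    open Admissible

    admissible-init : ∀ {k} (ps : Vec Point k) p → Admissible X (ps ∷ʳ p) → Admissible X ps
    admissible-init ps p adm .onGrid i = ≡.subst OnGrid (lookup-∷ʳ-inject₁ ps p i) (adm .onGrid (inject₁ i))
    admissible-init ps p adm .distinct i j i≢j eq = adm .distinct (inject₁ i) (inject₁ j) (i≢j ∘ Finₚ.inject₁-injective)
      (≡.trans (lookup-∷ʳ-inject₁ ps p i) (≡.trans eq (≡.sym (lookup-∷ʳ-inject₁ ps p j))))
    admissible-init ps p adm .ordered i j i<j = ≡.subst₂ (Above X) (lookup-∷ʳ-inject₁ ps p i) (lookup-∷ʳ-inject₁ ps p j)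
      (adm .ordered (inject₁ i) (inject₁ j) (≡.subst₂ _<_ (≡.sym (Finₚ.toℕ-inject₁ i)) (≡.sym (Finₚ.toℕ-inject₁ j)) i<j))

    module Advance {k} (ps : Vec Point k) (adm : Admissible X ps) (i : Fin k)
      (min : ∀ j → proj₁ (lookup ps i) ≤ proj₁ (lookup ps j)) where

      p : Point
      p = lookup ps i

      -- Abscissas increase along a path, and no other point lies to the left of p.
      avoids : ∀ j ss → j ≢ i → ¬ p ∈ vertices (lookup ps j) ss
      avoids j ss j≢i p∈ with later-vertex (lookup ps j) ss p∈
      ... | inj₁ eq = adm .distinct i j (j≢i ∘ ≡.sym) eq
      ... | inj₂ lt = ℕₚ.<⇒≱ lt (min j)

      module _ (s : Step) (s∈ : s ∈ steps p) where
        q : Point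
        q = move p s

        ps′ : Vec Point k
        ps′ = ps [ i ]≔ q

        at-i : lookup ps′ i ≡ q
        at-i = Vecₚ.lookup∘update i ps q

        at-other : ∀ {j} → j ≢ i → lookup ps′ j ≡ lookup ps j
        at-other j≢i = Vecₚ.lookup∘update′ j≢i ps q

        advance-admissible : (∀ j → j ≢ i → lookup ps j ≢ q) → Admissible X ps′
        advance-admissible free .onGrid j with j Finₚ.≟ i
        ... | yes ≡.refl = ≡.subst OnGrid (≡.sym at-i) (move-onGrid p s (no-descent-below-0 p s∈) (adm .onGrid i))
        ... | no j≢i     = ≡.subst OnGrid (≡.sym (at-other j≢i)) (adm .onGrid j)
        advance-admissible free .distinct a b a≢b eq with a Finₚ.≟ i | b Finₚ.≟ i
        ... | yes ≡.refl | yes ≡.refl = a≢b ≡.refl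
        ... | yes ≡.refl | no b≢i = free b b≢i (≡.trans (≡.sym (at-other b≢i)) (≡.trans (≡.sym eq) at-i))
        ... | no a≢i | yes ≡.refl = free a a≢i (≡.trans (≡.sym (at-other a≢i)) (≡.trans eq at-i))
        ... | no a≢i | no b≢i = adm .distinct a b a≢b (≡.trans (≡.sym (at-other a≢i)) (≡.trans eq (at-other b≢i)))
        advance-admissible free .ordered a b a<b with a Finₚ.≟ i | b Finₚ.≟ i
        ... | yes ≡.refl | yes ≡.refl = contradiction a<b (ℕₚ.<-irrefl ≡.refl)
        ... | yes ≡.refl | no b≢i = ≡.subst₂ (Above X) (≡.sym at-i) (≡.sym (at-other b≢i))
          (move-upper p (lookup ps b) s (adm .onGrid i) (adm .onGrid b) (no-descent-below-0 p s∈) (adm .distinct i b (b≢i ∘ ≡.sym)) (min b) (adm .ordered i b a<b))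
        ... | no a≢i | yes ≡.refl = ≡.subst₂ (Above X) (≡.sym (at-other a≢i)) (≡.sym at-i)
          (move-lower p (lookup ps a) s (adm .onGrid i) (adm .onGrid a) (no-descent-below-0 p s∈) (adm .distinct i a (a≢i ∘ ≡.sym)) (min a) (adm .ordered a i a<b))
        ... | no a≢i | no b≢i = ≡.subst₂ (Above X) (≡.sym (at-other a≢i)) (≡.sym (at-other b≢i)) (adm .ordered a b a<b)

        module _ (P : Vec (List Step) k) where
          private
            P⁺ : Vec (List Step) k
            P⁺ = updateAt P i (s ∷_)
            P⁺-i : lookup P⁺ i ≡ s ∷ lookup P i
            P⁺-i = Vecₚ.lookup∘updateAt i P
            P⁺-other : ∀ {j} → j ≢ i → lookup P⁺ j ≡ lookup P j
            P⁺-other {j} j≢i = Vecₚ.lookup∘updateAt′ j i j≢i P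
            vs⁺ vs′ : Fin k → List Point
            vs⁺ j = vertices (lookup ps j) (lookup P⁺ j)
            vs′ j = vertices (lookup ps′ j) (lookup P j)
            vs-i : vs⁺ i ≡ p ∷ vs′ i
            vs-i = ≡.trans (≡.cong (vertices p) P⁺-i) (≡.trans (vertices-∷ p s (lookup P i)) (≡.cong (λ z → p ∷ vertices z (lookup P i)) (≡.sym at-i)))
            vs-other : ∀ {j} → j ≢ i → vs⁺ j ≡ vs′ j
            vs-other j≢i = ≡.cong₂ vertices (≡.sym (at-other j≢i)) (P⁺-other j≢i)

          prepend-disjoint : DisjointPaths steps T ps′ P → DisjointPaths steps T ps P⁺
          prepend-disjoint D .isPath j with j Finₚ.≟ i
          ... | yes ≡.refl = ≡.subst (λ ss → Path steps p ss _) (≡.sym P⁺-i) (step s∈ (≡.subst (λ z → Path steps z _ _) at-i (D .isPath i)))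
          ... | no j≢i     = ≡.subst₂ (λ z ss → Path steps z ss _) (at-other j≢i) (≡.sym (P⁺-other j≢i)) (D .isPath j)
          prepend-disjoint D .disjoint a b a≢b {z} (z∈a , z∈b) = split (a Finₚ.≟ i) (b Finₚ.≟ i)
            where
            head : ∀ {b} → b ≢ i → z ∈ vs⁺ i → z ∈ vs⁺ b → ⊥
            head {b} b≢i z∈i z∈b with ≡.subst (z ∈_) vs-i z∈i
            ... | here ≡.refl = avoids b (lookup P⁺ b) b≢i z∈b
            ... | there z∈′   = D .disjoint i b (b≢i ∘ ≡.sym) (z∈′ , ≡.subst (z ∈_) (vs-other b≢i) z∈b)
            split : Dec (a ≡ i) → Dec (b ≡ i) → ⊥
            split (yes ≡.refl) (yes ≡.refl) = a≢b ≡.refl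
            split (yes ≡.refl) (no b≢i)     = head b≢i z∈a z∈b
            split (no a≢i)     (yes ≡.refl) = head a≢i z∈b z∈a
            split (no a≢i)     (no b≢i)     = D .disjoint a b a≢b (≡.subst (z ∈_) (vs-other a≢i) z∈a , ≡.subst (z ∈_) (vs-other b≢i) z∈b)

          behead-disjoint : DisjointPaths steps T ps P⁺ → DisjointPaths steps T ps′ P
          behead-disjoint D .isPath j with j Finₚ.≟ i
          ... | no j≢i     = ≡.subst₂ (λ z ss → Path steps z ss _) (≡.sym (at-other j≢i)) (P⁺-other j≢i) (D .isPath j)
          ... | yes ≡.refl with lookup P⁺ i | P⁺-i | D .isPath i
          ...   | _ | ≡.refl | step _ path = ≡.subst (λ z → Path steps z _ _) (≡.sym at-i) path
          behead-disjoint D .disjoint a b a≢b {z} (z∈a , z∈b) = D .disjoint a b a≢b (embed a z∈a , embed b z∈b)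
            where
            embed : ∀ j → z ∈ vs′ j → z ∈ vs⁺ j
            embed j z∈ with j Finₚ.≟ i
            ... | yes ≡.refl = ≡.subst (z ∈_) (≡.sym vs-i) (there z∈)
            ... | no j≢i     = ≡.subst (z ∈_) (≡.sym (vs-other j≢i)) z∈

    measure : ∀ {k} → Vec Point k → ℕ
    measure ps = Vec.sum (Vec.map (λ p → C ∸ proj₁ p) ps)

    rows : ∀ {k} → Vec Point k → Vec Row k
    rows = Vec.map row

    lookup-rows : ∀ {k} (ps : Vec Point k) i → lookup (rows ps) i ≡ row (lookup ps i)
    lookup-rows ps i = Vecₚ.lookup-map i row ps

    -- The point furthest to the left is advanced by one step in all possible ways.
    -- By multilinearity the determinant follows, and it vanishes as soon as two
    -- points meet; planarity makes the last point the first one to arrive.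
    lgv : ∀ fuel {k} (ps : Vec Point k) → k ≤ k₀ → Admissible X ps → measure ps < fuel →
      HasSum (tupleWeight w) (DisjointPaths steps T ps) (det (rows ps))
    lgv (suc fuel) [] _ adm _ = hasSum-singleton [] (λ { [] → mk⇔ (λ _ → ≡.refl) (λ _ → record { isPath = λ () ; disjoint = λ () }) })
    lgv (suc fuel) {suc k} ps k<k₀ adm (s≤s measure≤) with leftmost ps
    ... | i , min with proj₁ (lookup ps i) ℕₚ.≤? T k
    -- All points are then past T k. The last path cannot reach its end, and column k vanishes.
    ...   | no x≰t = hasSum-resp (λ P → mk⇔ (λ { (() , _) }) (λ D → contradiction (unreachable D) x≰t)) (sym det≈0)
                       (hasSum-empty {P = λ P → ⊥ × DisjointPaths steps T ps P} (λ { _ (() , _) }))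
      where
      unreachable : ∀ {P} → DisjointPaths steps T ps P → proj₁ (lookup ps i) ≤ T k
      unreachable D = ℕₚ.≤-trans (min (fromℕ k)) (≡.subst (λ z → proj₁ (lookup ps (fromℕ k)) ≤ T z) (Finₚ.toℕ-fromℕ k) (path-advances (D .isPath (fromℕ k))))
      det≈0 : det (rows ps) ≈ 0#
      det≈0 = expand-zero-column k det (rows ps) (λ j → trans (reflexive (≡.cong (λ f → f k) (lookup-rows ps j)))
        (row-past _ k (ℕₚ.<-≤-trans (ℕₚ.≰⇒> x≰t) (min j))))
    ...   | yes x≤t with lookup ps i ≟ₚ (T k , 0)
    ...     | yes p≡end with Vec.initLast ps
    ...       | ps₀ , p , ≡.refl = hasSum-resp equiv det≈ (hasSum-map (_∷ʳ []) 1# (λ {u} {v} → Vecₚ.∷ʳ-injectiveˡ u v) tupleWeight-∷ʳ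
                  (lgv fuel ps₀ (ℕₚ.<⇒≤ k<k₀) (admissible-init ps₀ p adm) measure₀<))
      where
      t : ℕ
      t = T k
      at-last : lookup (ps₀ ∷ʳ p) (fromℕ k) ≡ p
      at-last = lookup-∷ʳ-fromℕ ps₀ p
      at-init : ∀ j → lookup (ps₀ ∷ʳ p) (inject₁ j) ≡ lookup ps₀ j
      at-init = lookup-∷ʳ-inject₁ ps₀ p
      -- If another point were at (t, 0), the last point, at abscissa ≥ t and inside its cone, would
      -- be squeezed onto (t, 0) as well, against distinctness.
      i-last : i ≡ fromℕ k
      i-last with i Finₚ.≟ fromℕ k
      ... | yes eq = eq
      ... | no i≢  = contradiction (meet (Above.antidiagonal (adm .ordered i (fromℕ k) i<))) (adm .distinct i (fromℕ k) i≢)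
        where
        i< : toℕ i < toℕ (fromℕ k)
        i< = ≡.subst (toℕ i <_) (≡.sym (Finₚ.toℕ-fromℕ k)) (ℕₚ.≤∧≢⇒< (Finₚ.toℕ≤pred[n] i) (λ eq → i≢ (Finₚ.toℕ-injective (≡.trans eq (≡.sym (Finₚ.toℕ-fromℕ k))))))
        l : Point
        l = lookup (ps₀ ∷ʳ p) (fromℕ k)
        t≤ : t ≤ proj₁ l
        t≤ = ≡.subst (λ z → proj₁ z ≤ proj₁ l) p≡end (min (fromℕ k))
        meet : (proj₂ l ≡ 0 × proj₁ l ≤ X) ⊎ proj₁ l ℕ.+ proj₂ l ≤ proj₁ (lookup (ps₀ ∷ʳ p) i) ℕ.+ proj₂ (lookup (ps₀ ∷ʳ p) i) →
          lookup (ps₀ ∷ʳ p) i ≡ l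
        -- The last point may still be at its start; X ≤ t says that no start lies to the right of
        -- the innermost end.
        meet (inj₁ (h≡0 , x≤X)) = ≡.trans p≡end (≡.cong₂ _,_ (ℕₚ.≤-antisym t≤ (ℕₚ.≤-trans x≤X (X≤T k<k₀))) (≡.sym h≡0))
        meet (inj₂ le) = ≡.trans p≡end (≡.cong₂ _,_ (ℕₚ.≤-antisym t≤ (ℕₚ.≤-trans (ℕₚ.m≤m+n _ _) le′))
          (≡.sym (ℕₚ.n≤0⇒n≡0 (ℕₚ.+-cancelˡ-≤ t _ _ (ℕₚ.≤-trans (ℕₚ.+-monoˡ-≤ (proj₂ l) t≤) (≡.subst (proj₁ l ℕ.+ proj₂ l ≤_) (≡.sym (ℕₚ.+-identityʳ t)) le′))))))
          where
          le′ : proj₁ l ℕ.+ proj₂ l ≤ t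
          le′ = ≡.subst (proj₁ l ℕ.+ proj₂ l ≤_) (ℕₚ.+-identityʳ t) (≡.subst (λ z → proj₁ l ℕ.+ proj₂ l ≤ proj₁ z ℕ.+ proj₂ z) p≡end le)
      p≡ : p ≡ (t , 0)
      p≡ = ≡.trans (≡.sym at-last) (≡.trans (≡.cong (lookup (ps₀ ∷ʳ p)) (≡.sym i-last)) p≡end)
      min₀ : ∀ j → t ≤ proj₁ (lookup ps₀ j)
      min₀ j = ≡.subst₂ (λ a b → proj₁ a ≤ proj₁ b) p≡end (at-init j) (min (inject₁ j))
      apart₀ : ∀ j → lookup ps₀ j ≢ (t , 0)
      apart₀ j eq = adm .distinct (inject₁ j) i (λ e → Finₚ.fromℕ≢inject₁ (≡.trans (≡.sym i-last) (≡.sym e)))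
        (≡.trans (at-init j) (≡.trans eq (≡.sym p≡end)))
      -- The other points have abscissa ≥ t and are not (t, 0), so only the 1 in the last row
      -- survives in the last column.
      column : ∀ j → lookup (rows ps₀) j k ≈ 0#
      column j = trans (reflexive (≡.cong (λ f → f k) (lookup-rows ps₀ j))) (zero-entry (lookup ps₀ j) (min₀ j) (apart₀ j))
        where
        zero-entry : ∀ q → t ≤ proj₁ q → q ≢ (t , 0) → row q k ≈ 0#
        zero-entry (x , h) t≤x ≢end with ℕₚ.m≤n⇒m<n∨m≡n t≤x
        zero-entry (x , h)     t≤x ≢end | inj₁ t<x    = row-past h k t<x
        zero-entry (x , zero)  t≤x ≢end | inj₂ ≡.refl = contradiction ≡.refl ≢end
        zero-entry (x , suc h) t≤x ≢end | inj₂ ≡.refl = row-column h k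
      det≈ : 1# * det (rows ps₀) ≈ det (rows (ps₀ ∷ʳ p))
      det≈ = begin
        1# * det (rows ps₀)             ≈⟨ *-congʳ (trans (reflexive (≡.cong (λ z → row z k) p≡)) (row-end k)) ⟨
        row p k * det (rows ps₀)        ≈⟨ expand-last-row k det (rows ps₀) (row p) column ⟨
        expand k det (rows ps₀ ∷ʳ row p) ≡⟨ ≡.cong (expand k det) (Vecₚ.map-∷ʳ row p ps₀) ⟨
        det (rows (ps₀ ∷ʳ p))           ∎
      -- Nothing moves here, but C exceeds every T i, so the removed point accounted for a positive
      -- amount.
      measure₀< : measure ps₀ < fuel
      measure₀< = ℕₚ.<-≤-trans (≡.subst (measure ps₀ <_) (≡.sym (total-∷ʳ (λ q → C ∸ proj₁ q) ps₀ p))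
        (ℕₚ.m<m+n (measure ps₀) (ℕₚ.m<n⇒0<n∸m (≡.subst (λ z → proj₁ z < C) (≡.sym p≡) (T<C k<k₀))))) measure≤
      equiv : ∀ P → (∃[ P₀ ] DisjointPaths steps T ps₀ P₀ × P ≡ P₀ ∷ʳ []) ⇔ DisjointPaths steps T (ps₀ ∷ʳ p) P
      equiv P = mk⇔ extend restrict
        where
        extend : (∃[ P₀ ] DisjointPaths steps T ps₀ P₀ × P ≡ P₀ ∷ʳ []) → DisjointPaths steps T (ps₀ ∷ʳ p) P
        extend (P₀ , D , ≡.refl) = record { isPath = path ; disjoint = disj }
          where
          path : ∀ j → Path steps (lookup (ps₀ ∷ʳ p) j) (lookup (P₀ ∷ʳ []) j) (T (toℕ j) , 0)
          path j with view j
          ... | ‵fromℕ = ≡.subst₂ (λ a b → Path steps a b (T (toℕ (fromℕ k)) , 0)) (≡.sym at-last) (≡.sym (lookup-∷ʳ-fromℕ P₀ []))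
                   (≡.subst (λ a → Path steps a [] _) (≡.trans (≡.cong (λ z → T z , 0) (Finₚ.toℕ-fromℕ k)) (≡.sym p≡)) done)
          ... | ‵inject₁ j′ = ≡.subst₂ (λ a b → Path steps a b (T (toℕ (inject₁ j′)) , 0)) (≡.sym (at-init j′)) (≡.sym (lookup-∷ʳ-inject₁ P₀ [] j′))
                   (≡.subst (λ z → Path steps (lookup ps₀ j′) (lookup P₀ j′) (T z , 0)) (≡.sym (Finₚ.toℕ-inject₁ j′)) (D .isPath j′))
          vs : Fin (suc k) → List Point
          vs j = vertices (lookup (ps₀ ∷ʳ p) j) (lookup (P₀ ∷ʳ []) j)
          vs-last : vs (fromℕ k) ≡ p ∷ []
          vs-last = ≡.cong₂ vertices at-last (lookup-∷ʳ-fromℕ P₀ [])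
          vs-init : ∀ j → vs (inject₁ j) ≡ vertices (lookup ps₀ j) (lookup P₀ j)
          vs-init j = ≡.cong₂ vertices (at-init j) (lookup-∷ʳ-inject₁ P₀ [] j)
          with-last : ∀ j {z} → z ∈ vs (fromℕ k) → z ∈ vs (inject₁ j) → ⊥
          with-last j z∈l z∈j with ≡.subst (_ ∈_) vs-last z∈l
          ... | here ≡.refl = Advance.avoids (ps₀ ∷ʳ p) adm i min (inject₁ j) (lookup (P₀ ∷ʳ []) (inject₁ j))
                  (λ e → Finₚ.fromℕ≢inject₁ (≡.trans (≡.sym i-last) (≡.sym e)))
                  (≡.subst (_∈ _) (≡.trans p≡ (≡.sym p≡end)) z∈j)
          disj : ∀ a b → a ≢ b → Disjoint (vs a) (vs b)
          disj a b a≢b (z∈a , z∈b) with view a | view b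
          ... | ‵fromℕ      | ‵fromℕ      = a≢b ≡.refl
          ... | ‵fromℕ      | ‵inject₁ b′ = with-last b′ z∈a z∈b
          ... | ‵inject₁ a′ | ‵fromℕ      = with-last a′ z∈b z∈a
          ... | ‵inject₁ a′ | ‵inject₁ b′ = D .disjoint a′ b′ (a≢b ∘ ≡.cong inject₁)
                  (≡.subst (_ ∈_) (vs-init a′) z∈a , ≡.subst (_ ∈_) (vs-init b′) z∈b)
        restrict : DisjointPaths steps T (ps₀ ∷ʳ p) P → ∃[ P₀ ] DisjointPaths steps T ps₀ P₀ × P ≡ P₀ ∷ʳ []
        restrict D with Vec.initLast P
        ... | P₀ , ss , ≡.refl = P₀ , record { isPath = path ; disjoint = disj } , ≡.cong (P₀ ∷ʳ_) (path-to-itself last-path)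
          where
          last-path : Path steps p ss p
          last-path = ≡.subst₂ (λ a b → Path steps a b p) at-last (lookup-∷ʳ-fromℕ P₀ ss)
            (≡.subst (Path steps _ _) (≡.trans (≡.cong (λ z → T z , 0) (Finₚ.toℕ-fromℕ k)) (≡.sym p≡)) (D .isPath (fromℕ k)))
          path : ∀ j → Path steps (lookup ps₀ j) (lookup P₀ j) (T (toℕ j) , 0)
          path j = ≡.subst₂ (λ a b → Path steps a b (T (toℕ j) , 0)) (at-init j) (lookup-∷ʳ-inject₁ P₀ ss j)
            (≡.subst (λ z → Path steps (lookup (ps₀ ∷ʳ p) (inject₁ j)) (lookup (P₀ ∷ʳ ss) (inject₁ j)) (T z , 0)) (Finₚ.toℕ-inject₁ j) (D .isPath (inject₁ j)))
          disj : ∀ a b → a ≢ b → Disjoint (vertices (lookup ps₀ a) (lookup P₀ a)) (vertices (lookup ps₀ b) (lookup P₀ b))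
          disj a b a≢b (z∈a , z∈b) = D .disjoint (inject₁ a) (inject₁ b) (a≢b ∘ Finₚ.inject₁-injective)
            (≡.subst (_ ∈_) (≡.sym (vs-init a)) z∈a , ≡.subst (_ ∈_) (≡.sym (vs-init b)) z∈b)
            where
            vs-init : ∀ j → vertices (lookup (ps₀ ∷ʳ p) (inject₁ j)) (lookup (P₀ ∷ʳ ss) (inject₁ j)) ≡ vertices (lookup ps₀ j) (lookup P₀ j)
            vs-init j = ≡.cong₂ vertices (at-init j) (lookup-∷ʳ-inject₁ P₀ ss j)
    lgv (suc fuel) {suc k} ps k<k₀ adm (s≤s measure≤) | i , min | yes x≤t | no p≢end =
      hasSum-resp equiv (sym det≈) (hasSum-⋃ same-step (steps-unique p) branch)
      where
      open Advance ps adm i min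
      -- `row-step` is needed in every column in use. Since T decreases, it suffices that p has not
      -- passed the innermost end and does not sit on it.
      x≤T : ∀ {j} → j < suc k → proj₁ p ≤ T j
      x≤T {j} (s≤s j≤k) with ℕₚ.m≤n⇒m<n∨m≡n j≤k
      ... | inj₁ j<k    = ℕₚ.≤-trans x≤t (ℕₚ.<⇒≤ (T-decreasing j<k k<k₀))
      ... | inj₂ ≡.refl = x≤t
      p≢T : ∀ {j} → j < suc k → p ≢ (T j , 0)
      p≢T {j} (s≤s j≤k) eq with ℕₚ.m≤n⇒m<n∨m≡n j≤k
      ... | inj₁ j<k    = ℕₚ.<⇒≱ (T-decreasing j<k k<k₀) (≡.subst (λ z → proj₁ z ≤ T k) eq x≤t)
      ... | inj₂ ≡.refl = p≢end eq
      Branch : Step → Vec (List Step) (suc k) → Set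
      Branch s P = ∃[ P′ ] DisjointPaths steps T (ps [ i ]≔ move p s) P′ × P ≡ updateAt P′ i (s ∷_)
      value : Step → Carrier
      value s = w s * det (rows (ps [ i ]≔ move p s))
      prepend-injective : ∀ s {P P′ : Vec (List Step) (suc k)} → updateAt P i (s ∷_) ≡ updateAt P′ i (s ∷_) → P ≡ P′
      prepend-injective s {P} {P′} eq = go i P P′ eq
        where
        go : ∀ {k} (i : Fin k) (P P′ : Vec (List Step) k) → updateAt P i (s ∷_) ≡ updateAt P′ i (s ∷_) → P ≡ P′
        go zero    (ss ∷ P) (ss′ ∷ P′) eq = ≡.cong₂ _∷_ (Listₚ.∷-injectiveʳ (Vecₚ.∷-injectiveˡ eq)) (Vecₚ.∷-injectiveʳ eq)
        go (suc i) (ss ∷ P) (ss′ ∷ P′) eq = ≡.cong₂ _∷_ (Vecₚ.∷-injectiveˡ eq) (go i P P′ (Vecₚ.∷-injectiveʳ eq))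
      branch : ∀ {s} → s ∈ steps p → HasSum (tupleWeight w) (Branch s) (value s)
      branch {s} s∈ = hasSum-map (λ P → updateAt P i (s ∷_)) (w s) (prepend-injective s) (tupleWeight-prepend i s) continue
        where
        q′ : Point
        q′ = move p s
        continue : HasSum (tupleWeight w) (DisjointPaths steps T (ps [ i ]≔ q′)) (det (rows (ps [ i ]≔ q′)))
        -- On landing on another point, the tuples disappear because the paths share a vertex, and
        -- the determinant disappears because two rows coincide.
        continue with Finₚ.any? (λ j → ¬? (j Finₚ.≟ i) ×-dec (lookup ps j ≟ₚ q′))
        ... | no free = lgv fuel (ps [ i ]≔ q′) k<k₀ (advance-admissible s s∈ (λ j j≢i eq → free (j , j≢i , eq)))
          (ℕₚ.<-≤-trans (total-update (λ z → C ∸ proj₁ z) ps i q′ closer) measure≤)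
          where
          closer : C ∸ proj₁ (move p s) < C ∸ proj₁ p
          closer = ℕₚ.≤-<-trans (ℕₚ.∸-monoʳ-≤ C (move-advances p s)) (ℕₚ.∸-monoʳ-< ℕₚ.≤-refl (ℕₚ.≤-<-trans x≤t (T<C k<k₀)))
        ... | yes (j , j≢i , eq) = hasSum-resp (λ P → mk⇔ (λ { (() , _) }) (λ D → contradiction D (impossible P))) (sym det≈0)
                       (hasSum-empty {P = λ P → ⊥ × DisjointPaths steps T (ps [ i ]≔ q′) P} (λ { _ (() , _) }))
          where
          impossible : ∀ P → ¬ DisjointPaths steps T (ps [ i ]≔ q′) P
          impossible P D = D .disjoint i j (j≢i ∘ ≡.sym)
            (≡.subst (_∈ vs i) (at-i s s∈) (start∈vertices _ (lookup P i)) , ≡.subst (_∈ vs j) (≡.trans (at-other s s∈ j≢i) eq) (start∈vertices _ (lookup P j)))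
            where
            vs : Fin (suc k) → List Point
            vs a = vertices (lookup (ps [ i ]≔ q′) a) (lookup P a)
          det≈0 : det (rows (ps [ i ]≔ q′)) ≈ 0#
          det≈0 = det-alternating .Alternating.equal-rows {i} {j} (rows (ps [ i ]≔ q′)) (j≢i ∘ ≡.sym)
            (≡.trans (lookup-rows (ps [ i ]≔ q′) i) (≡.trans (≡.cong row (≡.trans (at-i s s∈) (≡.trans (≡.sym eq) (≡.sym (at-other s s∈ j≢i))))) (≡.sym (lookup-rows (ps [ i ]≔ q′) j))))
      same-step : ∀ {s s′ P} → Branch s P → Branch s′ P → s ≡ s′
      same-step (P₁ , _ , ≡.refl) (P₂ , _ , eq) = Listₚ.∷-injectiveˡ
        (≡.trans (≡.sym (Vecₚ.lookup∘updateAt i P₁)) (≡.trans (≡.cong (λ P → lookup P i) eq) (Vecₚ.lookup∘updateAt i P₂)))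
      det≈ : det (rows ps) ≈ sum K (List.map value (steps p))
      det≈ = begin
        det (rows ps)
          ≡⟨ ≡.cong det (≡.sym (Vecₚ.[]≔-lookup (rows ps) i)) ⟩
        det (rows ps [ i ]≔ lookup (rows ps) i)
          ≡⟨ ≡.cong (λ z → det (rows ps [ i ]≔ z)) (lookup-rows ps i) ⟩
        det (rows ps [ i ]≔ row p)
          ≈⟨ det-cong (replace i (rows ps) (λ j j<k → row-step _ _ j (x≤T j<k) (p≢T j<k))) ⟩
        det (rows ps [ i ]≔ combination w (row ∘ move p) (steps p))
          ≈⟨ linear-combination det-alternating i (rows ps) w (row ∘ move p) (steps p) ⟩
        sum K (List.map (λ s → w s * det (rows ps [ i ]≔ row (move p s))) (steps p))
          ≡⟨ ≡.cong (sum K) (Listₚ.map-cong (λ s → ≡.cong (λ v → w s * det v) (Vecₚ.map-[]≔ row ps i)) (steps p)) ⟨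
        sum K (List.map value (steps p)) ∎
        where
        replace : ∀ {n m} (i : Fin n) (v : Vec Row n) {r s : Row} → (∀ j → j < m → r j ≈ s j) →
          Pointwise (λ r s → ∀ j → j < m → r j ≈ s j) (v [ i ]≔ r) (v [ i ]≔ s)
        replace zero    (_ ∷ v) r≈s = r≈s ∷ Pointwise.refl (λ _ _ → refl)
        replace (suc i) (_ ∷ v) r≈s = (λ _ _ → refl) ∷ replace i v r≈s
      equiv : ∀ P → (∃[ s ] s ∈ steps p × Branch s P) ⇔ DisjointPaths steps T ps P
      equiv P = mk⇔ (λ { (s , s∈ , P′ , D , ≡.refl) → prepend-disjoint s s∈ P′ D }) split
        where
        split : DisjointPaths steps T ps P → ∃[ s ] s ∈ steps p × Branch s P
        split D with lookup P i in eq | D .isPath i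
        ... | []     | path = contradiction (stopped path) (p≢T (Finₚ.toℕ<n i))
          where
          stopped : ∀ {a b} → Path steps a [] b → a ≡ b
          stopped done = ≡.refl
        ... | s ∷ ss | step s∈ _ = s , s∈ , P [ i ]≔ ss , behead-disjoint s s∈ (P [ i ]≔ ss) (≡.subst (DisjointPaths steps T ps) P≡ D) , P≡
          where
          P≡ : P ≡ updateAt (P [ i ]≔ ss) i (s ∷_)
          P≡ = ≡.sym (≡.trans (Vecₚ.updateAt-updateAt i P) (Vecₚ.updateAt-id-local i P (≡.sym eq)))

  -- Path counts of the tree as rows

  combination-++ : ∀ {a} {X : Set a} w (r : X → Row) xs ys j →
    combination w r (xs ++ ys) j ≈ combination w r xs j + combination w r ys j
  combination-++ w r []       ys j = sym (+-identityˡ _)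
  combination-++ w r (x ∷ xs) ys j = trans (+-congˡ (combination-++ w r xs ys j)) (sym (+-assoc _ _ _))

  combination-fromMaybe : ∀ {a} {X : Set a} w (r : X → Row) f me j →
    combination w r (fromMaybe f me) j ≈ maybe′ (λ e → w (f e) * r (f e) j) 0# me
  combination-fromMaybe w r f nothing  j = refl
  combination-fromMaybe w r f (just e) j = +-identityʳ _

  downWeights≡ : ∀ y ls h → downWeights y ls h ≡ maybe′ y 0# (downAt ls h)
  downWeights≡ y []             h       = ≡.refl
  downWeights≡ y ((_ , e) ∷ ls) zero    = ≡.refl
  downWeights≡ y ((_ , e) ∷ ls) (suc h) = downWeights≡ y ls h

  flatWeights≡ : ∀ y ls h → flatWeights y ls h ≡ maybe′ y 0# (flatAt ls h)
  flatWeights≡ y []             h       = ≡.refl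
  flatWeights≡ y ((e , _) ∷ ls) zero    = ≡.refl
  flatWeights≡ y ((e , _) ∷ ls) (suc h) = flatWeights≡ y ls h

  maybe-* : ∀ (y : ℕ → Carrier) x me → maybe′ (λ e → y e * x) 0# me ≈ maybe′ y 0# me * x
  maybe-* y x nothing  = sym (zeroˡ x)
  maybe-* y x (just e) = refl

  module Rows (ls : Levels) (y : ℕ → Carrier) (w : Step → Carrier)
    (w-up : w up ≈ 1#) (w-down : ∀ e → w (down e) ≈ y e) (w-flat : ∀ e → w (flat e) ≈ y e) (T : ℕ → ℕ) where
    open Steps ls

    f d : ℕ → Carrier
    f = flatWeights y ls
    d = downWeights y ls

    -- `V` with l + 1 columns counts paths of length l, hence `suc`; truncated subtraction makes the
    -- entry 0 beyond T j.
    row : Point → Row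
    row (x , h) j = V f d δ (suc (T j) ∸ x) h

    private
      here≡1 : ∀ t → suc t ∸ t ≡ 1
      here≡1 t = ℕₚ.m+n∸n≡m 1 t

    row-end : ∀ j → row (T j , 0) j ≈ 1#
    row-end j = trans (reflexive (≡.cong (λ l → V f d δ l 0) (here≡1 (T j)))) (trans (+-congˡ (+-identityʳ _)) (+-identityʳ _))

    row-past : ∀ {x} h j → T j < x → row (x , h) j ≈ 0#
    row-past h j T<x = reflexive (≡.cong (λ l → V f d δ l h) (ℕₚ.m≤n⇒m∸n≡0 T<x))

    row-column : ∀ h j → row (T j , suc h) j ≈ 0#
    row-column h j = trans (reflexive (≡.cong (λ l → V f d δ l (suc h)) (here≡1 (T j))))
      (trans (+-cong (zeroʳ _) (+-identityʳ _)) (+-identityʳ _))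

    row-step : ∀ x h j → x ≤ T j → (x , h) ≢ (T j , 0) →
      row (x , h) j ≈ combination w (row ∘ move (x , h)) (steps (x , h)) j
    row-step x h j x≤T ≢end = begin
      V f d δ (suc (T j) ∸ x) h
        ≡⟨ ≡.cong (λ l → V f d δ l h) (ℕₚ.+-∸-assoc 1 x≤T) ⟩
      below f d δ l h + (V f d δ l (suc h) + level f d δ l h)
        ≈⟨ solve 3 (λ a b c → a :+ (b :+ c) := b :+ (a :+ c)) refl _ _ _ ⟩
      V f d δ l (suc h) + (below f d δ l h + level f d δ l h)
        ≈⟨ +-cong ups≈ (+-cong (downs≈ h ≢end) flats≈) ⟩
      combination w ρ (ups h) j + (combination w ρ (downs h) j + combination w ρ (flats h) j)
        ≈⟨ +-congˡ (combination-++ w ρ (downs h) (flats h) j) ⟨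
      combination w ρ (ups h) j + combination w ρ (downs h ++ flats h) j
        ≈⟨ combination-++ w ρ (ups h) (downs h ++ flats h) j ⟨
      combination w ρ (steps (x , h)) j ∎
      where
      l : ℕ
      l = T j ∸ x
      ρ : Step → Row
      ρ = row ∘ move (x , h)
      ups≈ : V f d δ l (suc h) ≈ combination w ρ (ups h) j
      ups≈ with h ℕₚ.<? length ls
      ... | yes _ = sym (trans (+-identityʳ _) (trans (*-congʳ w-up) (*-identityˡ _)))
      ... | no h≮ = V-above-top {N = length ls} d≈0 f≈0 l (suc h) (s≤s (ℕₚ.≮⇒≥ h≮))
        where
        d≈0 : ∀ h → length ls ≤ h → d h ≈ 0#
        d≈0 h len≤ = reflexive (≡.trans (downWeights≡ y ls h) (≡.cong (maybe′ y 0#)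
          (nth-beyond (List.map proj₂ ls) h (≡.subst (_≤ h) (≡.sym (Listₚ.length-map proj₂ ls)) len≤))))
        f≈0 : ∀ h → length ls ≤ h → f h ≈ 0#
        f≈0 h len≤ = reflexive (≡.trans (flatWeights≡ y ls h) (≡.cong (maybe′ y 0#) (flatAt-beyond ls h len≤)))
      downs≈ : ∀ h → (x , h) ≢ (T j , 0) → below f d δ l h ≈ combination w (row ∘ move (x , h)) (downs h) j
      -- `δ l` is 1 only at the end point (T j, 0), which is excluded.
      downs≈ zero ≢end = δ≈0 l ≡.refl
        where
        δ≈0 : ∀ l′ → l′ ≡ T j ∸ x → δ l′ ≈ 0#
        δ≈0 zero     eq = contradiction (≡.cong (_, 0) (ℕₚ.≤-antisym x≤T (ℕₚ.m∸n≡0⇒m≤n (≡.sym eq)))) ≢end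
        δ≈0 (suc l′) eq = refl
      downs≈ (suc h) _ = begin
        d h * V f d δ l h
          ≡⟨ ≡.cong (_* V f d δ l h) (downWeights≡ y ls h) ⟩
        maybe′ y 0# (downAt ls h) * V f d δ l h
          ≈⟨ maybe-* y _ (downAt ls h) ⟨
        maybe′ (λ e → y e * V f d δ l h) 0# (downAt ls h)
          ≈⟨ weights (downAt ls h) ⟩
        maybe′ (λ e → w (down e) * row (move (x , suc h) (down e)) j) 0# (downAt ls h)
          ≈⟨ combination-fromMaybe w (row ∘ move (x , suc h)) down (downAt ls h) j ⟨
        combination w (row ∘ move (x , suc h)) (downs (suc h)) j ∎
        where
        weights : ∀ me → maybe′ (λ e → y e * V f d δ l h) 0# me ≈ maybe′ (λ e → w (down e) * row (move (x , suc h) (down e)) j) 0# me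
        weights nothing  = refl
        weights (just e) = *-congʳ (sym (w-down e))
      -- For l = 0 a flat step does not fit, and `ℕ.pred 0` columns indeed give the value 0.
      level≈ : ∀ l → level f d δ l h ≈ f h * V f d δ (ℕ.pred l) h
      level≈ zero    = sym (zeroʳ _)
      level≈ (suc l) = refl
      flats≈ : level f d δ l h ≈ combination w ρ (flats h) j
      flats≈ = begin
        level f d δ l h
          ≈⟨ level≈ l ⟩
        f h * V f d δ (ℕ.pred l) h
          ≡⟨ ≡.cong₂ (λ a b → a * V f d δ b h) (flatWeights≡ y ls h) (ℕₚ.pred[m∸n]≡m∸[1+n] (T j) x) ⟩
        maybe′ y 0# (flatAt ls h) * row (suc (suc x) , h) j
          ≈⟨ maybe-* y _ (flatAt ls h) ⟨
        maybe′ (λ e → y e * row (suc (suc x) , h) j) 0# (flatAt ls h)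
          ≈⟨ weights (flatAt ls h) ⟩
        maybe′ (λ e → w (flat e) * ρ (flat e) j) 0# (flatAt ls h)
          ≈⟨ combination-fromMaybe w ρ flat (flatAt ls h) j ⟨
        combination w ρ (flats h) j ∎
        where
        weights : ∀ me → maybe′ (λ e → y e * row (suc (suc x) , h) j) 0# me ≈ maybe′ (λ e → w (flat e) * ρ (flat e) j) 0# me
        weights nothing  = refl
        weights (just e) = *-congʳ (sym (w-flat e))

  -- Hankel determinants

  descending : ∀ {a} {X : Set a} → (ℕ → X) → ∀ b → Vec X b
  descending g zero    = []
  descending g (suc b) = g b ∷ descending g b

  descending-∷ʳ : ∀ {a} {X : Set a} (g : ℕ → X) b → descending g (suc b) ≡ descending (g ∘ suc) b ∷ʳ g 0
  descending-∷ʳ g zero    = ≡.refl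
  descending-∷ʳ g (suc b) = ≡.cong (g (suc b) ∷_) (descending-∷ʳ g b)

  descending≡tabulate : ∀ {a} {X : Set a} (g : ℕ → X) b → descending g b ≡ tabulate (λ i → g (b ∸ suc (toℕ i)))
  descending≡tabulate g zero    = ≡.refl
  descending≡tabulate g (suc b) = ≡.cong (g b ∷_) (descending≡tabulate g b)

  lookup-descending : ∀ {a p} {X : Set a} {P : X → Set p} (g : ℕ → X) b → (∀ i → i < b → P (g i)) → ∀ i → P (lookup (descending g b) i)
  lookup-descending g (suc b) Pg zero    = Pg b ℕₚ.≤-refl
  lookup-descending {P = P} g (suc b) Pg (suc i) = lookup-descending {P = P} g b (λ i i<b → Pg i (ℕₚ.m<n⇒m<1+n i<b)) i

  prodUpTo : (ℕ → Carrier) → ℕ → Carrier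
  prodUpTo π zero    = 1#
  prodUpTo π (suc b) = π 0 * prodUpTo (π ∘ suc) b

  prodUpTo-last : ∀ π b → prodUpTo π (suc b) ≈ prodUpTo π b * π b
  prodUpTo-last π zero    = *-comm _ _
  prodUpTo-last π (suc b) = trans (*-congˡ (prodUpTo-last (π ∘ suc) b)) (sym (*-assoc _ _ _))

  -- Row `g i` stands in position b - 1 - i, so the zeros lie to the right of the diagonal, and
  -- expansion along the last column leaves only `g 0`.
  det-triangular : ∀ b (g : ℕ → Row) π → (∀ i j → i < b → j < b → b ≤ j ℕ.+ i → g i j ≈ 0#) →
    (∀ i → i < b → g i (b ∸ suc i) ≈ π i) → det (descending g b) ≈ prodUpTo π b
  det-triangular zero    g π zeros diagonal = refl
  det-triangular (suc b) g π zeros diagonal = begin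
    det (descending g (suc b))
      ≡⟨ ≡.cong det (descending-∷ʳ g b) ⟩
    expand b det (descending (g ∘ suc) b ∷ʳ g 0)
      ≈⟨ expand-last-row b det (descending (g ∘ suc) b) (g 0)
           (lookup-descending {P = λ r → r b ≈ 0#} (g ∘ suc) b (λ i i<b → zeros (suc i) b (s≤s i<b) ℕₚ.≤-refl (≡.subst (suc b ≤_) (≡.sym (ℕₚ.+-suc b i)) (s≤s (ℕₚ.m≤m+n b i))))) ⟩
    g 0 b * det (descending (g ∘ suc) b)
      ≈⟨ *-cong (diagonal 0 (s≤s z≤n)) (det-triangular b (g ∘ suc) (π ∘ suc)
           (λ i j i<b j<b b≤ → zeros (suc i) j (s≤s i<b) (ℕₚ.m<n⇒m<1+n j<b) (≡.subst (suc b ≤_) (≡.sym (ℕₚ.+-suc j i)) (s≤s b≤)))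
           (λ i i<b → diagonal (suc i) (s≤s i<b))) ⟩
    π 0 * prodUpTo (π ∘ suc) b ∎

  module HankelDeterminant (s : Carrier) (d : ℕ → Carrier) (k : ℕ) where
    private
      W : ℕ → ℕ → Carrier
      W = V 𝟎 d δ

    -- The row of a point at height 2j, lying 2l columns to the left of the
    -- innermost starting point; ρ 0 is the triangular system.
    ρ : ℕ → ℕ → Row
    ρ l j c = s * W (suc (double (l ℕ.+ (k ∸ c)))) (double j)

    LeadingTerm : ℕ → Row → Set _
    LeadingTerm q r = ∃[ t ] Span (descending (ρ 0) q) t × r ≋ ρ 0 q ⊕ t

    leading⇒span : ∀ {q r} → LeadingTerm q r → ∃[ t ] Span (descending (ρ 0) (suc q)) t × r ≋ t
    leading⇒span {q} (t , span , r≈) = ρ 0 q ⊕ t , plus (member zero) (span-weaken span) , r≈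

    -- Two steps to the right express `ρ (suc l) j` by `ρ l` at j + 1, j and j - 1. Two up steps
    -- have weight 1, so the term at j + 1 has coefficient 1 and, after l rounds, the highest row is
    -- `ρ 0 (j + l)`.
    leading : ∀ l j q → q ≡ j ℕ.+ l → LeadingTerm q (ρ l j)
    leading zero j q q≡ with ≡.trans q≡ (ℕₚ.+-identityʳ j)
    ... | ≡.refl = 𝟎 , null , λ _ → sym (+-identityʳ _)
    leading (suc l) zero .(suc l) ≡.refl with leading l 1 (suc l) ≡.refl | leading⇒span (leading l 0 l ≡.refl)
    ... | t , span , ≈t | u , span′ , ≈u = t ⊕ d 0 ⊙ u , plus span (times (d 0) span′) , λ c → begin
      s * W (3 ℕ.+ double (l ℕ.+ (k ∸ c))) 0
        ≈⟨ *-congˡ (two-steps-base {𝟎} {d} {δ} (suc (double (l ℕ.+ (k ∸ c)))) refl) ⟩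
      s * (0# + (W (suc (double (l ℕ.+ (k ∸ c)))) 2 + (0# + d 0) * W (suc (double (l ℕ.+ (k ∸ c)))) 0))
        ≈⟨ *-congˡ (trans (+-identityˡ _) (+-congˡ (*-congʳ (+-identityˡ _)))) ⟩
      s * (W (suc (double (l ℕ.+ (k ∸ c)))) 2 + d 0 * W (suc (double (l ℕ.+ (k ∸ c)))) 0)
        ≈⟨ solve 4 (λ s x d y → s :* (x :+ d :* y) := s :* x :+ d :* (s :* y)) refl s _ (d 0) _ ⟩
      ρ l 1 c + d 0 * ρ l 0 c
        ≈⟨ +-cong (≈t c) (*-congˡ (≈u c)) ⟩
      ρ 0 (suc l) c + t c + d 0 * u c
        ≈⟨ +-assoc _ _ _ ⟩
      ρ 0 (suc l) c + (t c + d 0 * u c) ∎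
    leading (suc l) (suc j) .(suc j ℕ.+ suc l) ≡.refl rewrite ℕₚ.+-suc j l
      with leading l (2 ℕ.+ j) (2 ℕ.+ j ℕ.+ l) ≡.refl | leading⇒span (leading l (suc j) (suc j ℕ.+ l) ≡.refl) | leading⇒span (leading l j (j ℕ.+ l) ≡.refl)
    ... | t , span , ≈t | u , span′ , ≈u | u′ , span″ , ≈u′ =
      t ⊕ (b ⊙ u ⊕ e ⊙ u′) , plus span (plus (times b span′) (times e (span-weaken span″))) , λ c → begin
      s * W (3 ℕ.+ double (l ℕ.+ (k ∸ c))) (2 ℕ.+ double j)
        ≈⟨ *-congˡ (two-steps {𝟎} {d} {δ} (suc (double (l ℕ.+ (k ∸ c)))) (double j) refl refl refl) ⟩
      s * (W (suc (double (l ℕ.+ (k ∸ c)))) (4 ℕ.+ double j) + (b * W (suc (double (l ℕ.+ (k ∸ c)))) (2 ℕ.+ double j) + e * W (suc (double (l ℕ.+ (k ∸ c)))) (double j)))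
        ≈⟨ solve 6 (λ s x b y e z → s :* (x :+ (b :* y :+ e :* z)) := s :* x :+ (b :* (s :* y) :+ e :* (s :* z))) refl s _ b _ e _ ⟩
      ρ l (2 ℕ.+ j) c + (b * ρ l (suc j) c + e * ρ l j c)
        ≈⟨ +-cong (≈t c) (+-cong (*-congˡ (≈u c)) (*-congˡ (≈u′ c))) ⟩
      ρ 0 (2 ℕ.+ j ℕ.+ l) c + t c + (b * u c + e * u′ c)
        ≈⟨ +-assoc _ _ _ ⟩
      ρ 0 (2 ℕ.+ j ℕ.+ l) c + (t c + (b * u c + e * u′ c)) ∎
      where
      b e : Carrier
      b = d (2 ℕ.+ double j) + d (1 ℕ.+ double j)
      e = d (1 ℕ.+ double j) * d (double j)

    -- The corrections to a row have smaller index and so come after it in descending order, as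
    -- `Unitriangular` demands.
    reduction : ∀ b → Unitriangular (descending (λ l → ρ l 0) b) (descending (ρ 0) b)
    reduction zero    = []
    reduction (suc b) = let (_ , span , u≈) = leading b 0 b ≡.refl in (span , u≈) ∷ reduction b

    hankel≈ : det (descending (λ l → ρ l 0) (suc k)) ≈ prodUpTo (λ j → s * descent d (double j)) (suc k)
    hankel≈ = trans (unitriangular det-alternating (reduction (suc k))) (det-triangular (suc k) (ρ 0) _ zeros diagonal)
      where
      double-mono : ∀ {a b} → a ≤ b → double a ≤ double b
      double-mono z≤n       = z≤n
      double-mono (s≤s a≤b) = s≤s (s≤s (double-mono a≤b))
      -- Descending from height 2i takes 2i columns, more than the 2(k - j) available.
      zeros : ∀ i j → i < suc k → j < suc k → suc k ≤ j ℕ.+ i → ρ 0 i j ≈ 0#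
      zeros i j _ (s≤s j≤k) k<j+i = trans (*-congˡ (V-short (suc (double (k ∸ j))) (double i)
        (ℕₚ.≤-trans (ℕₚ.n≤1+n _) (double-mono {suc (k ∸ j)} (≡.subst (_≤ i) (ℕₚ.+-∸-assoc 1 j≤k) (ℕₚ.m≤n+o⇒m∸n≤o (suc k) j k<j+i)))))) (zeroʳ s)
      diagonal : ∀ i → i < suc k → ρ 0 i (k ∸ i) ≈ s * descent d (double i)
      diagonal i (s≤s i≤k) = *-congˡ (trans (reflexive (≡.cong (λ l → W (suc (double l)) (double i)) (ℕₚ.m∸[m∸n]≡n i≤k))) (V-descent {𝟎} {d} (double i)))

  module _ {r : ℕ} {Q : ℕ → ℕ → Carrier} (QS : NonZeroQSystem r Q) where
    open NonZeroQSystem QS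
    open Chain QS

    prod-pivots : ∀ t k → k ≤ r → prodUpTo (pivot t) (suc k) ≈ Q (suc k) (k ℕ.+ t)
    prod-pivots t zero    _   = trans (*-identityʳ _) (*-identityʳ _)
    prod-pivots t (suc k) k<r = begin
      prodUpTo (pivot t) (suc (suc k))           ≈⟨ prodUpTo-last (pivot t) (suc k) ⟩
      prodUpTo (pivot t) (suc k) * pivot t (suc k) ≈⟨ *-congʳ (prod-pivots t k (ℕₚ.<⇒≤ k<r)) ⟩
      Q (suc k) (k ℕ.+ t) * pivot t (suc k)      ≈⟨ *-comm _ _ ⟩
      pivot t (suc k) * Q (suc k) (k ℕ.+ t)      ≈⟨ pivot-ratio t k k<r ⟩
      Q (suc (suc k)) (suc (k ℕ.+ t))            ∎

    hankel : ℕ → ℕ → ℕ → Row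
    hankel t k l c = Q 1 (t ℕ.+ (l ℕ.+ (k ∸ c)))

    hankel-determinant : ∀ t k → k ≤ r → det (descending (hankel t k) (suc k)) ≈ Q (suc k) (k ℕ.+ t)
    hankel-determinant t k k≤r = begin
      det (descending (hankel t k) (suc k))
        ≈⟨ det-alternating .Alternating.cong (rows≋ (suc k)) ⟨
      det (descending (λ l → ρ l 0) (suc k))
        ≈⟨ hankel≈ ⟩
      prodUpTo (pivot t) (suc k)
        ≈⟨ prod-pivots t k k≤r ⟩
      Q (suc k) (k ℕ.+ t) ∎
      where
      open HankelDeterminant (Q 1 t) (fundamental t) k
      rows≋ : ∀ b → descending (λ l → ρ l 0) b ≋ᵛ descending (hankel t k) b
      rows≋ zero    = []
      rows≋ (suc b) = (λ c → fundamental-moments t (b ℕ.+ (k ∸ c))) ∷ rows≋ b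

  -- From the tree to the path formula

  module PathFormula (r′ : ℕ) (R : ℕ → ℤ → Carrier) (qs : IsQSystem K (suc r′) R)
    (nz : ∀ α n → α ≤ suc (suc r′) → NonZero (R α n))
    (m : ℕ → ℤ) (asc : AscendingMotzkin (suc r′) m) (m₁≡0 : m 1 ≡ + 0) where
    open Weights K R m using (y; y-odd; y-even)
    open PathWeights K R m using (stepWeight)
    open Shape r′ m

    r : ℕ
    r = suc r′

    Q : ℕ → ℕ → Carrier
    Q α i = R α (+ i)

    QS : NonZeroQSystem r Q
    QS = record
      { left-boundary  = λ i → IsQSystem.left-boundary qs (+ i)
      ; right-boundary = λ i → IsQSystem.right-boundary qs (+ i)
      ; recursion      = λ a i a<r → trans
          (*-congʳ (reflexive (≡.cong (λ j → R (suc a) (+ j)) (≡.sym (ℕₚ.+-comm (suc i) 1)))))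
          (IsQSystem.recursion qs (suc a) (+ suc i) (s≤s z≤n) a<r)
      ; nonZero        = λ a i a≤ → nz a (+ i) a≤
      }
    open EdgeWeights QS
    open Chain QS

    M : ℕ → ℕ
    M a = ∣ m a ∣

    m≡+M : ∀ a → a < r → m (suc a) ≡ + M (suc a)
    m≡+M zero    _   = ≡.trans m₁≡0 (≡.cong (λ z → + ∣ z ∣) (≡.sym m₁≡0))
    m≡+M (suc a) a<r with asc (suc a) (s≤s z≤n) a<r
    ... | inj₁ eq = ≡.trans eq (≡.trans (m≡+M a (ℕₚ.<⇒≤ a<r)) (≡.cong (λ z → + ∣ z ∣) (≡.sym eq)))
    ... | inj₂ eq rewrite eq | m≡+M a (ℕₚ.<⇒≤ a<r) = ≡.refl

    m≡+M′ : ∀ a → 1 ≤ a → a ≤ r → m a ≡ + M a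
    m≡+M′ (suc a) _ a<r = m≡+M a a<r

    same : ∀ a → 1 ≤ a → a < r → m (suc a) ≡ m a → M (suc a) ≡ M a
    same a _ _ eq = ≡.cong ∣_∣ eq

    rise : ∀ a → 1 ≤ a → a < r → ¬ m (suc a) ≡ m a → M (suc a) ≡ suc (M a)
    rise a 1≤a a<r neq with asc a 1≤a a<r
    ... | inj₁ eq = contradiction eq neq
    ... | inj₂ eq = ≡.trans (≡.cong ∣_∣ (≡.trans eq (≡.cong (ℤ._+ + 1) (m≡+M′ a 1≤a (ℕₚ.<⇒≤ a<r))))) (ℕₚ.+-comm (M a) 1)

    y-odd-label : ∀ a → y (suc (double a)) ≡ y-odd (suc a)
    y-odd-label a rewrite parity-odd a = ≡.cong (λ b → y-odd (suc b)) (⌊double/2⌋ a)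

    y-even-label : ∀ a → y (double a) ≡ y-even a
    y-even-label a rewrite parity-double a = ≡.cong y-even (⌊double/2⌋ a)

    lam≡ : ∀ α {z} i → z ≡ + i → Weights.lam K R m α z ≡ lam α i
    lam≡ α i ≡.refl = ≡.cong (λ j → R α (+ j) ÷ R α (+ i)) (ℕₚ.+-comm i 1)

    y-hor : ∀ a → 1 ≤ a → a < r → m (suc a) ≡ m a → y (suc (double a)) ≈ hor a (M a)
    y-hor a 1≤a a<r eq = reflexive (≡.trans (y-odd-label a)
      (≡.cong₂ _÷_ (lam≡ (suc a) (M a) (≡.trans eq (m≡+M′ a 1≤a (ℕₚ.<⇒≤ a<r)))) (lam≡ a (M a) (m≡+M′ a 1≤a (ℕₚ.<⇒≤ a<r)))))

    y-ver : ∀ a → 1 ≤ a → a < r → ¬ m (suc a) ≡ m a → y (suc (double a)) ≈ ver a (M a)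
    y-ver a 1≤a a<r neq = reflexive (≡.trans (y-odd-label a)
      (≡.cong₂ _÷_ (lam≡ (suc a) (suc (M a)) (≡.trans (m≡+M a a<r) (≡.cong +_ (rise a 1≤a a<r neq)))) (lam≡ a (M a) (m≡+M′ a 1≤a (ℕₚ.<⇒≤ a<r)))))

    -- `m (suc r)` is arbitrary, but λ(r+1,n) is 1 for every n, so the index that `ver` expects may
    -- be put in its place.
    y-top : y (suc (double r)) ≈ ver r (M r)
    y-top = trans (reflexive (y-odd-label r)) (÷-cong
      (trans (trans (÷-cong (right _) (right _)) (x÷1≈x 1#)) (sym (trans (÷-cong (right _) (right _)) (x÷1≈x 1#))))
      (reflexive (lam≡ r (M r) (m≡+M r′ ℕₚ.≤-refl))))
      where
      right : ∀ n → R (suc r) n ≈ 1#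
      right = IsQSystem.right-boundary qs

    y-evn : ∀ a → a < r → y (double (suc a)) ≈ evn a (M (suc a))
    y-evn a a<r = reflexive (≡.trans (y-even-label (suc a)) (lemma (m (suc a)) (m≡+M a a<r)))
      where
      lemma : ∀ z {i} → z ≡ + i → Weights.mu K R m (suc (suc a)) (z ℤ.+ + 1) ÷ Weights.mu K R m (suc a) z ≡ evn a i
      lemma z {i} ≡.refl = ≡.cong (λ j → (R (suc (suc a)) (+ j) ÷ R (suc a) (+ j)) ÷ (R (suc a) (+ i) ÷ R a (+ i))) (ℕₚ.+-comm i 1)

    -- All straightening takes place above edge 2; the two lowest edges are put back by
    -- `Equivalent-cons`, and m₁ = 0 makes t = 0.
    tree∼fundamental : Equivalent (flatWeights y levels) (downWeights y levels) 𝟎 (fundamental 0)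
    tree∼fundamental = Equivalent-trans
      (Equivalent-cons (Equivalent-cons (blocks∼maximal m M y same rise y-hor y-ver y-top y-evn r′ 1 ℕₚ.≤-refl ≡.refl)))
      (Equivalent-reflexive flat≋ (cons-cong y₁≈ (cons-cong y₂≈ (λ h → reflexive (≡.cong (λ n → maximal 1 n h) M₁≡0)))))
      where
      M₁≡0 : M 1 ≡ 0
      M₁≡0 = ≡.cong ∣_∣ m₁≡0
      flat≋ : cons 0# (cons 0# 𝟎) ≋ 𝟎
      flat≋ zero          = refl
      flat≋ (suc zero)    = refl
      flat≋ (suc (suc h)) = refl
      y₁≈ : y 1 ≈ lam 1 0
      y₁≈ = trans (÷-cong (reflexive (lam≡ 1 0 m₁≡0)) (trans (÷-cong (IsQSystem.left-boundary qs _) (IsQSystem.left-boundary qs _)) (x÷1≈x 1#))) (x÷1≈x _)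
      y₂≈ : y 2 ≈ Evn 0 0
      y₂≈ = trans (y-evn 0 (s≤s z≤n)) (trans (reflexive (≡.cong (evn 0) M₁≡0)) (sym (Evn≈evn 0 (s≤s z≤n))))

    moments : ∀ j → Q 1 0 * V (flatWeights y levels) (downWeights y levels) δ (suc (double j)) 0 ≈ Q 1 j
    moments j = trans (*-congˡ (tree∼fundamental δ (suc (double j)))) (fundamental-moments 0 j)

    module _ (t k : ℕ) (k≤r′ : k ≤ r′) where
      -- There are `suc k` paths, so n = t + k encodes the lower bound on n; t is the index at which
      -- the Hankel matrix starts.
      n : ℕ
      n = t ℕ.+ k

      T : ℕ → ℕ
      T i = proj₁ (E (suc k) n (suc i))

      starts : Vec Point (suc k)
      starts = tabulate (λ i → A (suc (toℕ i)))

      A≡ : ∀ i → 2 ℕ.* suc i ∸ 2 ≡ i ℕ.+ i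
      A≡ i = ≡.cong (_∸ 2) (lemma i)
        where
        lemma : ∀ i → 2 ℕ.* suc i ≡ 2 ℕ.+ (i ℕ.+ i)
        lemma = ℕSolver.solve-∀

      T≡ : ∀ i → i ≤ k → T i ≡ 2 ℕ.* n ℕ.+ 2 ℕ.* (k ∸ i)
      T≡ i i≤k = ≡.trans (≡.cong (_∸ 2 ℕ.* suc i) (≡.trans (≡.cong (λ z → 2 ℕ.* n ℕ.+ 2 ℕ.* suc z) (≡.sym (ℕₚ.m+[n∸m]≡n i≤k))) (lemma n i (k ∸ i))))
        (ℕₚ.m+n∸m≡n (2 ℕ.* suc i) _)
        where
        lemma : ∀ n i j → 2 ℕ.* n ℕ.+ 2 ℕ.* suc (i ℕ.+ j) ≡ 2 ℕ.* suc i ℕ.+ (2 ℕ.* n ℕ.+ 2 ℕ.* j)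
        lemma = ℕSolver.solve-∀

      -- The distance depends only on the sum of k - i and k - c, which makes the matrix of path
      -- counts Hankel.
      gap≡ : ∀ i c → i ≤ k → c ≤ k → suc (T c) ∸ (2 ℕ.* suc i ∸ 2) ≡ suc (double (t ℕ.+ ((k ∸ i) ℕ.+ (k ∸ c))))
      gap≡ i c i≤k c≤k = ≡.trans (≡.cong₂ (λ a b → suc a ∸ b) (T≡ c c≤k) (A≡ i))
        (≡.trans (≡.cong (_∸ (i ℕ.+ i)) (≡.trans (≡.cong (λ z → suc (2 ℕ.* (t ℕ.+ z) ℕ.+ 2 ℕ.* (k ∸ c))) (≡.sym (ℕₚ.m+[n∸m]≡n i≤k))) (lemma t i (k ∸ i) (k ∸ c))))
        (≡.trans (ℕₚ.m+n∸m≡n (i ℕ.+ i) _) (≡.cong suc (2*≡double (t ℕ.+ ((k ∸ i) ℕ.+ (k ∸ c)))))))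
        where
        lemma : ∀ t i i′ c′ → suc (2 ℕ.* (t ℕ.+ (i ℕ.+ i′)) ℕ.+ 2 ℕ.* c′) ≡ i ℕ.+ i ℕ.+ suc (2 ℕ.* (t ℕ.+ (i′ ℕ.+ c′)))
        lemma = ℕSolver.solve-∀

      T-decreasing : ∀ {i j} → i < j → j < suc k → T j < T i
      T-decreasing {i} {j} i<j j≤k = ℕₚ.∸-monoʳ-< (ℕₚ.*-monoʳ-< 2 (s≤s i<j)) (ℕₚ.m≤n⇒m≤o+n (2 ℕ.* n) (ℕₚ.*-monoʳ-≤ 2 j≤k))

      -- The innermost path runs from abscissa 2k to 2n, and n ≥ k.
      2k≤T : ∀ {i} → i < suc k → 2 ℕ.* k ≤ T i
      2k≤T {i} (s≤s i≤k) = ≡.subst (2 ℕ.* k ≤_) (≡.sym (T≡ i i≤k)) (ℕₚ.m≤n⇒m≤n+o _ (ℕₚ.*-monoʳ-≤ 2 (ℕₚ.m≤n+m k t)))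

      T<C : ∀ {i} → i < suc k → T i < suc (2 ℕ.* n ℕ.+ 2 ℕ.* suc k)
      T<C {i} _ = s≤s (ℕₚ.m∸n≤m _ (2 ℕ.* suc i))

      open Rows levels y stepWeight refl (λ _ → refl) (λ _ → refl) T
      open Steps levels
      open LGV stepWeight steps steps-unique no-descent-below-0 (suc k) T (2 ℕ.* k) (suc (2 ℕ.* n ℕ.+ 2 ℕ.* suc k))
        T-decreasing 2k≤T T<C row row-end row-past row-column row-step

      starts-admissible : Admissible (2 ℕ.* k) starts
      starts-admissible = record
        { onGrid   = λ i → ≡.subst OnGrid (≡.sym (at i)) (toℕ i , ≡.trans (ℕₚ.+-identityʳ _) (A≡ (toℕ i)))
        ; distinct = λ i j i≢j eq → i≢j (Finₚ.toℕ-injective (half (toℕ i) (toℕ j)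
            (≡.trans (≡.sym (A≡ (toℕ i))) (≡.trans (≡.cong proj₁ (≡.trans (≡.sym (at i)) (≡.trans eq (at j)))) (A≡ (toℕ j))))))
        ; ordered  = λ i j i<j → ≡.subst₂ (Above (2 ℕ.* k)) (≡.sym (at i)) (≡.sym (at j))
            (above (ℕₚ.∸-monoˡ-≤ 2 (ℕₚ.*-monoʳ-≤ 2 (s≤s (ℕₚ.<⇒≤ i<j))))
                   (inj₁ (≡.refl , ≡.subst (_≤ 2 ℕ.* k) (≡.sym (A≡ (toℕ j))) (bound (Finₚ.toℕ≤pred[n] j)))))
        }
        where
        at : ∀ i → lookup starts i ≡ A (suc (toℕ i))
        at = Vecₚ.lookup∘tabulate (λ i → A (suc (toℕ i)))
        half : ∀ a b → a ℕ.+ a ≡ b ℕ.+ b → a ≡ b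
        half a b eq = double-injective (≡.trans (≡.sym (2*≡double a)) (≡.trans (≡.cong (a ℕ.+_) (ℕₚ.+-identityʳ a))
          (≡.trans eq (≡.trans (≡.cong (b ℕ.+_) (≡.sym (ℕₚ.+-identityʳ b))) (2*≡double b)))))
        bound : ∀ {j} → j ≤ k → j ℕ.+ j ≤ 2 ℕ.* k
        bound {j} j≤k = ≡.subst (j ℕ.+ j ≤_) (≡.cong (k ℕ.+_) (≡.sym (ℕₚ.+-identityʳ k))) (ℕₚ.+-mono-≤ j≤k j≤k)

      disjoint⇔ : ∀ P → DisjointPaths steps T starts P ⇔ NonIntersecting r m (suc k) n P
      disjoint⇔ P = mk⇔
        (λ D → record
          { isPath   = λ i → Path⇒IsPath r′ m (≡.subst (λ p → Path steps p (lookup P i) (T (toℕ i) , 0)) (at i) (DisjointPaths.isPath D i))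
          ; disjoint = λ i j i≢j → ≡.subst₂ (λ p q → Disjoint (vertices p (lookup P i)) (vertices q (lookup P j))) (at i) (at j) (DisjointPaths.disjoint D i j i≢j) })
        (λ D → record
          { isPath   = λ i → ≡.subst (λ p → Path steps p (lookup P i) (T (toℕ i) , 0)) (≡.sym (at i)) (IsPath⇒Path r′ m (NonIntersecting.isPath D i))
          ; disjoint = λ i j i≢j → ≡.subst₂ (λ p q → Disjoint (vertices p (lookup P i)) (vertices q (lookup P j))) (≡.sym (at i)) (≡.sym (at j)) (NonIntersecting.disjoint D i j i≢j) })
        where
        at : ∀ i → lookup starts i ≡ A (suc (toℕ i))
        at = Vecₚ.lookup∘tabulate (λ i → A (suc (toℕ i)))

      determinant : Q 1 0 ^ suc k * det (rows starts) ≈ Q (suc k) n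
      determinant = begin
        Q 1 0 ^ suc k * det (rows starts)
          -- Each row takes one factor R(1,0), which turns its path counts into moments.
          ≈⟨ det-scale (Q 1 0) (rows starts) ⟨
        det (Vec.map (Q 1 0 ⊙_) (rows starts))
          ≡⟨ ≡.cong (det {suc k}) scaled≡ ⟨
        det {suc k} (tabulate scaled)
          ≈⟨ det-cong {suc k} (Pointwise.tabulate⁺ entries) ⟩
        det {suc k} (tabulate moment-rows)
          ≡⟨ ≡.cong (det {suc k}) (descending≡tabulate (hankel QS t k) (suc k)) ⟨
        det (descending (hankel QS t k) (suc k))
          ≈⟨ hankel-determinant QS t k (ℕₚ.m≤n⇒m≤1+n k≤r′) ⟩
        Q (suc k) (k ℕ.+ t)
          ≡⟨ ≡.cong (Q (suc k)) (ℕₚ.+-comm k t) ⟩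
        Q (suc k) n ∎
        where
        scaled moment-rows : Fin (suc k) → Row
        scaled i = Q 1 0 ⊙ row (A (suc (toℕ i)))
        moment-rows i = hankel QS t k (k ∸ toℕ i)
        scaled≡ : tabulate scaled ≡ Vec.map (Q 1 0 ⊙_) (rows starts)
        scaled≡ = ≡.trans (Vecₚ.tabulate-∘ (Q 1 0 ⊙_) (λ i → row (A (suc (toℕ i)))))
          (≡.cong (Vec.map (Q 1 0 ⊙_)) (Vecₚ.tabulate-∘ row (λ i → A (suc (toℕ i)))))
        entries : ∀ i c → c < suc k → scaled i c ≈ moment-rows i c
        entries i c (s≤s c≤k) = trans
          (*-congˡ (reflexive (≡.cong (λ l → V (flatWeights y levels) (downWeights y levels) δ l 0) (gap≡ (toℕ i) c (Finₚ.toℕ≤pred[n] i) c≤k))))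
          (moments (t ℕ.+ ((k ∸ toℕ i) ℕ.+ (k ∸ c))))

      path-formula : ∃[ L ] Enumerates L (NonIntersecting r m (suc k) n) ×
        R (suc k) (+ n) ≈ R 1 (+ 0) ^ suc k * sum K (map (PathWeights.tupleWeight K R m) L)
      path-formula = let (L , enum , det≈) = hasSum-resp disjoint⇔ refl (lgv _ starts ℕₚ.≤-refl starts-admissible ℕₚ.≤-refl)
        in L , enum , trans (sym determinant) (*-congˡ det≈)

mainTheorem13 : ∀ {c ℓ} (K : Field c ℓ) → let open Field K in
    (r : ℕ) → 1 ≤ r →
    (R : ℕ → ℤ → Carrier) → IsQSystem K r R →
    (m₀ : ℕ → ℤ) → AscendingMotzkin r m₀ →
    AlgebraicallyIndependent K (initialData K r R m₀) →
    (m : ℕ → ℤ) → AscendingMotzkin r m → m 1 ≡ + 0 →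
    (k n : ℕ) → 1 ≤ k → k ≤ r → k ∸ 1 ≤ n →
    ∃[ L ] Enumerates L (NonIntersecting r m k n) ×
    R k (+ n) ≈ R 1 (+ 0) ^ k * sum K (map (PathWeights.tupleWeight K R m) L)
mainTheorem13 K (suc r′) _ R qs m₀ asc₀ indep m asc m₁≡0 (suc k) n _ (s≤s k≤r′) k≤n =
  ≡.subst (λ n → ∃[ L ] Enumerates L (NonIntersecting (suc r′) m (suc k) n) ×
      R (suc k) (+ n) ≈ R 1 (+ 0) ^ suc k * sum K (map (PathWeights.tupleWeight K R m) L))
    (ℕₚ.m∸n+n≡m k≤n)
    -- Independence is given along m₀, the tree along m; the link is that every R(α,n) with α ≤ r +
    -- 1 is nonzero.
    (PathFormula.path-formula r′ R qs (Propagation.nonZero (suc r′) R qs m₀ asc₀ indep) m asc m₁≡0 (n ∸ k) k k≤r′)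
  where
  open Field K
  open OverField K
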